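{- Let $\lambda_2$ be a positive integer. The average case complexity of the Novelli--Pak--Stoyanovskii algorithm on the partition $(\lambda_2,\lambda_2)$ is $$C(\lambda_2,\lambda_2)=\frac{\lambda_2(\lambda_2-2)}{2}-2\left(-\frac{2^{2\lambda_2}}{\binom{2\lambda_2}{\lambda_2}}+\frac{H_{\lambda_2}}{2}+1\right).$$
   Context: $H_m=\sum_{\ell=1}^m\frac1\ell$ denotes the $m$-th harmonic number. A partition $\lambda$ of $n$ is identified with its Young diagram $\{(i,j):1\le i\le l(\lambda),\ 1\le j\le\lambda_i\}$ ($l(\lambda)$ is the number of parts), whose elements are called cells. A cell $(i,j)$ is a corner of $\lambda$ if neither $(i+1,j)$ nor $(i,j+1)$ belongs to $\lambda$. A tableau of shape $\lambda$ is a bijection $T:\lambda\to\{1,\dots,n\}$; the set of tableaux is $\mathrm{T}(\lambda)$. The (column-wise) Novelli--Pak--Stoyanovskii (NPS) algorithm applied to $T\in \mathrm{T}(\lambda)$: order cells by $(i,j)\preceq(i',j')$ if $j<j'$, or $j=j'$ and $i\le i'$. Let $(i_1,j_1)\succ\dots\succ(i_n,j_n)$ be the cells of $\lambda$ in decreasing order, put $k_r=T(i_r,j_r)$ (entries of the initial tableau) and $T_0=T$. For $r=1,\dots,n$ the tableau $T_r$ is obtained from $T_{r-1}$ as follows. Start with the current tableau equal to $T_{r-1}$ and repeat: let $(i,j)$ be the cell of the current tableau containing $k_r$. If $(i,j)$ is a corner of $\lambda$, stop. Otherwise let $m$ be the minimum of the entries of the current tableau in the cells of $\lambda\cap\{(i+1,j),(i,j+1)\}$.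 If $k_r<m$, stop. If $m<k_r$, exchange the entries $m$ and $k_r$ (one exchange) and repeat. When stopped, $T_r$ is the current tableau. $n(T)$ is the total number of exchanges performed during the construction of $T_1,\dots,T_n$, and $C(\lambda)=\frac1{n!}\sum_{T\in \mathrm{T}(\lambda)}n(T)$; $C(\lambda_1,\lambda_2)$ means $C(\lambda)$ for $\lambda=(\lambda_1,\lambda_2)$. -}

module Defs where

open import Data.Fin.Base using (Fin; zero; suc; toℕ; fromℕ<)
open import Data.Fin.Permutation using (transpose)
open import Data.Fin.Properties using (_≟_; _<?_; all?; any?; ∀-cons; ≤-totalOrder)
open import Data.Integer.Base using (+_)
open import Data.List.Base
  using (List; []; _∷_; [_]; length; lookup; map; mapMaybe; concatMap;
         allFin; downFrom; cartesianProductWith)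
open import Data.List.Extrema using (min)
open import Data.List.Extrema.Nat using (max)
open import Data.List.Relation.Unary.All using (All; []; _∷_)
open import Data.List.Relation.Unary.Linked using (Linked; [-]; _∷_)
open import Data.Maybe.Base as Maybe using (Maybe; just; nothing)
open import Data.Nat.Base as ℕ using (ℕ; zero; suc; _≤_; _≥_; _!; _∸_; NonZero)
open import Data.Nat.Combinatorics using (_C_; nCk≡n!/k![n-k]!; k![n∸k]!∣n!)
open import Data.Nat.Divisibility using (∣⇒≤)
open import Data.Nat.DivMod using (m≥n⇒m/n>0)
import Data.Nat.Properties as ℕ
open import Data.Nat.ListAction using (sum)
open import Data.Nat.Properties using (_!≢0; _!*_!≢0)
open import Data.Product.Base using (Σ; ∃; _×_; _,_; uncurry; map₁)
open import Data.Product.Properties using (≡-dec)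
open import Data.Rational.Base using (ℚ; 0ℚ; _/_; _+_)
open import Function.Base using (_∘_)
open import Function.Bundles using (_↔_; mk⤖; module Inverse)
open import Function.Construct.Composition using (_↔-∘_)
open import Function.Definitions using (Injective; Surjective; Bijective)
open import Function.Properties.Bijection using (⤖⇒↔)
open import Relation.Binary.Definitions using (DecidableEquality)
open import Relation.Binary.PropositionalEquality using (_≡_; refl; sym; subst)
open import Relation.Nullary.Decidable
  using (Dec; yes; no; map′; _×-dec_; _→-dec_; dec⇒maybe)

H : ℕ → ℚ
H zero    = 0ℚ
H (suc m) = H m + + 1 / suc m

nCk≢0 : ∀ {n k} → k ≤ n → NonZero (n C k)
nCk≢0 {n} {k} k≤n = subst NonZero (sym (nCk≡n!/k![n-k]! k≤n))
  (ℕ.>-nonZero (m≥n⇒m/n>0 (∣⇒≤ (k![n∸k]!∣n! k≤n))))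
  where instance
    _ = n !≢0
    _ = k !* (n ∸ k) !≢0

centralBinomial≢0 : ∀ m → NonZero ((2 ℕ.* m) C m)
centralBinomial≢0 m = nCk≢0 (ℕ.m≤m+n m _)

record Partition : Set where
  field
    parts      : List ℕ
    decreasing : Linked _≥_ parts
    positive   : All (ℕ._> 0) parts

  size : ℕ
  size = sum parts

open Partition public

twoRow : ∀ λ₁ λ₂ → λ₁ ≥ λ₂ → .{{NonZero λ₂}} → Partition
twoRow λ₁ λ₂ λ₁≥λ₂ = record
  { parts      = λ₁ ∷ λ₂ ∷ []
  ; decreasing = λ₁≥λ₂ ∷ [-]
  ; positive   = ℕ.≤-trans 0<λ₂ λ₁≥λ₂ ∷ 0<λ₂ ∷ []
  }
  where 0<λ₂ = ℕ.>-nonZero⁻¹ λ₂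

-- Rows and columns are numbered from 0: (i , j) is the cell usually
-- written (i + 1 , j + 1).
Cell : Partition → Set
Cell μ = Σ (Fin (length (parts μ))) λ i → Fin (lookup (parts μ) i)

-- The value k : Fin (size μ) stands for the entry toℕ k + 1; the algorithm
-- uses only the order of the entries.
Tableau : Partition → Set
Tableau μ = Cell μ ↔ Fin (size μ)

module _ (μ : Partition) where

  private
    n : ℕ
    n = size μ

  open Inverse using (to; from)

  cellAt : ℕ → ℕ → Maybe (Cell μ)
  cellAt i j with i ℕ.<? length (parts μ)
  ... | no  _   = nothing
  ... | yes i<l with j ℕ.<? lookup (parts μ) (fromℕ< i<l)
  ...   | no  _    = nothing
  ...   | yes j<μᵢ = just (fromℕ< i<l , fromℕ< j<μᵢ)

  -- μ ∩ {(i + 1 , j) , (i , j + 1)}; a corner is a cell for which this is [].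
  neighbours : Cell μ → List (Cell μ)
  neighbours (i , j) =
    mapMaybe (uncurry cellAt) ((suc (toℕ i) , toℕ j) ∷ (toℕ i , suc (toℕ j)) ∷ [])

  -- All cells in decreasing column-wise order: columns from right to left,
  -- each column from bottom to top.
  decreasingCells : List (Cell μ)
  decreasingCells = concatMap
    (λ j → mapMaybe (λ i → cellAt i j) (downFrom (length (parts μ))))
    (downFrom (max 0 (parts μ)))

  exchange : Fin n → Fin n → Tableau μ → Tableau μ
  exchange m k T = transpose m k ↔-∘ T

  -- One round of the algorithm, moving the entry k: the number of exchanges
  -- and the resulting tableau.  The first argument bounds the number of
  -- exchanges.  Each exchange moves k one cell down or to the right, so a
  -- round has fewer than n exchanges and the bound n is never reached.
  round : ℕ → Fin n → Tableau μ → ℕ × Tableau μ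
  round zero        k T = 0 , T
  round (suc bound) k T with neighbours (from T k)
  ... | []     = 0 , T
  ... | d ∷ ds with min (≤-totalOrder n) (to T d) (map (to T) ds)
  ...   | m with k <? m
  ...     | yes _ = 0 , T
  ...     | no  _ = map₁ suc (round bound k (exchange m k T))

  rounds : List (Fin n) → Tableau μ → ℕ
  rounds []       T = 0
  rounds (k ∷ ks) T with round n k T
  ... | e , T′ = e ℕ.+ rounds ks T′

  -- n(T); the entries k₁, …, kₙ are read off the initial tableau.
  exchanges : Tableau μ → ℕ
  exchanges T = rounds (map (to T) decreasingCells) T

  _≟ᶜ_ : DecidableEquality (Cell μ)
  _≟ᶜ_ = ≡-dec _≟_ _≟_

  bijective? : (f : Cell μ → Fin n) → Dec (Bijective _≡_ _≡_ f)
  bijective? f = injective? ×-dec surjective?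
    where
    injective? : Dec (Injective _≡_ _≡_ f)
    injective? = map′ (λ inj → inj _ _ _ _) (λ inj _ _ _ _ → inj)
      (all? λ i → all? λ j → all? λ i′ → all? λ j′ →
        (f (i , j) ≟ f (i′ , j′)) →-dec ((i , j) ≟ᶜ (i′ , j′)))
    surjective? : Dec (Surjective _≡_ _≡_ f)
    surjective? = map′
      (λ (sur : ∀ k → ∃ λ i → ∃ λ j → f (i , j) ≡ k) k →
        let i , j , eq = sur k in (i , j) , λ { refl → eq })
      (λ sur k → let (i , j) , eq = sur k in i , j , eq refl)
      (all? λ k → any? λ i → any? λ j → f (i , j) ≟ k)

-- All functions f with f i drawn from xs i for every i.
choices : ∀ {n} {A : Fin n → Set} → (∀ i → List (A i)) → List (∀ i → A i)
choices {zero}  xs = [ (λ ()) ]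
choices {suc n} xs = cartesianProductWith ∀-cons (xs zero) (choices (xs ∘ suc))

fillings : ∀ μ → List (Cell μ → Fin (size μ))
fillings μ = map uncurry (choices λ i → choices λ j → allFin (size μ))

-- T(μ): the bijections among all maps Cell μ → Fin (size μ), each listed once.
tableaux : ∀ μ → List (Tableau μ)
tableaux μ = mapMaybe (λ f → Maybe.map (⤖⇒↔ ∘ mk⤖) (dec⇒maybe (bijective? μ f)))
                      (fillings μ)

complexity : Partition → ℚ
complexity μ = + sum (map (exchanges μ) (tableaux μ)) / (size μ !)
  where instance _ = size μ !≢0

{-# OPTIONS --safe #-}
module Submission where

-- Reading the entries of the processed columns in increasing order, and writing ↑
-- for an entry in the upper and ↓ for one in the lower row, turns the state of the
-- algorithm after n columns into a Dyck path.  A step inserts the two entries of a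
-- further column, which only depends on their ranks.  Every path of semilength n
-- arises from exactly n(n + 1) pairs of a path of semilength n − 1 and two ranks, so
-- the state is uniformly distributed; and summed over these pairs the number of
-- exchanges is n³ + n(n + 1)/2 − ∑ lᵢ², where lᵢ are the semilengths of the
-- excursions from 0.  The sum of ∑ lᵢ² over all paths of semilength n is
-- (n² + 3n + 1) Catₙ − 4ⁿ, by moving a marked excursion to the front and the
-- convolution ∑ C(2i , i) C(2j , j) = 4ⁿ over i + j = n.  This gives the increment of
-- the average from n − 1 to n, and the theorem follows by induction.

open import Defs
open import Data.Empty using (⊥-elim)
open import Data.Fin.Base as Fin using (Fin; zero; suc; toℕ; fromℕ<; punchIn; punchOut)
import Data.Fin.Properties as Fin
open import Data.Fin.Properties
  using (_≟_; ∀-cons; toℕ<n; punchIn-injective; punchInᵢ≢i; punchIn-punchOut; punchIn-mono-≤; punchIn-cancel-≤)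
open import Data.Integer.Base as ℤ using (ℤ; +_)
import Data.Integer.Properties as ℤ
import Data.Integer.Tactic.RingSolver as ℤ-Solver
open import Data.List.Base
  using (List; []; _∷_; _++_; length; lookup; map; mapMaybe; filter; tabulate; allFin; downFrom; drop;
         concatMap; cartesianProductWith)
open import Data.List.Extrema
  using (min; argmin-all; f[argmin]≤v⁺; v≤f[argmin]⁺; f[argmax]≤v⁺; v≤f[argmax]⁺)
open import Data.List.Extrema.Nat using (max)
open import Data.List.Membership.Propositional using (_∈_; lose)
open import Data.List.Membership.Propositional.Properties
  using (∈-cartesianProductWith⁺; ∈-cartesianProductWith⁻; ∈-allFin; ∈-map⁺)
open import Data.List.Membership.Propositional.Properties.WithK using (unique∧set⇒bag)
import Data.List.Membership.Setoid as SetoidMembership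
import Data.List.Membership.Setoid.Properties as SetoidMembership
import Data.List.Properties as List
open import Data.List.Relation.Binary.BagAndSetEquality using (∼bag⇒↭)
open import Data.List.Relation.Binary.Permutation.Propositional
  using (_↭_; ↭-refl; ↭-sym; ↭-trans; ↭-prep; ↭-swap)
open import Data.List.Relation.Binary.Permutation.Propositional.Properties
  using (All-resp-↭; filter-↭; ↭-length; map⁺)
open import Data.List.Relation.Unary.All as All using (All; []; _∷_)
import Data.List.Relation.Unary.All.Properties as All
open import Data.List.Relation.Unary.AllPairs as AllPairs using (AllPairs; []; _∷_)
import Data.List.Relation.Unary.AllPairs.Properties as AllPairs
open import Data.List.Relation.Unary.Any as Any using (Any; here; there)
import Data.List.Relation.Unary.Any.Properties as Any
open import Data.List.Relation.Unary.Unique.Propositional using (Unique)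
import Data.List.Relation.Unary.Unique.Propositional.Properties as Unique
import Data.List.Relation.Unary.Unique.Setoid as SetoidUnique
import Data.List.Relation.Unary.Unique.Setoid.Properties as SetoidUnique
open import Data.Maybe.Base as Maybe using (Maybe; just; nothing)
open import Data.Nat.Base as ℕ using (ℕ; zero; suc; z≤n; s≤s; s<s⁻¹; NonZero; _^_; _!)
open import Data.Nat.Combinatorics using (_C_; nCk≡n!/k![n-k]!)
import Data.Nat.DivMod as ℕ
open import Data.Nat.DivMod using (m*n/n≡m)
open import Data.Nat.Induction using (<-rec)
open import Data.Nat.ListAction using (sum)
open import Data.Nat.ListAction.Properties using (sum-++; sum-↭)
import Data.Nat.Properties as ℕ
open import Data.Nat.Properties using (≤-refl; _!≢0; _!*_!≢0)
open import Data.Nat.Tactic.RingSolver using (solve-∀)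
open import Data.Product.Base using (∃; ∃₂; _×_; _,_; proj₁; proj₂; map₁; uncurry)
open import Data.Rational.Base using (ℚ; 1ℚ; ½; _/_; _+_; _-_; _*_; -_; toℚᵘ)
import Data.Rational.Properties as ℚ
open import Data.Rational.Solver using (module +-*-Solver)
open import Data.Rational.Unnormalised.Base as ℚᵘ using (mkℚᵘ; *≡*; _≃_)
import Data.Rational.Unnormalised.Properties as ℚᵘ
open import Data.Sum.Base using (_⊎_; inj₁; inj₂)
open import Function.Base using (_∘_; id)
open import Function.Bundles using (_⇔_; mk⇔; mk⤖; module Equivalence; module Inverse)
open import Function.Definitions using (Injective; Surjective; Bijective)
open import Function.Properties.Bijection using (⤖⇒↔)
open import Level using (0ℓ)
open import Relation.Binary.Bundles using (Setoid)
open import Relation.Binary.PropositionalEquality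
  using (_≡_; _≢_; refl; sym; trans; cong; cong₂; subst; setoid; module ≡-Reasoning)
open import Relation.Nullary using (¬_; yes; no; contradiction)
open import Relation.Nullary.Decidable using (dec⇒maybe)
open +-*-Solver using (solve; _:+_; _:*_; _:-_; :-_; con; _:=_)
open ≡-Reasoning

-- Lattice paths

-- Both rows of the processed part increase to the right, so the i-th `↑` of the word belongs to its
-- i-th upper entry and the i-th `↓` to its i-th lower entry. The word thus fixes the arrangement up
-- to the values, and the route of a new entry is decided by its rank alone. The lower entry of a
-- new column leaves one `↓` too many, hence a path from height 1; the upper entry restores a path
-- from height 0. The fibre of the step over a given path is found by scanning that path once. What
-- a single `↑` contributes depends on where it stands, but it is the growth of a polynomial in two
-- numbers: how many `↑` have been read, and which `↓`, counted from the start, ends the current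
-- excursion. At the end of the path both are n, so the total does not depend on the path. For the
-- costs this balance fails only at an `↑` that opens an excursion, by the square of its semilength;
-- hence the term ∑ lᵢ². The recurrence of the Catalan numbers is a by-product: it counts the
-- insertions in two ways.

+-interchange : ∀ a b c d → a ℕ.+ b ℕ.+ (c ℕ.+ d) ≡ a ℕ.+ c ℕ.+ (b ℕ.+ d)
+-interchange = solve-∀

∑ : ℕ → (ℕ → ℕ) → ℕ
∑ zero    f = 0
∑ (suc n) f = f 0 ℕ.+ ∑ n (f ∘ suc)

∑-cong : ∀ n {f g : ℕ → ℕ} → (∀ i → f i ≡ g i) → ∑ n f ≡ ∑ n g
∑-cong zero    f≡g = refl
∑-cong (suc n) f≡g = cong₂ ℕ._+_ (f≡g 0) (∑-cong n (f≡g ∘ suc))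

∑-distrib-+ : ∀ n (f g : ℕ → ℕ) → ∑ n (λ i → f i ℕ.+ g i) ≡ ∑ n f ℕ.+ ∑ n g
∑-distrib-+ zero    f g = refl
∑-distrib-+ (suc n) f g =
  trans (cong (f 0 ℕ.+ g 0 ℕ.+_) (∑-distrib-+ n (f ∘ suc) (g ∘ suc)))
        (+-interchange (f 0) (g 0) _ _)

∑-const : ∀ n c → ∑ n (λ _ → c) ≡ n ℕ.* c
∑-const zero    c = refl
∑-const (suc n) c = cong (c ℕ.+_) (∑-const n c)

2∑-arithmetic : ∀ n a → 2 ℕ.* ∑ n (λ i → i ℕ.+ a) ℕ.+ n ≡ n ℕ.* n ℕ.+ 2 ℕ.* n ℕ.* a
2∑-arithmetic zero    a = refl
2∑-arithmetic (suc n) a = begin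
  2 ℕ.* (a ℕ.+ ∑ n (λ i → suc i ℕ.+ a)) ℕ.+ suc n
    ≡⟨ cong (λ s → 2 ℕ.* (a ℕ.+ s) ℕ.+ suc n) (∑-cong n (λ i → sym (ℕ.+-suc i a))) ⟩
  2 ℕ.* (a ℕ.+ ∑ n (λ i → i ℕ.+ suc a)) ℕ.+ suc n
    ≡⟨ regroup a (∑ n (λ i → i ℕ.+ suc a)) n ⟩
  (2 ℕ.* ∑ n (λ i → i ℕ.+ suc a) ℕ.+ n) ℕ.+ (2 ℕ.* a ℕ.+ 1)
    ≡⟨ cong (ℕ._+ (2 ℕ.* a ℕ.+ 1)) (2∑-arithmetic n (suc a)) ⟩
  n ℕ.* n ℕ.+ 2 ℕ.* n ℕ.* suc a ℕ.+ (2 ℕ.* a ℕ.+ 1)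
    ≡⟨ expand n a ⟩
  suc n ℕ.* suc n ℕ.+ 2 ℕ.* suc n ℕ.* a ∎
  where
  regroup : ∀ a s n → 2 ℕ.* (a ℕ.+ s) ℕ.+ suc n ≡ (2 ℕ.* s ℕ.+ n) ℕ.+ (2 ℕ.* a ℕ.+ 1)
  regroup = solve-∀
  expand : ∀ n a → n ℕ.* n ℕ.+ 2 ℕ.* n ℕ.* suc a ℕ.+ (2 ℕ.* a ℕ.+ 1) ≡ suc n ℕ.* suc n ℕ.+ 2 ℕ.* suc n ℕ.* a
  expand = solve-∀

data Step : Set where
  ↑ ↓ : Step

Word : Set
Word = List Step

-- The words with u letters ↑ and h + u letters ↓ in which every suffix has
-- at least as many ↓ as ↑, i.e. lattice paths from height h to 0.
data Path : ℕ → ℕ → Word → Set where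
  []  : Path 0 0 []
  ↑∷_ : ∀ {u h w} → Path u (suc h) w → Path (suc u) h (↑ ∷ w)
  ↓∷_ : ∀ {u h w} → Path u h w → Path u (suc h) (↓ ∷ w)

-- The sum of F over all words w with Path u h w.
S : ℕ → ℕ → (Word → ℕ) → ℕ
S zero    zero    F = F []
S zero    (suc h) F = S zero h (F ∘ (↓ ∷_))
S (suc u) zero    F = S u 1 (F ∘ (↑ ∷_))
S (suc u) (suc h) F = S u (suc (suc h)) (F ∘ (↑ ∷_)) ℕ.+ S (suc u) h (F ∘ (↓ ∷_))

S-cong : ∀ u h {F G : Word → ℕ} → (∀ w → Path u h w → F w ≡ G w) → S u h F ≡ S u h G
S-cong zero    zero    F≡G = F≡G [] []
S-cong zero    (suc h) F≡G = S-cong zero h (λ w p → F≡G _ (↓∷ p))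
S-cong (suc u) zero    F≡G = S-cong u 1 (λ w p → F≡G _ (↑∷ p))
S-cong (suc u) (suc h) F≡G = cong₂ ℕ._+_ (S-cong u (suc (suc h)) (λ w p → F≡G _ (↑∷ p)))
                                         (S-cong (suc u) h (λ w p → F≡G _ (↓∷ p)))

S-distrib-+ : ∀ u h (F G : Word → ℕ) → S u h (λ w → F w ℕ.+ G w) ≡ S u h F ℕ.+ S u h G
S-distrib-+ zero    zero    F G = refl
S-distrib-+ zero    (suc h) F G = S-distrib-+ zero h _ _
S-distrib-+ (suc u) zero    F G = S-distrib-+ u 1 _ _
S-distrib-+ (suc u) (suc h) F G =
  trans (cong₂ ℕ._+_ (S-distrib-+ u (suc (suc h)) _ _) (S-distrib-+ (suc u) h _ _))
        (+-interchange (S u (suc (suc h)) (F ∘ (↑ ∷_))) _ _ _)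

S-*ˡ : ∀ u h c (F : Word → ℕ) → S u h (λ w → c ℕ.* F w) ≡ c ℕ.* S u h F
S-*ˡ zero    zero    c F = refl
S-*ˡ zero    (suc h) c F = S-*ˡ zero h c _
S-*ˡ (suc u) zero    c F = S-*ˡ u 1 c _
S-*ˡ (suc u) (suc h) c F =
  trans (cong₂ ℕ._+_ (S-*ˡ u (suc (suc h)) c _) (S-*ˡ (suc u) h c _))
        (sym (ℕ.*-distribˡ-+ c (S u (suc (suc h)) (F ∘ (↑ ∷_))) _))

-- The number of letters ↓ up to and including the first visit to height 0 of
-- the path that starts at height h.
wt : ℕ → Word → ℕ
wt zero    w       = 0
wt (suc h) []      = 0
wt (suc h) (↑ ∷ w) = wt (suc (suc h)) w
wt (suc h) (↓ ∷ w) = suc (wt h w)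

-- The sum of K Q c over all ways of inserting a letter ↓ into w; Q is the
-- resulting word and c the number of exchanges, i.e. of letters ↓ passed.
∑↓ : Word → (Word → ℕ → ℕ) → ℕ
∑↓ []      K = K (↓ ∷ []) 0 ℕ.+ 0
∑↓ (↑ ∷ w) K = K (↓ ∷ ↑ ∷ w) 0 ℕ.+ ∑↓ w (λ Q c → K (↑ ∷ Q) c)
∑↓ (↓ ∷ w) K = K (↓ ∷ ↓ ∷ w) 0 ℕ.+ ∑↓ w (λ Q c → K (↓ ∷ Q) (suc c))

-- The same for an entry that starts in the upper row.  Inserted before the first
-- visit to −1 of the path Q, which starts at height h, it stays in the upper row.
-- Otherwise it moves down in the column of the ↓ that leads to −1, which is
-- exchanged with it and becomes ↑; the inserted letter is then a ↓.
∑↑ : ℕ → Word → (Word → ℕ → ℕ) → ℕ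
∑↑⁺ : ℕ → Word → (Word → ℕ → ℕ) → ℕ
∑↑ h Q K = K (↑ ∷ Q) 0 ℕ.+ ∑↑⁺ h Q K
∑↑⁺ h       []      K = 0
∑↑⁺ h       (↑ ∷ Q) K = ∑↑ (suc h) Q (λ P c → K (↑ ∷ P) (suc c))
∑↑⁺ zero    (↓ ∷ Q) K = ∑↓ Q (λ P c → K (↑ ∷ P) (suc c))
∑↑⁺ (suc h) (↓ ∷ Q) K = ∑↑ h Q (λ P c → K (↓ ∷ P) c)

-- The sum of J c t over all insertions as in ∑↑ that result in a given word: c
-- counts the exchanges, and t the letters ↓ of the word before the insertion up
-- to its first visit to −1.  By S-∑↓ that word in turn arises from t insertions
-- of a ↓, which cost 0, …, t − 1 exchanges.
preimages : ℕ → Word → (ℕ → ℕ → ℕ) → ℕ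
preimages h       []      J = 0
preimages zero    (↑ ∷ w) J =
  J 0 (wt 1 w) ℕ.+ (∑ (wt 1 w) (λ c → J (suc c) 1) ℕ.+ preimages 1 w (λ c t → J (suc c) t))
preimages (suc h) (↑ ∷ w) J =
  J 0 (wt (suc (suc h)) w) ℕ.+ preimages (suc (suc h)) w (λ c t → J (suc c) t)
preimages zero    (↓ ∷ w) J = 0
preimages (suc h) (↓ ∷ w) J = preimages h w (λ c t → J c (suc t))

-- Removing a `↓` from `Q` lowers the part of the path before it by one. The result is a path
-- exactly if that `↓` comes no later than the one that first reaches height 0. These `wt (suc h) Q`
-- letters have 0, 1, 2, ... letters `↓` before them, and these numbers are the costs.
S-∑↓ : ∀ u h (K : Word → ℕ → ℕ) →
       S u h (λ D → ∑↓ D K) ≡ S u (suc h) (λ Q → ∑ (wt (suc h) Q) (K Q))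
S-∑↓ zero    zero    K = refl
S-∑↓ zero    (suc h) K = begin
  S zero h (λ D → K (↓ ∷ ↓ ∷ D) 0 ℕ.+ ∑↓ D (λ Q c → K (↓ ∷ Q) (suc c)))
    ≡⟨ S-distrib-+ zero h _ _ ⟩
  S zero (suc h) (λ D → K (↓ ∷ D) 0) ℕ.+ S zero h (λ D → ∑↓ D (λ Q c → K (↓ ∷ Q) (suc c)))
    ≡⟨ cong (S zero (suc h) (λ D → K (↓ ∷ D) 0) ℕ.+_) (S-∑↓ zero h _) ⟩
  S zero (suc h) (λ D → K (↓ ∷ D) 0) ℕ.+ S zero (suc h) (λ Q → ∑ (wt (suc h) Q) (K (↓ ∷ Q) ∘ suc))
    ≡⟨ S-distrib-+ zero (suc h) (λ D → K (↓ ∷ D) 0) (λ Q → ∑ (wt (suc h) Q) (K (↓ ∷ Q) ∘ suc)) ⟨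
  S zero (suc (suc h)) (λ Q → ∑ (wt (suc (suc h)) Q) (K Q)) ∎
S-∑↓ (suc u) zero    K = begin
  S u 1 (λ D → K (↓ ∷ ↑ ∷ D) 0 ℕ.+ ∑↓ D (λ Q → K (↑ ∷ Q)))
    ≡⟨ S-distrib-+ u 1 _ _ ⟩
  S u 1 (λ D → K (↓ ∷ ↑ ∷ D) 0) ℕ.+ S u 1 (λ D → ∑↓ D (λ Q → K (↑ ∷ Q)))
    ≡⟨ ℕ.+-comm (S u 1 (λ D → K (↓ ∷ ↑ ∷ D) 0)) _ ⟩
  S u 1 (λ D → ∑↓ D (λ Q → K (↑ ∷ Q))) ℕ.+ S u 1 (λ D → K (↓ ∷ ↑ ∷ D) 0)
    ≡⟨ cong₂ ℕ._+_ (S-∑↓ u 1 _) (S-cong u 1 (λ w _ → sym (ℕ.+-identityʳ _))) ⟩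
  S (suc u) 1 (λ Q → ∑ (wt 1 Q) (K Q)) ∎
S-∑↓ (suc u) (suc h) K = begin
  S u (2 ℕ.+ h) (λ D → K (↓ ∷ ↑ ∷ D) 0 ℕ.+ ∑↓ D (λ Q → K (↑ ∷ Q)))
    ℕ.+ S (suc u) h (λ D → K (↓ ∷ ↓ ∷ D) 0 ℕ.+ ∑↓ D (λ Q c → K (↓ ∷ Q) (suc c)))
    ≡⟨ cong₂ ℕ._+_ (S-distrib-+ u (2 ℕ.+ h) _ _) (S-distrib-+ (suc u) h _ _) ⟩
  (S u (2 ℕ.+ h) (λ D → K (↓ ∷ ↑ ∷ D) 0) ℕ.+ S u (2 ℕ.+ h) (λ D → ∑↓ D (λ Q → K (↑ ∷ Q))))
    ℕ.+ (S (suc u) h (λ D → K (↓ ∷ ↓ ∷ D) 0) ℕ.+ S (suc u) h (λ D → ∑↓ D (λ Q c → K (↓ ∷ Q) (suc c))))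
    ≡⟨ cong₂ (λ a b → (S u (2 ℕ.+ h) (λ D → K (↓ ∷ ↑ ∷ D) 0) ℕ.+ a) ℕ.+ (S (suc u) h (λ D → K (↓ ∷ ↓ ∷ D) 0) ℕ.+ b))
         (S-∑↓ u (2 ℕ.+ h) _) (S-∑↓ (suc u) h _) ⟩
  (S u (2 ℕ.+ h) (λ D → K (↓ ∷ ↑ ∷ D) 0) ℕ.+ S u (3 ℕ.+ h) (λ Q → ∑ (wt (3 ℕ.+ h) Q) (K (↑ ∷ Q))))
    ℕ.+ (S (suc u) h (λ D → K (↓ ∷ ↓ ∷ D) 0) ℕ.+ S (suc u) (suc h) (λ Q → ∑ (wt (suc h) Q) (K (↓ ∷ Q) ∘ suc)))
    ≡⟨ regroup (S u (2 ℕ.+ h) (λ D → K (↓ ∷ ↑ ∷ D) 0)) _ _ _ ⟩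
  S u (3 ℕ.+ h) (λ Q → ∑ (wt (3 ℕ.+ h) Q) (K (↑ ∷ Q)))
    ℕ.+ (S (suc u) (suc h) (λ D → K (↓ ∷ D) 0) ℕ.+ S (suc u) (suc h) (λ Q → ∑ (wt (suc h) Q) (K (↓ ∷ Q) ∘ suc)))
    ≡⟨ cong (S u (3 ℕ.+ h) (λ Q → ∑ (wt (3 ℕ.+ h) Q) (K (↑ ∷ Q))) ℕ.+_)
         (S-distrib-+ (suc u) (suc h) (λ D → K (↓ ∷ D) 0) (λ Q → ∑ (wt (suc h) Q) (K (↓ ∷ Q) ∘ suc))) ⟨
  S (suc u) (2 ℕ.+ h) (λ Q → ∑ (wt (2 ℕ.+ h) Q) (K Q)) ∎
  where
  regroup : ∀ a b c d → (a ℕ.+ b) ℕ.+ (c ℕ.+ d) ≡ b ℕ.+ ((a ℕ.+ c) ℕ.+ d)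
  regroup = solve-∀

preimages-no-↑ : ∀ h w J → Path 0 h w → preimages h w J ≡ 0
preimages-no-↑ h _ J []     = refl
preimages-no-↑ (suc h) _ J (↓∷ p) = preimages-no-↑ h _ _ p

S-zero : ∀ u h → S u h (λ _ → 0) ≡ 0
S-zero u h = S-*ˡ u h 0 (λ _ → 0)

-- Undoing the insertion: any `↑` of `P` met by `preimages` may be the inserted letter, and an `↑`
-- at height 0 may instead be an exchanged `↓`, in which case the rest of `P` arises by inserting a
-- `↓` and is handled by `S-∑↓`. As a path, `Q` starts at `suc h`, one higher than in `∑↑ h`, so its
-- first visit to -1 appears as the first visit to 0.
S-∑↑ : ∀ u h (K : Word → ℕ → ℕ → ℕ) →
       S u (suc h) (λ Q → ∑↑ h Q (λ P c → K P c (wt (suc h) Q))) ≡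
       S (suc u) h (λ P → preimages h P (K P))
S-∑↑ u zero K = begin
  S u 1 (λ Q → ∑↑ 0 Q (λ P c → K P c (wt 1 Q)))
    ≡⟨ S-distrib-+ u 1 _ _ ⟩
  front ℕ.+ S u 1 (λ Q → ∑↑⁺ 0 Q (λ P c → K P c (wt 1 Q)))
    ≡⟨ cong (front ℕ.+_) (rest u) ⟩
  front ℕ.+ (S u 1 (λ Q → ∑ (wt 1 Q) (λ c → K (↑ ∷ Q) (suc c) 1))
    ℕ.+ S u 1 (λ Q → preimages 1 Q (λ c t → K (↑ ∷ Q) (suc c) t)))
    ≡⟨ cong (front ℕ.+_) (S-distrib-+ u 1 _ _) ⟨
  front ℕ.+ S u 1 (λ Q → ∑ (wt 1 Q) (λ c → K (↑ ∷ Q) (suc c) 1)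
    ℕ.+ preimages 1 Q (λ c t → K (↑ ∷ Q) (suc c) t))
    ≡⟨ S-distrib-+ u 1 _ _ ⟨
  S (suc u) 0 (λ P → preimages 0 P (K P)) ∎
  where
  front = S u 1 (λ Q → K (↑ ∷ Q) 0 (wt 1 Q))
  -- `∑↑⁺` inspects the first letter of `Q`, which `S` exposes only after a case distinction on `u`.
  rest : ∀ u → S u 1 (λ Q → ∑↑⁺ 0 Q (λ P c → K P c (wt 1 Q))) ≡
               S u 1 (λ Q → ∑ (wt 1 Q) (λ c → K (↑ ∷ Q) (suc c) 1))
               ℕ.+ S u 1 (λ Q → preimages 1 Q (λ c t → K (↑ ∷ Q) (suc c) t))
  rest zero    = sym (ℕ.+-identityʳ _)
  rest (suc u) = trans
    (cong₂ ℕ._+_ (S-∑↑ u 1 (λ P c t → K (↑ ∷ P) (suc c) t))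
                 (S-∑↓ (suc u) 0 (λ P c → K (↑ ∷ P) (suc c) 1)))
    (ℕ.+-comm (S (suc u) 1 (λ Q → preimages 1 Q (λ c t → K (↑ ∷ Q) (suc c) t))) _)
S-∑↑ u (suc h) K = begin
  S u (2 ℕ.+ h) (λ Q → ∑↑ (suc h) Q (λ P c → K P c (wt (2 ℕ.+ h) Q)))
    ≡⟨ S-distrib-+ u (2 ℕ.+ h) _ _ ⟩
  front ℕ.+ S u (2 ℕ.+ h) (λ Q → ∑↑⁺ (suc h) Q (λ P c → K P c (wt (2 ℕ.+ h) Q)))
    ≡⟨ cong (front ℕ.+_) (rest u) ⟩
  front ℕ.+ (S u (2 ℕ.+ h) (λ Q → preimages (2 ℕ.+ h) Q (λ c t → K (↑ ∷ Q) (suc c) t))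
    ℕ.+ S (suc u) h (λ P → preimages h P (λ c t → K (↓ ∷ P) c (suc t))))
    ≡⟨ ℕ.+-assoc front _ _ ⟨
  front ℕ.+ S u (2 ℕ.+ h) (λ Q → preimages (2 ℕ.+ h) Q (λ c t → K (↑ ∷ Q) (suc c) t))
    ℕ.+ S (suc u) h (λ P → preimages h P (λ c t → K (↓ ∷ P) c (suc t)))
    ≡⟨ cong (ℕ._+ S (suc u) h (λ P → preimages h P (λ c t → K (↓ ∷ P) c (suc t)))) (S-distrib-+ u (2 ℕ.+ h) _ _) ⟨
  S (suc u) (suc h) (λ P → preimages (suc h) P (K P)) ∎
  where
  front = S u (2 ℕ.+ h) (λ Q → K (↑ ∷ Q) 0 (wt (2 ℕ.+ h) Q))
  rest : ∀ u → S u (2 ℕ.+ h) (λ Q → ∑↑⁺ (suc h) Q (λ P c → K P c (wt (2 ℕ.+ h) Q))) ≡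
               S u (2 ℕ.+ h) (λ Q → preimages (2 ℕ.+ h) Q (λ c t → K (↑ ∷ Q) (suc c) t))
               ℕ.+ S (suc u) h (λ P → preimages h P (λ c t → K (↓ ∷ P) c (suc t)))
  rest zero    = trans (S-∑↑ 0 h (λ P c t → K (↓ ∷ P) c (suc t)))
    (cong (ℕ._+ S 1 h (λ P → preimages h P (λ c t → K (↓ ∷ P) c (suc t))))
      (sym (trans (S-cong 0 (2 ℕ.+ h) (λ w → preimages-no-↑ _ w (λ c t → K (↑ ∷ w) (suc c) t))) (S-zero 0 (2 ℕ.+ h)))))
  rest (suc u) = cong₂ ℕ._+_ (S-∑↑ u (2 ℕ.+ h) (λ P c t → K (↑ ∷ P) (suc c) t))
                             (S-∑↑ (suc u) h (λ P c t → K (↓ ∷ P) c (suc t)))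

-- Adds the equation p ≡ q to the goal with its sides crossed, which turns a
-- goal following linearly from p ≡ q into a semiring identity.
cross : ∀ {p q} l r → p ≡ q → l ℕ.+ q ≡ r ℕ.+ p → l ≡ r
cross {p} l r refl = ℕ.+-cancelʳ-≡ p l r

-- Size and cost of the fibres of a step

preimages-cong : ∀ h w {J J′ : ℕ → ℕ → ℕ} → (∀ c t → J c t ≡ J′ c t) →
                 preimages h w J ≡ preimages h w J′
preimages-cong h       []      J≡J′ = refl
preimages-cong zero    (↑ ∷ w) J≡J′ = cong₂ ℕ._+_ (J≡J′ _ _)
  (cong₂ ℕ._+_ (∑-cong (wt 1 w) (λ c → J≡J′ _ _)) (preimages-cong 1 w (λ c t → J≡J′ _ _)))
preimages-cong (suc h) (↑ ∷ w) J≡J′ = cong₂ ℕ._+_ (J≡J′ _ _)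
  (preimages-cong (suc (suc h)) w (λ c t → J≡J′ _ _))
preimages-cong zero    (↓ ∷ w) J≡J′ = refl
preimages-cong (suc h) (↓ ∷ w) J≡J′ = preimages-cong h w (λ c t → J≡J′ _ _)

-- Here `d` letters `↓` and a = `d + h` letters `↑` have been read, and b = `d + wt h w` numbers the
-- `↓` that ends the current excursion. The quantity (a + 1) b is unchanged by a `↓`, and every `↑`
-- raises it by exactly what it contributes to `preimages`. At the end it is (n + 1) n.
preimages-count′ : ∀ d {u h w} → Path u h w →
  preimages h w (λ c t → d ℕ.+ t) ℕ.+ suc (d ℕ.+ h) ℕ.* (d ℕ.+ wt h w) ≡
  (d ℕ.+ h ℕ.+ u) ℕ.* suc (d ℕ.+ h ℕ.+ u)
preimages-count′ d [] = base d
  where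
  base : ∀ d → suc (d ℕ.+ 0) ℕ.* (d ℕ.+ 0) ≡ (d ℕ.+ 0 ℕ.+ 0) ℕ.* suc (d ℕ.+ 0 ℕ.+ 0)
  base = solve-∀
preimages-count′ d (↑∷_ {u} {zero} {w} p) = begin
  d ℕ.+ l ℕ.+ (∑ l (λ _ → d ℕ.+ 1) ℕ.+ ψ) ℕ.+ suc (d ℕ.+ 0) ℕ.* (d ℕ.+ 0)
    ≡⟨ cong (λ s → d ℕ.+ l ℕ.+ (s ℕ.+ ψ) ℕ.+ suc (d ℕ.+ 0) ℕ.* (d ℕ.+ 0)) (∑-const l (d ℕ.+ 1)) ⟩
  d ℕ.+ l ℕ.+ (l ℕ.* (d ℕ.+ 1) ℕ.+ ψ) ℕ.+ suc (d ℕ.+ 0) ℕ.* (d ℕ.+ 0)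
    ≡⟨ regroup d l ψ ⟩
  ψ ℕ.+ suc (d ℕ.+ 1) ℕ.* (d ℕ.+ l)
    ≡⟨ preimages-count′ d p ⟩
  (d ℕ.+ 1 ℕ.+ u) ℕ.* suc (d ℕ.+ 1 ℕ.+ u)
    ≡⟨ shift d u ⟩
  (d ℕ.+ 0 ℕ.+ suc u) ℕ.* suc (d ℕ.+ 0 ℕ.+ suc u) ∎
  where
  l = wt 1 w
  ψ = preimages 1 w (λ c t → d ℕ.+ t)
  regroup : ∀ d l ψ → d ℕ.+ l ℕ.+ (l ℕ.* (d ℕ.+ 1) ℕ.+ ψ) ℕ.+ suc (d ℕ.+ 0) ℕ.* (d ℕ.+ 0) ≡
                      ψ ℕ.+ suc (d ℕ.+ 1) ℕ.* (d ℕ.+ l)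
  regroup = solve-∀
  shift : ∀ d u → (d ℕ.+ 1 ℕ.+ u) ℕ.* suc (d ℕ.+ 1 ℕ.+ u) ≡ (d ℕ.+ 0 ℕ.+ suc u) ℕ.* suc (d ℕ.+ 0 ℕ.+ suc u)
  shift = solve-∀
preimages-count′ d (↑∷_ {u} {suc h} {w} p) =
  trans (regroup d h (wt (2 ℕ.+ h) w) _) (trans (preimages-count′ d p) (shift d h u))
  where
  regroup : ∀ d h l ψ → d ℕ.+ l ℕ.+ ψ ℕ.+ suc (d ℕ.+ suc h) ℕ.* (d ℕ.+ l) ≡
                        ψ ℕ.+ suc (d ℕ.+ (2 ℕ.+ h)) ℕ.* (d ℕ.+ l)
  regroup = solve-∀
  shift : ∀ d h u → (d ℕ.+ (2 ℕ.+ h) ℕ.+ u) ℕ.* suc (d ℕ.+ (2 ℕ.+ h) ℕ.+ u) ≡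
                    (d ℕ.+ suc h ℕ.+ suc u) ℕ.* suc (d ℕ.+ suc h ℕ.+ suc u)
  shift = solve-∀
preimages-count′ d (↓∷_ {u} {h} {w} p) = begin
  preimages h w (λ c t → d ℕ.+ suc t) ℕ.+ suc (d ℕ.+ suc h) ℕ.* (d ℕ.+ suc (wt h w))
    ≡⟨ cong₂ ℕ._+_ (preimages-cong h w (λ c t → ℕ.+-suc d t))
                   (cong₂ (λ a b → suc a ℕ.* b) (ℕ.+-suc d h) (ℕ.+-suc d (wt h w))) ⟩
  preimages h w (λ c t → suc d ℕ.+ t) ℕ.+ suc (suc d ℕ.+ h) ℕ.* (suc d ℕ.+ wt h w)
    ≡⟨ preimages-count′ (suc d) p ⟩
  (suc d ℕ.+ h ℕ.+ u) ℕ.* suc (suc d ℕ.+ h ℕ.+ u)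
    ≡⟨ cong (λ a → (a ℕ.+ u) ℕ.* suc (a ℕ.+ u)) (ℕ.+-suc d h) ⟨
  (d ℕ.+ suc h ℕ.+ u) ℕ.* suc (d ℕ.+ suc h ℕ.+ u) ∎

preimages-count : ∀ {n w} → Path n 0 w → preimages 0 w (λ c t → t) ≡ n ℕ.* suc n
preimages-count p = trans (sym (ℕ.+-identityʳ _)) (preimages-count′ 0 p)

-- The sum of the squares of the semilengths of the excursions from height 0
-- that start at or after the first visit to height 0.
squares : ℕ → Word → ℕ
squares h       []      = 0
squares zero    (↑ ∷ w) = wt 1 w ℕ.* wt 1 w ℕ.+ squares 1 w
squares (suc h) (↑ ∷ w) = squares (suc (suc h)) w
squares zero    (↓ ∷ w) = 0
squares (suc h) (↓ ∷ w) = squares h w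

-- The exchanges of all pairs of insertions that share one undone upper entry: its own `c` exchanges
-- are added to each of the costs 0, ..., `t` - 1 of the lower one.
stepCost : ℕ → ℕ → ℕ
stepCost c t = ∑ t (λ i → i ℕ.+ c)

∑-stepCost : ∀ l t a → 2 ℕ.* ∑ l (λ c → stepCost (c ℕ.+ a) t) ℕ.+ 2 ℕ.* l ℕ.* t ≡
                       l ℕ.* (t ℕ.* t) ℕ.+ t ℕ.* (l ℕ.* l ℕ.+ 2 ℕ.* l ℕ.* a)
∑-stepCost zero    t a = sym (ℕ.*-zeroʳ t)
∑-stepCost (suc l) t a = begin
  2 ℕ.* (stepCost a t ℕ.+ ∑ l (λ c → stepCost (suc c ℕ.+ a) t)) ℕ.+ 2 ℕ.* suc l ℕ.* t
    ≡⟨ cong (λ s → 2 ℕ.* (stepCost a t ℕ.+ s) ℕ.+ 2 ℕ.* suc l ℕ.* t)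
         (∑-cong l (λ c → cong (λ x → stepCost x t) (sym (ℕ.+-suc c a)))) ⟩
  2 ℕ.* (stepCost a t ℕ.+ ∑ l (λ c → stepCost (c ℕ.+ suc a) t)) ℕ.+ 2 ℕ.* suc l ℕ.* t
    ≡⟨ regroup (stepCost a t) (∑ l (λ c → stepCost (c ℕ.+ suc a) t)) l t ⟩
  (2 ℕ.* stepCost a t ℕ.+ t) ℕ.+ (2 ℕ.* ∑ l (λ c → stepCost (c ℕ.+ suc a) t) ℕ.+ 2 ℕ.* l ℕ.* t) ℕ.+ t
    ≡⟨ cong₂ (λ x y → x ℕ.+ y ℕ.+ t) (2∑-arithmetic t a) (∑-stepCost l t (suc a)) ⟩
  (t ℕ.* t ℕ.+ 2 ℕ.* t ℕ.* a) ℕ.+ (l ℕ.* (t ℕ.* t) ℕ.+ t ℕ.* (l ℕ.* l ℕ.+ 2 ℕ.* l ℕ.* suc a)) ℕ.+ t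
    ≡⟨ expand t l a ⟩
  suc l ℕ.* (t ℕ.* t) ℕ.+ t ℕ.* (suc l ℕ.* suc l ℕ.+ 2 ℕ.* suc l ℕ.* a) ∎
  where
  regroup : ∀ x y l t → 2 ℕ.* (x ℕ.+ y) ℕ.+ 2 ℕ.* suc l ℕ.* t ≡
                        (2 ℕ.* x ℕ.+ t) ℕ.+ (2 ℕ.* y ℕ.+ 2 ℕ.* l ℕ.* t) ℕ.+ t
  regroup = solve-∀
  expand : ∀ t l a → (t ℕ.* t ℕ.+ 2 ℕ.* t ℕ.* a) ℕ.+ (l ℕ.* (t ℕ.* t) ℕ.+ t ℕ.* (l ℕ.* l ℕ.+ 2 ℕ.* l ℕ.* suc a)) ℕ.+ t ≡
                     suc l ℕ.* (t ℕ.* t) ℕ.+ t ℕ.* (suc l ℕ.* suc l ℕ.+ 2 ℕ.* suc l ℕ.* a)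
  expand = solve-∀

-- Up to the squares of the semilengths of its excursions, the preimages of a path
-- with n letters ↑ cost total n / 2.  potential u b is the correction for an
-- excursion in progress: u letters ↑ have been read, and the excursion ends
-- with the b-th letter ↓.
potential : ℕ → ℕ → ℕ
potential u b = b ℕ.* (3 ℕ.* b ℕ.+ 1 ℕ.+ u ℕ.* b ℕ.+ u ℕ.* u)

total : ℕ → ℕ
total n = 2 ℕ.* (n ℕ.* n ℕ.* n) ℕ.+ n ℕ.* n ℕ.+ n

-- The same telescoping as in `preimages-count′`, with a and b as there and Φ = `potential a b` -
-- 2ab. A `↓` leaves Φ unchanged. An `↑` inside an excursion raises Φ by 2 `stepCost a b` = b² + 2ab
-- - b, which determines how `potential` depends on a; an `↑` that opens an excursion of semilength
-- l raises Φ by twice its cost plus 2l². The final value Φ(n, n) is `total n`. The term 2ab stands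
-- on the right to avoid subtraction.
preimages-cost′ : ∀ d {u h w} → Path u h w →
  2 ℕ.* preimages h w (λ c t → stepCost (c ℕ.+ (h ℕ.+ d)) (t ℕ.+ d))
    ℕ.+ potential (h ℕ.+ d) (wt h w ℕ.+ d) ℕ.+ 2 ℕ.* squares h w ≡
  total (u ℕ.+ (h ℕ.+ d)) ℕ.+ 2 ℕ.* ((h ℕ.+ d) ℕ.* (wt h w ℕ.+ d))
preimages-cost′ d [] = base d
  where
  base : ∀ d → potential d d ℕ.+ 0 ≡ total d ℕ.+ 2 ℕ.* (d ℕ.* d)
  base = unfolded
    where
    unfolded : ∀ d → d ℕ.* (3 ℕ.* d ℕ.+ 1 ℕ.+ d ℕ.* d ℕ.+ d ℕ.* d) ℕ.+ 0 ≡
               2 ℕ.* (d ℕ.* d ℕ.* d) ℕ.+ d ℕ.* d ℕ.+ d ℕ.+ 2 ℕ.* (d ℕ.* d)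
    unfolded = solve-∀
preimages-cost′ d (↑∷_ {u} {zero} {w} p) = begin
  2 ℕ.* (x ℕ.+ (∑ l (λ c → stepCost (suc c ℕ.+ d) (1 ℕ.+ d)) ℕ.+ preimages 1 w (λ c t → stepCost (suc c ℕ.+ d) (t ℕ.+ d))))
    ℕ.+ potential d d ℕ.+ 2 ℕ.* (l ℕ.* l ℕ.+ q)
    ≡⟨ cong₂ (λ y z → 2 ℕ.* (x ℕ.+ (y ℕ.+ z)) ℕ.+ potential d d ℕ.+ 2 ℕ.* (l ℕ.* l ℕ.+ q))
         (∑-cong l (λ c → cong (λ a → stepCost a (1 ℕ.+ d)) (sym (ℕ.+-suc c d))))
         (preimages-cong 1 w (λ c t → cong (λ a → stepCost a (t ℕ.+ d)) (sym (ℕ.+-suc c d)))) ⟩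
  2 ℕ.* (x ℕ.+ (y ℕ.+ z)) ℕ.+ potential d d ℕ.+ 2 ℕ.* (l ℕ.* l ℕ.+ q)
    ≡⟨ cross _ _
         (cong₂ ℕ._+_ (cong₂ ℕ._+_ (2∑-arithmetic (l ℕ.+ d) d) (∑-stepCost l (1 ℕ.+ d) (1 ℕ.+ d))) (preimages-cost′ d p))
         (balance d l q x y z (total (u ℕ.+ (1 ℕ.+ d)))) ⟩
  total (u ℕ.+ suc d) ℕ.+ 2 ℕ.* (d ℕ.* d)
    ≡⟨ cong (λ n → total n ℕ.+ 2 ℕ.* (d ℕ.* d)) (ℕ.+-suc u d) ⟩
  total (suc u ℕ.+ d) ℕ.+ 2 ℕ.* (d ℕ.* d) ∎
  where
  l = wt 1 w
  q = squares 1 w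
  x = stepCost d (l ℕ.+ d)
  y = ∑ l (λ c → stepCost (c ℕ.+ (1 ℕ.+ d)) (1 ℕ.+ d))
  z = preimages 1 w (λ c t → stepCost (c ℕ.+ (1 ℕ.+ d)) (t ℕ.+ d))
  balance : ∀ d l q x y z T →
    2 ℕ.* (x ℕ.+ (y ℕ.+ z)) ℕ.+ d ℕ.* (3 ℕ.* d ℕ.+ 1 ℕ.+ d ℕ.* d ℕ.+ d ℕ.* d) ℕ.+ 2 ℕ.* (l ℕ.* l ℕ.+ q)
      ℕ.+ (((l ℕ.+ d) ℕ.* (l ℕ.+ d) ℕ.+ 2 ℕ.* (l ℕ.+ d) ℕ.* d)
      ℕ.+ (l ℕ.* ((1 ℕ.+ d) ℕ.* (1 ℕ.+ d)) ℕ.+ (1 ℕ.+ d) ℕ.* (l ℕ.* l ℕ.+ 2 ℕ.* l ℕ.* (1 ℕ.+ d)))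
      ℕ.+ (T ℕ.+ 2 ℕ.* ((1 ℕ.+ d) ℕ.* (l ℕ.+ d)))) ≡
    T ℕ.+ 2 ℕ.* (d ℕ.* d)
      ℕ.+ ((2 ℕ.* x ℕ.+ (l ℕ.+ d)) ℕ.+ (2 ℕ.* y ℕ.+ 2 ℕ.* l ℕ.* (1 ℕ.+ d))
      ℕ.+ (2 ℕ.* z ℕ.+ (l ℕ.+ d) ℕ.* (3 ℕ.* (l ℕ.+ d) ℕ.+ 1 ℕ.+ (1 ℕ.+ d) ℕ.* (l ℕ.+ d) ℕ.+ (1 ℕ.+ d) ℕ.* (1 ℕ.+ d)) ℕ.+ 2 ℕ.* q))
  balance = solve-∀
preimages-cost′ d (↑∷_ {u} {suc h} {w} p) = begin
  2 ℕ.* (x ℕ.+ preimages (2 ℕ.+ h) w (λ c t → stepCost (suc c ℕ.+ (suc h ℕ.+ d)) (t ℕ.+ d)))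
    ℕ.+ potential (suc h ℕ.+ d) (l ℕ.+ d) ℕ.+ 2 ℕ.* q
    ≡⟨ cong (λ z → 2 ℕ.* (x ℕ.+ z) ℕ.+ potential (suc h ℕ.+ d) (l ℕ.+ d) ℕ.+ 2 ℕ.* q)
         (preimages-cong (2 ℕ.+ h) w (λ c t → cong (λ a → stepCost a (t ℕ.+ d)) (sym (ℕ.+-suc c (suc h ℕ.+ d))))) ⟩
  2 ℕ.* (x ℕ.+ z) ℕ.+ potential (suc h ℕ.+ d) (l ℕ.+ d) ℕ.+ 2 ℕ.* q
    ≡⟨ cross _ _
         (cong₂ ℕ._+_ (2∑-arithmetic (l ℕ.+ d) (suc h ℕ.+ d)) (preimages-cost′ d p))
         (balance (h ℕ.+ d) (l ℕ.+ d) q x z (total (u ℕ.+ (2 ℕ.+ h ℕ.+ d)))) ⟩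
  total (u ℕ.+ suc (suc h ℕ.+ d)) ℕ.+ 2 ℕ.* ((suc h ℕ.+ d) ℕ.* (l ℕ.+ d))
    ≡⟨ cong (λ n → total n ℕ.+ 2 ℕ.* ((suc h ℕ.+ d) ℕ.* (l ℕ.+ d))) (ℕ.+-suc u (suc h ℕ.+ d)) ⟩
  total (suc u ℕ.+ (suc h ℕ.+ d)) ℕ.+ 2 ℕ.* ((suc h ℕ.+ d) ℕ.* (l ℕ.+ d)) ∎
  where
  l = wt (2 ℕ.+ h) w
  q = squares (2 ℕ.+ h) w
  x = stepCost (suc h ℕ.+ d) (l ℕ.+ d)
  z = preimages (2 ℕ.+ h) w (λ c t → stepCost (c ℕ.+ (2 ℕ.+ h ℕ.+ d)) (t ℕ.+ d))
  balance : ∀ v b q x z T →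
    2 ℕ.* (x ℕ.+ z) ℕ.+ b ℕ.* (3 ℕ.* b ℕ.+ 1 ℕ.+ suc v ℕ.* b ℕ.+ suc v ℕ.* suc v) ℕ.+ 2 ℕ.* q
      ℕ.+ ((b ℕ.* b ℕ.+ 2 ℕ.* b ℕ.* suc v) ℕ.+ (T ℕ.+ 2 ℕ.* (suc (suc v) ℕ.* b))) ≡
    T ℕ.+ 2 ℕ.* (suc v ℕ.* b)
      ℕ.+ ((2 ℕ.* x ℕ.+ b) ℕ.+ (2 ℕ.* z ℕ.+ b ℕ.* (3 ℕ.* b ℕ.+ 1 ℕ.+ suc (suc v) ℕ.* b ℕ.+ suc (suc v) ℕ.* suc (suc v)) ℕ.+ 2 ℕ.* q))
  balance = solve-∀
preimages-cost′ d (↓∷_ {u} {h} {w} p) = begin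
  2 ℕ.* preimages h w (λ c t → stepCost (c ℕ.+ suc (h ℕ.+ d)) (suc (t ℕ.+ d)))
    ℕ.+ potential (suc (h ℕ.+ d)) (suc (wt h w ℕ.+ d)) ℕ.+ 2 ℕ.* squares h w
    ≡⟨ cong (λ x → 2 ℕ.* x ℕ.+ potential (suc (h ℕ.+ d)) (suc (wt h w ℕ.+ d)) ℕ.+ 2 ℕ.* squares h w)
         (preimages-cong h w (λ c t → cong₂ (λ a b → stepCost (c ℕ.+ a) b) (sym (ℕ.+-suc h d)) (sym (ℕ.+-suc t d)))) ⟩
  2 ℕ.* preimages h w (λ c t → stepCost (c ℕ.+ (h ℕ.+ suc d)) (t ℕ.+ suc d))
    ℕ.+ potential (suc (h ℕ.+ d)) (suc (wt h w ℕ.+ d)) ℕ.+ 2 ℕ.* squares h w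
    ≡⟨ cong₂ (λ a b → 2 ℕ.* preimages h w (λ c t → stepCost (c ℕ.+ (h ℕ.+ suc d)) (t ℕ.+ suc d)) ℕ.+ potential a b ℕ.+ 2 ℕ.* squares h w)
         (sym (ℕ.+-suc h d)) (sym (ℕ.+-suc (wt h w) d)) ⟩
  2 ℕ.* preimages h w (λ c t → stepCost (c ℕ.+ (h ℕ.+ suc d)) (t ℕ.+ suc d))
    ℕ.+ potential (h ℕ.+ suc d) (wt h w ℕ.+ suc d) ℕ.+ 2 ℕ.* squares h w
    ≡⟨ preimages-cost′ (suc d) p ⟩
  total (u ℕ.+ (h ℕ.+ suc d)) ℕ.+ 2 ℕ.* ((h ℕ.+ suc d) ℕ.* (wt h w ℕ.+ suc d))
    ≡⟨ cong₂ (λ a b → total (u ℕ.+ a) ℕ.+ 2 ℕ.* (a ℕ.* b)) (ℕ.+-suc h d) (ℕ.+-suc (wt h w) d) ⟩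
  total (u ℕ.+ suc (h ℕ.+ d)) ℕ.+ 2 ℕ.* (suc (h ℕ.+ d) ℕ.* suc (wt h w ℕ.+ d)) ∎

preimages-cost : ∀ {n w} → Path n 0 w →
  2 ℕ.* preimages 0 w stepCost ℕ.+ 2 ℕ.* squares 0 w ≡ total n
preimages-cost {n} {w} p = begin
  2 ℕ.* preimages 0 w stepCost ℕ.+ 2 ℕ.* squares 0 w
    ≡⟨ cong₂ ℕ._+_ (trans (cong (2 ℕ.*_) (preimages-cong 0 w (λ c t → cong₂ stepCost (sym (ℕ.+-identityʳ c)) (sym (ℕ.+-identityʳ t)))))
                          (sym (ℕ.+-identityʳ _))) refl ⟩
  2 ℕ.* preimages 0 w (λ c t → stepCost (c ℕ.+ 0) (t ℕ.+ 0)) ℕ.+ 0 ℕ.+ 2 ℕ.* squares 0 w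
    ≡⟨ preimages-cost′ 0 p ⟩
  total (n ℕ.+ 0) ℕ.+ 0
    ≡⟨ ℕ.+-identityʳ _ ⟩
  total (n ℕ.+ 0)
    ≡⟨ cong total (ℕ.+-identityʳ n) ⟩
  total n ∎

-- Catalan convolutions

∑↓-cong : ∀ w {K K′ : Word → ℕ → ℕ} → (∀ Q c → length Q ≡ suc (length w) → K Q c ≡ K′ Q c) → ∑↓ w K ≡ ∑↓ w K′
∑↓-cong []      K≡K′ = cong (ℕ._+ 0) (K≡K′ _ _ refl)
∑↓-cong (↑ ∷ w) K≡K′ = cong₂ ℕ._+_ (K≡K′ _ _ refl) (∑↓-cong w (λ Q c e → K≡K′ _ _ (cong suc e)))
∑↓-cong (↓ ∷ w) K≡K′ = cong₂ ℕ._+_ (K≡K′ _ _ refl) (∑↓-cong w (λ Q c e → K≡K′ _ _ (cong suc e)))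

∑↓-distrib-+ : ∀ w (K L : Word → ℕ → ℕ) → ∑↓ w (λ Q c → K Q c ℕ.+ L Q c) ≡ ∑↓ w K ℕ.+ ∑↓ w L
∑↓-distrib-+ []      K L = +-interchange (K (↓ ∷ []) 0) (L (↓ ∷ []) 0) 0 0
∑↓-distrib-+ (↑ ∷ w) K L =
  trans (cong (K _ 0 ℕ.+ L _ 0 ℕ.+_) (∑↓-distrib-+ w _ _)) (+-interchange (K _ 0) _ _ _)
∑↓-distrib-+ (↓ ∷ w) K L =
  trans (cong (K _ 0 ℕ.+ L _ 0 ℕ.+_) (∑↓-distrib-+ w _ _)) (+-interchange (K _ 0) _ _ _)

∑↓-const : ∀ w c → ∑↓ w (λ _ _ → c) ≡ suc (length w) ℕ.* c
∑↓-const []      c = refl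
∑↓-const (↑ ∷ w) c = cong (c ℕ.+_) (∑↓-const w c)
∑↓-const (↓ ∷ w) c = cong (c ℕ.+_) (∑↓-const w c)

∑↑-distrib-+ : ∀ h w (K L : Word → ℕ → ℕ) → ∑↑ h w (λ Q c → K Q c ℕ.+ L Q c) ≡ ∑↑ h w K ℕ.+ ∑↑ h w L
∑↑-distrib-+ h w K L = trans (cong (K _ 0 ℕ.+ L _ 0 ℕ.+_) (rest h w)) (+-interchange (K _ 0) _ _ _)
  where
  rest : ∀ h w → ∑↑⁺ h w (λ Q c → K Q c ℕ.+ L Q c) ≡ ∑↑⁺ h w K ℕ.+ ∑↑⁺ h w L
  rest h       []      = refl
  rest h       (↑ ∷ w) = ∑↑-distrib-+ (suc h) w (λ P c → K (↑ ∷ P) (suc c)) (λ P c → L (↑ ∷ P) (suc c))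
  rest zero    (↓ ∷ w) = ∑↓-distrib-+ w _ _
  rest (suc h) (↓ ∷ w) = ∑↑-distrib-+ h w (λ P c → K (↓ ∷ P) c) (λ P c → L (↓ ∷ P) c)

∑↑-const : ∀ h w c → ∑↑ h w (λ _ _ → c) ≡ suc (length w) ℕ.* c
∑↑-const h w c = cong (c ℕ.+_) (rest h w)
  where
  rest : ∀ h w → ∑↑⁺ h w (λ _ _ → c) ≡ length w ℕ.* c
  rest h       []      = refl
  rest h       (↑ ∷ w) = ∑↑-const (suc h) w c
  rest zero    (↓ ∷ w) = ∑↓-const w c
  rest (suc h) (↓ ∷ w) = ∑↑-const h w c

∑-∑↑-comm : ∀ t h w (K : ℕ → Word → ℕ → ℕ) →
            ∑ t (λ i → ∑↑ h w (K i)) ≡ ∑↑ h w (λ P c → ∑ t (λ i → K i P c))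
∑-∑↑-comm zero    h w K = sym (trans (∑↑-const h w 0) (ℕ.*-zeroʳ (suc (length w))))
∑-∑↑-comm (suc t) h w K =
  trans (cong (∑↑ h w (K 0) ℕ.+_) (∑-∑↑-comm t h w (K ∘ suc)))
        (sym (∑↑-distrib-+ h w (K 0) _))

-- The two insertions are undone one after the other. The intermediate word `Q` disappears from the
-- result; only its number `wt 1 Q` of predecessors survives, as the argument `t`.
S-∑↓∑↑ : ∀ n (K : Word → ℕ → ℕ) →
  S n 0 (λ D → ∑↓ D (λ Q i → ∑↑ 0 Q (λ P c → K P (i ℕ.+ c)))) ≡
  S (suc n) 0 (λ P → preimages 0 P (λ c t → ∑ t (λ i → K P (i ℕ.+ c))))
S-∑↓∑↑ n K = begin
  S n 0 (λ D → ∑↓ D (λ Q i → ∑↑ 0 Q (λ P c → K P (i ℕ.+ c))))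
    ≡⟨ S-∑↓ n 0 _ ⟩
  S n 1 (λ Q → ∑ (wt 1 Q) (λ i → ∑↑ 0 Q (λ P c → K P (i ℕ.+ c))))
    ≡⟨ S-cong n 1 (λ Q _ → ∑-∑↑-comm (wt 1 Q) 0 Q (λ i P c → K P (i ℕ.+ c))) ⟩
  S n 1 (λ Q → ∑↑ 0 Q (λ P c → ∑ (wt 1 Q) (λ i → K P (i ℕ.+ c))))
    ≡⟨ S-∑↑ n 0 (λ P c t → ∑ t (λ i → K P (i ℕ.+ c))) ⟩
  S (suc n) 0 (λ P → preimages 0 P (λ c t → ∑ t (λ i → K P (i ℕ.+ c)))) ∎

preimages-*ʳ : ∀ h w J k → preimages h w (λ c t → J c t ℕ.* k) ≡ preimages h w J ℕ.* k
preimages-*ʳ h       []      J k = refl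
preimages-*ʳ zero    (↑ ∷ w) J k = begin
  J 0 (wt 1 w) ℕ.* k ℕ.+ (∑ (wt 1 w) (λ c → J (suc c) 1 ℕ.* k) ℕ.+ preimages 1 w (λ c t → J (suc c) t ℕ.* k))
    ≡⟨ cong₂ (λ a b → J 0 (wt 1 w) ℕ.* k ℕ.+ (a ℕ.+ b)) (∑-*ʳ (wt 1 w) (λ c → J (suc c) 1)) (preimages-*ʳ 1 w _ k) ⟩
  J 0 (wt 1 w) ℕ.* k ℕ.+ (∑ (wt 1 w) (λ c → J (suc c) 1) ℕ.* k ℕ.+ preimages 1 w (λ c t → J (suc c) t) ℕ.* k)
    ≡⟨ factor (J 0 (wt 1 w)) (∑ (wt 1 w) (λ c → J (suc c) 1)) _ k ⟩
  preimages zero (↑ ∷ w) J ℕ.* k ∎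
  where
  ∑-*ʳ : ∀ n (f : ℕ → ℕ) → ∑ n (λ i → f i ℕ.* k) ≡ ∑ n f ℕ.* k
  ∑-*ʳ zero    f = refl
  ∑-*ʳ (suc n) f = trans (cong (f 0 ℕ.* k ℕ.+_) (∑-*ʳ n (f ∘ suc))) (sym (ℕ.*-distribʳ-+ k (f 0) _))
  factor : ∀ a b c k → a ℕ.* k ℕ.+ (b ℕ.* k ℕ.+ c ℕ.* k) ≡ (a ℕ.+ (b ℕ.+ c)) ℕ.* k
  factor = solve-∀
preimages-*ʳ (suc h) (↑ ∷ w) J k =
  trans (cong (J 0 (wt (suc (suc h)) w) ℕ.* k ℕ.+_) (preimages-*ʳ (suc (suc h)) w _ k))
        (sym (ℕ.*-distribʳ-+ k (J 0 (wt (suc (suc h)) w)) _))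
preimages-*ʳ zero    (↓ ∷ w) J k = refl
preimages-*ʳ (suc h) (↓ ∷ w) J k = preimages-*ʳ h w _ k

-- The uniform distribution: a function of the resulting path alone is constant on each fibre, and
-- all fibres have the same size by `preimages-count`.
S-∑↓∑↑-uniform : ∀ n (F : Word → ℕ) →
  S n 0 (λ D → ∑↓ D (λ Q _ → ∑↑ 0 Q (λ P _ → F P))) ≡ suc n ℕ.* suc (suc n) ℕ.* S (suc n) 0 F
S-∑↓∑↑-uniform n F = begin
  S n 0 (λ D → ∑↓ D (λ Q _ → ∑↑ 0 Q (λ P _ → F P)))
    ≡⟨ S-∑↓∑↑ n (λ P _ → F P) ⟩
  S (suc n) 0 (λ P → preimages 0 P (λ c t → ∑ t (λ _ → F P)))
    ≡⟨ S-cong (suc n) 0 (λ P p → begin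
         preimages 0 P (λ c t → ∑ t (λ _ → F P))  ≡⟨ preimages-cong 0 P (λ c t → ∑-const t (F P)) ⟩
         preimages 0 P (λ c t → t ℕ.* F P)        ≡⟨ preimages-*ʳ 0 P (λ c t → t) (F P) ⟩
         preimages 0 P (λ c t → t) ℕ.* F P        ≡⟨ cong (ℕ._* F P) (preimages-count p) ⟩
         suc n ℕ.* suc (suc n) ℕ.* F P            ∎) ⟩
  S (suc n) 0 (λ P → suc n ℕ.* suc (suc n) ℕ.* F P)
    ≡⟨ S-*ˡ (suc n) 0 (suc n ℕ.* suc (suc n)) F ⟩
  suc n ℕ.* suc (suc n) ℕ.* S (suc n) 0 F ∎

dbl : ℕ → ℕ
dbl zero    = zero
dbl (suc n) = suc (suc (dbl n))

length-Path : ∀ {u h w} → Path u h w → length w ≡ dbl u ℕ.+ h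
length-Path []                   = refl
length-Path (↑∷_ {u} {h} p)      = cong suc (trans (length-Path p) (ℕ.+-suc (dbl u) h))
length-Path (↓∷_ {u} {h} p)      = trans (cong suc (length-Path p)) (sym (ℕ.+-suc (dbl u) h))

catalan : ℕ → ℕ
catalan n = S n 0 (λ _ → 1)

-- Counts the pairs of insertions twice: by the resulting path through uniformity, and by the gaps
-- of the original one, 2n + 1 for the first letter and 2n + 2 for the second.
catalan-rec′ : ∀ n → suc n ℕ.* suc (suc n) ℕ.* catalan (suc n) ≡ suc (dbl n) ℕ.* suc (suc (dbl n)) ℕ.* catalan n
catalan-rec′ n = begin
  suc n ℕ.* suc (suc n) ℕ.* catalan (suc n)
    ≡⟨ S-∑↓∑↑-uniform n (λ _ → 1) ⟨
  S n 0 (λ D → ∑↓ D (λ Q _ → ∑↑ 0 Q (λ P _ → 1)))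
    ≡⟨ S-cong n 0 (λ D p → begin
         ∑↓ D (λ Q _ → ∑↑ 0 Q (λ P _ → 1))
           ≡⟨ ∑↓-cong D (λ Q _ e → trans (∑↑-const 0 Q 1) (cong (λ k → suc k ℕ.* 1) e)) ⟩
         ∑↓ D (λ Q _ → suc (suc (length D)) ℕ.* 1)
           ≡⟨ ∑↓-const D _ ⟩
         suc (length D) ℕ.* (suc (suc (length D)) ℕ.* 1)
           ≡⟨ ℕ.*-assoc (suc (length D)) (suc (suc (length D))) 1 ⟨
         suc (length D) ℕ.* suc (suc (length D)) ℕ.* 1
           ≡⟨ cong (λ k → suc k ℕ.* suc (suc k) ℕ.* 1) (trans (length-Path p) (ℕ.+-identityʳ (dbl n))) ⟩
         suc (dbl n) ℕ.* suc (suc (dbl n)) ℕ.* 1 ∎) ⟩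
  S n 0 (λ D → suc (dbl n) ℕ.* suc (suc (dbl n)) ℕ.* 1)
    ≡⟨ S-*ˡ n 0 (suc (dbl n) ℕ.* suc (suc (dbl n))) (λ _ → 1) ⟩
  suc (dbl n) ℕ.* suc (suc (dbl n)) ℕ.* catalan n ∎

dbl≡2* : ∀ n → dbl n ≡ 2 ℕ.* n
dbl≡2* zero    = refl
dbl≡2* (suc n) = cong suc (trans (cong suc (dbl≡2* n)) (sym (ℕ.+-suc n (n ℕ.+ 0))))

catalan-rec : ∀ n → suc (suc n) ℕ.* catalan (suc n) ≡ 2 ℕ.* (2 ℕ.* n ℕ.+ 1) ℕ.* catalan n
catalan-rec n = ℕ.*-cancelˡ-≡ _ _ (suc n) (begin
  suc n ℕ.* (suc (suc n) ℕ.* catalan (suc n))      ≡⟨ ℕ.*-assoc (suc n) (suc (suc n)) (catalan (suc n)) ⟨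
  suc n ℕ.* suc (suc n) ℕ.* catalan (suc n)        ≡⟨ catalan-rec′ n ⟩
  suc (dbl n) ℕ.* suc (suc (dbl n)) ℕ.* catalan n  ≡⟨ cong (λ k → suc k ℕ.* suc (suc k) ℕ.* catalan n) (dbl≡2* n) ⟩
  suc (2 ℕ.* n) ℕ.* suc (suc (2 ℕ.* n)) ℕ.* catalan n ≡⟨ expand n (catalan n) ⟩
  suc n ℕ.* (2 ℕ.* (2 ℕ.* n ℕ.+ 1) ℕ.* catalan n)  ∎)
  where
  expand : ∀ n c → suc (2 ℕ.* n) ℕ.* suc (suc (2 ℕ.* n)) ℕ.* c ≡ suc n ℕ.* (2 ℕ.* (2 ℕ.* n ℕ.+ 1) ℕ.* c)
  expand = solve-∀

-- Convolutions and the sum of the squared semilengths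

∑² : (ℕ → ℕ → ℕ) → ℕ → ℕ
∑² f zero    = f 0 0
∑² f (suc n) = f 0 (suc n) ℕ.+ ∑² (f ∘ suc) n

∑²-cong : ∀ n {f g : ℕ → ℕ → ℕ} → (∀ i j → i ℕ.+ j ≡ n → f i j ≡ g i j) → ∑² f n ≡ ∑² g n
∑²-cong zero    f≡g = f≡g 0 0 refl
∑²-cong (suc n) f≡g = cong₂ ℕ._+_ (f≡g 0 (suc n) refl) (∑²-cong n (λ i j e → f≡g (suc i) j (cong suc e)))

∑²-distrib-+ : ∀ n (f g : ℕ → ℕ → ℕ) → ∑² (λ i j → f i j ℕ.+ g i j) n ≡ ∑² f n ℕ.+ ∑² g n
∑²-distrib-+ zero    f g = refl
∑²-distrib-+ (suc n) f g =
  trans (cong (f 0 (suc n) ℕ.+ g 0 (suc n) ℕ.+_) (∑²-distrib-+ n (f ∘ suc) (g ∘ suc)))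
        (+-interchange (f 0 (suc n)) _ _ _)

∑²-*ˡ : ∀ n c (f : ℕ → ℕ → ℕ) → ∑² (λ i j → c ℕ.* f i j) n ≡ c ℕ.* ∑² f n
∑²-*ˡ zero    c f = refl
∑²-*ˡ (suc n) c f =
  trans (cong (c ℕ.* f 0 (suc n) ℕ.+_) (∑²-*ˡ n c (f ∘ suc))) (sym (ℕ.*-distribˡ-+ c (f 0 (suc n)) _))

∑²-last : ∀ n (f : ℕ → ℕ → ℕ) → ∑² f (suc n) ≡ ∑² (λ i j → f i (suc j)) n ℕ.+ f (suc n) 0
∑²-last zero    f = refl
∑²-last (suc n) f = trans (cong (f 0 (suc (suc n)) ℕ.+_) (∑²-last n (f ∘ suc))) (sym (ℕ.+-assoc (f 0 (suc (suc n))) _ _))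

∑²-swap : ∀ n (f : ℕ → ℕ → ℕ) → ∑² f n ≡ ∑² (λ i j → f j i) n
∑²-swap zero    f = refl
∑²-swap (suc n) f = begin
  f 0 (suc n) ℕ.+ ∑² (f ∘ suc) n                   ≡⟨ cong (f 0 (suc n) ℕ.+_) (∑²-swap n (f ∘ suc)) ⟩
  f 0 (suc n) ℕ.+ ∑² (λ i j → f (suc j) i) n       ≡⟨ ℕ.+-comm (f 0 (suc n)) _ ⟩
  ∑² (λ i j → f (suc j) i) n ℕ.+ f 0 (suc n)       ≡⟨ ∑²-last n (λ i j → f j i) ⟨
  ∑² (λ i j → f j i) (suc n)                       ∎

infixl 7 _⊛_
_⊛_ : (ℕ → ℕ) → (ℕ → ℕ) → ℕ → ℕ
(f ⊛ g) n = ∑² (λ i j → f i ℕ.* g j) n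

⊛-comm : ∀ f g n → (f ⊛ g) n ≡ (g ⊛ f) n
⊛-comm f g n = trans (∑²-swap n (λ i j → f i ℕ.* g j)) (∑²-cong n (λ i j _ → ℕ.*-comm (f j) (g i)))

⊛-congˡ : ∀ f {g g′} n → (∀ i → i ℕ.≤ n → g i ≡ g′ i) → (f ⊛ g) n ≡ (f ⊛ g′) n
⊛-congˡ f n g≡g′ = ∑²-cong n (λ i j e → cong (f i ℕ.*_) (g≡g′ j (subst (j ℕ.≤_) e (ℕ.m≤n+m j i))))

⊛-distribˡ : ∀ f g h n → (f ⊛ (λ i → g i ℕ.+ h i)) n ≡ (f ⊛ g) n ℕ.+ (f ⊛ h) n
⊛-distribˡ f g h n = trans (∑²-cong n (λ i j _ → ℕ.*-distribˡ-+ (f i) (g j) (h j))) (∑²-distrib-+ n _ _)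

⊛-assoc : ∀ f g h n → ((f ⊛ g) ⊛ h) n ≡ (f ⊛ (g ⊛ h)) n
⊛-assoc f g h zero    = ℕ.*-assoc (f 0) (g 0) (h 0)
⊛-assoc f g h (suc n) = begin
  f 0 ℕ.* g 0 ℕ.* h (suc n) ℕ.+ ∑² (λ i j → (f 0 ℕ.* g (suc i) ℕ.+ ((f ∘ suc) ⊛ g) i) ℕ.* h j) n
    ≡⟨ cong (f 0 ℕ.* g 0 ℕ.* h (suc n) ℕ.+_) (trans
         (∑²-cong n (λ i j _ → expand (f 0) (g (suc i)) (((f ∘ suc) ⊛ g) i) (h j)))
         (trans (∑²-distrib-+ n _ _) (cong₂ ℕ._+_ (∑²-*ˡ n (f 0) _) (⊛-assoc (f ∘ suc) g h n)))) ⟩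
  f 0 ℕ.* g 0 ℕ.* h (suc n) ℕ.+ (f 0 ℕ.* ((g ∘ suc) ⊛ h) n ℕ.+ ((f ∘ suc) ⊛ (g ⊛ h)) n)
    ≡⟨ collect (f 0) (g 0) (h (suc n)) _ _ ⟩
  f 0 ℕ.* (g 0 ℕ.* h (suc n) ℕ.+ ((g ∘ suc) ⊛ h) n) ℕ.+ ((f ∘ suc) ⊛ (g ⊛ h)) n ∎
  where
  expand : ∀ a b c d → (a ℕ.* b ℕ.+ c) ℕ.* d ≡ a ℕ.* (b ℕ.* d) ℕ.+ c ℕ.* d
  expand = solve-∀
  collect : ∀ a b c d e → a ℕ.* b ℕ.* c ℕ.+ (a ℕ.* d ℕ.+ e) ≡ a ℕ.* (b ℕ.* c ℕ.+ d) ℕ.+ e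
  collect = solve-∀

-- H (wt h w) v, where v is what remains of w after the first visit to height 0
-- (0 if there is no such visit).
atFirstVisit : ℕ → (ℕ → Word → ℕ) → Word → ℕ
atFirstVisit zero    H w       = H 0 w
atFirstVisit (suc h) H []      = 0
atFirstVisit (suc h) H (↑ ∷ w) = atFirstVisit (suc (suc h)) H w
atFirstVisit (suc h) H (↓ ∷ w) = atFirstVisit h (H ∘ suc) w

-- Cut the path at its first visit to 0. The part before has `i` letters `↑` and ends with a forced
-- `↓`; without that letter, and lowered by one, it is an arbitrary path from height `h` to 0. The
-- part after is an arbitrary path from 0.
S-atFirstVisit : ∀ u h (H : ℕ → Word → ℕ) →
  S u (suc h) (atFirstVisit (suc h) H) ≡
  ∑² (λ i j → S i h (λ _ → 1) ℕ.* S j 0 (H (suc (i ℕ.+ h)))) u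
S-atFirstVisit zero    zero    H = sym (ℕ.+-identityʳ _)
S-atFirstVisit zero    (suc h) H = S-atFirstVisit zero h (H ∘ suc)
S-atFirstVisit (suc u) zero    H = trans
  (cong₂ ℕ._+_ (S-atFirstVisit u 1 H) (sym (ℕ.+-identityʳ _)))
  (trans (ℕ.+-comm (∑² _ u) _) (cong (1 ℕ.* S (suc u) 0 (H 1) ℕ.+_)
    (∑²-cong u (λ i j _ → cong (λ k → S i 1 (λ _ → 1) ℕ.* S j 0 (H (suc k))) (ℕ.+-suc i 0)))))
S-atFirstVisit (suc u) (suc h) H = begin
  S u (3 ℕ.+ h) (atFirstVisit (3 ℕ.+ h) H) ℕ.+ S (suc u) (suc h) (atFirstVisit (suc h) (H ∘ suc))
    ≡⟨ cong₂ ℕ._+_ (S-atFirstVisit u (2 ℕ.+ h) H) (S-atFirstVisit (suc u) h (H ∘ suc)) ⟩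
  ∑² (λ i j → N i (2 ℕ.+ h) ℕ.* S j 0 (H (suc (i ℕ.+ (2 ℕ.+ h))))) u
    ℕ.+ (N 0 h ℕ.* S (suc u) 0 (H (2 ℕ.+ h)) ℕ.+ ∑² (λ i j → N (suc i) h ℕ.* S j 0 (H (suc (suc (suc i ℕ.+ h))))) u)
    ≡⟨ regroup (∑² _ u) (N 0 h ℕ.* S (suc u) 0 (H (2 ℕ.+ h))) _ ⟩
  N 0 h ℕ.* S (suc u) 0 (H (2 ℕ.+ h)) ℕ.+ (∑² (λ i j → N i (2 ℕ.+ h) ℕ.* S j 0 (H (suc (i ℕ.+ (2 ℕ.+ h))))) u
    ℕ.+ ∑² (λ i j → N (suc i) h ℕ.* S j 0 (H (suc (suc (suc i ℕ.+ h))))) u)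
    ≡⟨ cong (N 0 h ℕ.* S (suc u) 0 (H (2 ℕ.+ h)) ℕ.+_) (∑²-distrib-+ u _ _) ⟨
  N 0 h ℕ.* S (suc u) 0 (H (2 ℕ.+ h)) ℕ.+ ∑² (λ i j → N i (2 ℕ.+ h) ℕ.* S j 0 (H (suc (i ℕ.+ (2 ℕ.+ h))))
    ℕ.+ N (suc i) h ℕ.* S j 0 (H (suc (suc (suc i ℕ.+ h))))) u
    ≡⟨ cong (N 0 h ℕ.* S (suc u) 0 (H (2 ℕ.+ h)) ℕ.+_) (∑²-cong u (λ i j _ → begin
         N i (2 ℕ.+ h) ℕ.* S j 0 (H (suc (i ℕ.+ (2 ℕ.+ h)))) ℕ.+ N (suc i) h ℕ.* S j 0 (H (suc (suc (suc i ℕ.+ h))))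
           ≡⟨ cong₂ (λ a b → N i (2 ℕ.+ h) ℕ.* S j 0 (H (suc a)) ℕ.+ N (suc i) h ℕ.* S j 0 (H (suc (suc b))))
                (ℕ.+-suc i (suc h)) (sym (ℕ.+-suc i h)) ⟩
         N i (2 ℕ.+ h) ℕ.* S j 0 (H (suc (suc i ℕ.+ suc h))) ℕ.+ N (suc i) h ℕ.* S j 0 (H (suc (suc i ℕ.+ suc h)))
           ≡⟨ ℕ.*-distribʳ-+ _ (N i (2 ℕ.+ h)) (N (suc i) h) ⟨
         N (suc i) (suc h) ℕ.* S j 0 (H (suc (suc i ℕ.+ suc h))) ∎)) ⟩
  ∑² (λ i j → N i (suc h) ℕ.* S j 0 (H (suc (i ℕ.+ suc h)))) (suc u) ∎
  where
  N : ℕ → ℕ → ℕ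
  N i h = S i h (λ _ → 1)
  regroup : ∀ a b c → a ℕ.+ (b ℕ.+ c) ≡ b ℕ.+ (a ℕ.+ c)
  regroup = solve-∀

atFirstVisit-wt : ∀ (f : ℕ → ℕ) {u h w} → Path u h w → f (wt h w) ≡ atFirstVisit h (λ t _ → f t) w
atFirstVisit-wt f []                   = refl
atFirstVisit-wt f (↑∷_ {h = zero}  p)  = refl
atFirstVisit-wt f (↑∷_ {h = suc h} p)  = atFirstVisit-wt f p
atFirstVisit-wt f (↓∷_ p)              = atFirstVisit-wt (f ∘ suc) p

atFirstVisit-squares : ∀ {u h w} → Path u h w → squares h w ≡ atFirstVisit h (λ _ → squares 0) w
atFirstVisit-squares []                  = refl
atFirstVisit-squares (↑∷_ {h = zero}  p) = refl
atFirstVisit-squares (↑∷_ {h = suc h} p) = atFirstVisit-squares p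
atFirstVisit-squares (↓∷_ p)             = atFirstVisit-squares p

catalan-⊛ : ∀ n → catalan (suc n) ≡ (catalan ⊛ catalan) n
catalan-⊛ n = trans (S-cong n 1 (λ w → atFirstVisit-wt (λ _ → 1))) (S-atFirstVisit n 0 (λ _ _ → 1))

-- There are `catalan i` excursions of semilength i + 1, so `squareCatalan i` is the sum of their
-- squared semilengths. Stated through `catalan`, the central binomial coefficients need no division
-- here; `centralBinomial≡C` identifies them later.
squareCatalan centralBinomial squaresTotal : ℕ → ℕ
squareCatalan i = suc i ℕ.* suc i ℕ.* catalan i
centralBinomial i = suc i ℕ.* catalan i
squaresTotal n = S n 0 (squares 0)

-- Splits off the first excursion: either its own square is counted, or the squares of the path that
-- follows it.
squaresTotal-suc : ∀ n → squaresTotal (suc n) ≡ (squareCatalan ⊛ catalan) n ℕ.+ (catalan ⊛ squaresTotal) n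
squaresTotal-suc n = begin
  S n 1 (λ w → wt 1 w ℕ.* wt 1 w ℕ.+ squares 1 w)
    ≡⟨ S-distrib-+ n 1 _ _ ⟩
  S n 1 (λ w → wt 1 w ℕ.* wt 1 w) ℕ.+ S n 1 (squares 1)
    ≡⟨ cong₂ ℕ._+_
         (trans (S-cong n 1 (λ w → atFirstVisit-wt (λ t → t ℕ.* t))) (S-atFirstVisit n 0 (λ t _ → t ℕ.* t)))
         (trans (S-cong n 1 (λ w → atFirstVisit-squares)) (S-atFirstVisit n 0 (λ _ → squares 0))) ⟩
  ∑² (λ i j → catalan i ℕ.* S j 0 (λ _ → suc (i ℕ.+ 0) ℕ.* suc (i ℕ.+ 0))) n ℕ.+ (catalan ⊛ squaresTotal) n
    ≡⟨ cong (ℕ._+ (catalan ⊛ squaresTotal) n) (∑²-cong n (λ i j _ → begin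
         catalan i ℕ.* S j 0 (λ _ → suc (i ℕ.+ 0) ℕ.* suc (i ℕ.+ 0))
           ≡⟨ cong (catalan i ℕ.*_) (trans (S-cong j 0 (λ _ _ → trans (cong (λ k → suc k ℕ.* suc k) (ℕ.+-identityʳ i)) (sym (ℕ.*-identityʳ (suc i ℕ.* suc i)))))
                (S-*ˡ j 0 (suc i ℕ.* suc i) (λ _ → 1))) ⟩
         catalan i ℕ.* (suc i ℕ.* suc i ℕ.* catalan j)
           ≡⟨ rotate (catalan i) (suc i ℕ.* suc i) (catalan j) ⟩
         squareCatalan i ℕ.* catalan j ∎)) ⟩
  (squareCatalan ⊛ catalan) n ℕ.+ (catalan ⊛ squaresTotal) n ∎
  where
  rotate : ∀ a b c → a ℕ.* (b ℕ.* c) ≡ b ℕ.* a ℕ.* c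
  rotate = solve-∀

-- Marking an excursion of a path and moving it to the front.
squaresTotal+squareCatalan : ∀ n → squaresTotal n ℕ.+ squareCatalan n ≡ (squareCatalan ⊛ catalan) n
squaresTotal+squareCatalan = <-rec _ step
  where
  step : ∀ n → (∀ {i} → i ℕ.< n → squaresTotal i ℕ.+ squareCatalan i ≡ (squareCatalan ⊛ catalan) i) →
         squaresTotal n ℕ.+ squareCatalan n ≡ (squareCatalan ⊛ catalan) n
  step zero    ih = refl
  step (suc n) ih = begin
    squaresTotal (suc n) ℕ.+ squareCatalan (suc n)
      ≡⟨ cong (ℕ._+ squareCatalan (suc n)) (squaresTotal-suc n) ⟩
    (squareCatalan ⊛ catalan) n ℕ.+ (catalan ⊛ squaresTotal) n ℕ.+ squareCatalan (suc n)
      ≡⟨ cong (ℕ._+ squareCatalan (suc n)) (begin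
           (squareCatalan ⊛ catalan) n ℕ.+ (catalan ⊛ squaresTotal) n
             ≡⟨ cong (ℕ._+ (catalan ⊛ squaresTotal) n) (⊛-comm squareCatalan catalan n) ⟩
           (catalan ⊛ squareCatalan) n ℕ.+ (catalan ⊛ squaresTotal) n
             ≡⟨ ℕ.+-comm ((catalan ⊛ squareCatalan) n) _ ⟩
           (catalan ⊛ squaresTotal) n ℕ.+ (catalan ⊛ squareCatalan) n
             ≡⟨ ⊛-distribˡ catalan squaresTotal squareCatalan n ⟨
           (catalan ⊛ (λ i → squaresTotal i ℕ.+ squareCatalan i)) n
             ≡⟨ ⊛-congˡ catalan n (λ i i≤n → ih (ℕ.s≤s i≤n)) ⟩
           (catalan ⊛ (squareCatalan ⊛ catalan)) n
             ≡⟨ ⊛-comm catalan (squareCatalan ⊛ catalan) n ⟩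
           ((squareCatalan ⊛ catalan) ⊛ catalan) n
             ≡⟨ ⊛-assoc squareCatalan catalan catalan n ⟩
           (squareCatalan ⊛ (catalan ⊛ catalan)) n
             ≡⟨ ⊛-congˡ squareCatalan n (λ i _ → sym (catalan-⊛ i)) ⟩
           (squareCatalan ⊛ (catalan ∘ suc)) n ∎) ⟩
    (squareCatalan ⊛ (catalan ∘ suc)) n ℕ.+ squareCatalan (suc n)
      ≡⟨ cong ((squareCatalan ⊛ (catalan ∘ suc)) n ℕ.+_) (ℕ.*-identityʳ (squareCatalan (suc n))) ⟨
    (squareCatalan ⊛ (catalan ∘ suc)) n ℕ.+ squareCatalan (suc n) ℕ.* 1
      ≡⟨ ∑²-last n (λ i j → squareCatalan i ℕ.* catalan j) ⟨
    (squareCatalan ⊛ catalan) (suc n) ∎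

-- The form is that of b′ = 4x b′ + 2b, compared at xⁱ.
centralBinomial-rec : ∀ i → suc i ℕ.* centralBinomial (suc i) ≡ 4 ℕ.* (i ℕ.* centralBinomial i) ℕ.+ 2 ℕ.* centralBinomial i
centralBinomial-rec i = trans (cong (suc i ℕ.*_) (catalan-rec i)) (expand i (catalan i))
  where
  expand : ∀ i c → suc i ℕ.* (2 ℕ.* (2 ℕ.* i ℕ.+ 1) ℕ.* c) ≡ 4 ℕ.* (i ℕ.* (suc i ℕ.* c)) ℕ.+ 2 ℕ.* (suc i ℕ.* c)
  expand = solve-∀

-- The generating function b = ∑ bᵢ xⁱ of the central binomial coefficients
-- satisfies (1 - 4x) b′ = 2b, hence (1 - 4x) (b²)′ = 4 b².
centralBinomial-⊛ : ∀ n → (centralBinomial ⊛ centralBinomial) n ≡ 4 ^ n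
centralBinomial-⊛ zero    = refl
centralBinomial-⊛ (suc n) = trans (ℕ.*-cancelˡ-≡ _ _ (suc n) (begin
  suc n ℕ.* (b ⊛ b) (suc n)                 ≡⟨ derivation (suc n) ⟨
  2 ℕ.* (θb ⊛ b) (suc n)                    ≡⟨ cong (2 ℕ.*_) (begin
    ∑² (λ i j → suc i ℕ.* b (suc i) ℕ.* b j) n
      ≡⟨ ∑²-cong n (λ i j _ → trans (cong (ℕ._* b j) (centralBinomial-rec i)) (expand (θb i) (b i) (b j))) ⟩
    ∑² (λ i j → 4 ℕ.* (θb i ℕ.* b j) ℕ.+ 2 ℕ.* (b i ℕ.* b j)) n
      ≡⟨ ∑²-distrib-+ n _ _ ⟩
    ∑² (λ i j → 4 ℕ.* (θb i ℕ.* b j)) n ℕ.+ ∑² (λ i j → 2 ℕ.* (b i ℕ.* b j)) n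
      ≡⟨ cong₂ ℕ._+_ (∑²-*ˡ n 4 _) (∑²-*ˡ n 2 _) ⟩
    4 ℕ.* (θb ⊛ b) n ℕ.+ 2 ℕ.* (b ⊛ b) n ∎) ⟩
  2 ℕ.* (4 ℕ.* (θb ⊛ b) n ℕ.+ 2 ℕ.* (b ⊛ b) n)   ≡⟨ regroup ((θb ⊛ b) n) ((b ⊛ b) n) ⟩
  4 ℕ.* (2 ℕ.* (θb ⊛ b) n) ℕ.+ 4 ℕ.* (b ⊛ b) n   ≡⟨ cong (λ x → 4 ℕ.* x ℕ.+ 4 ℕ.* (b ⊛ b) n) (derivation n) ⟩
  4 ℕ.* (n ℕ.* (b ⊛ b) n) ℕ.+ 4 ℕ.* (b ⊛ b) n    ≡⟨ collect n ((b ⊛ b) n) ⟩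
  suc n ℕ.* (4 ℕ.* (b ⊛ b) n)                    ∎))
  (cong (4 ℕ.*_) (centralBinomial-⊛ n))
  where
  b θb : ℕ → ℕ
  b = centralBinomial
  θb i = i ℕ.* b i
  derivation : ∀ n → 2 ℕ.* (θb ⊛ b) n ≡ n ℕ.* (b ⊛ b) n
  derivation n = begin
    2 ℕ.* (θb ⊛ b) n                  ≡⟨ cong ((θb ⊛ b) n ℕ.+_) (ℕ.+-identityʳ _) ⟩
    (θb ⊛ b) n ℕ.+ (θb ⊛ b) n         ≡⟨ cong ((θb ⊛ b) n ℕ.+_) (⊛-comm θb b n) ⟩
    (θb ⊛ b) n ℕ.+ (b ⊛ θb) n         ≡⟨ ∑²-distrib-+ n _ _ ⟨
    ∑² (λ i j → θb i ℕ.* b j ℕ.+ b i ℕ.* θb j) n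
      ≡⟨ ∑²-cong n (λ i j e → trans (leibniz i j (b i) (b j)) (cong (ℕ._* (b i ℕ.* b j)) e)) ⟩
    ∑² (λ i j → n ℕ.* (b i ℕ.* b j)) n  ≡⟨ ∑²-*ˡ n n _ ⟩
    n ℕ.* (b ⊛ b) n                   ∎
    where
    leibniz : ∀ i j x y → i ℕ.* x ℕ.* y ℕ.+ x ℕ.* (j ℕ.* y) ≡ (i ℕ.+ j) ℕ.* (x ℕ.* y)
    leibniz = solve-∀
  expand : ∀ x y z → (4 ℕ.* x ℕ.+ 2 ℕ.* y) ℕ.* z ≡ 4 ℕ.* (x ℕ.* z) ℕ.+ 2 ℕ.* (y ℕ.* z)
  expand = solve-∀
  regroup : ∀ x y → 2 ℕ.* (4 ℕ.* x ℕ.+ 2 ℕ.* y) ≡ 4 ℕ.* (2 ℕ.* x) ℕ.+ 4 ℕ.* y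
  regroup = solve-∀
  collect : ∀ n x → 4 ℕ.* (n ℕ.* x) ℕ.+ 4 ℕ.* x ≡ suc n ℕ.* (4 ℕ.* x)
  collect = solve-∀

-- Completing the square: (i + 1)² + (j + 1)² + 2 (i + 1)(j + 1) = (n + 2)² for i + j = n. By
-- symmetry the two squares give the same convolution, and the mixed term is the convolution of the
-- central binomial coefficients.
squareCatalan-⊛ : ∀ n → 2 ℕ.* (squareCatalan ⊛ catalan) n ℕ.+ 2 ℕ.* 4 ^ n ≡
                        suc (suc n) ℕ.* suc (suc n) ℕ.* catalan (suc n)
squareCatalan-⊛ n = begin
  2 ℕ.* (squareCatalan ⊛ catalan) n ℕ.+ 2 ℕ.* 4 ^ n
    ≡⟨ cong₂ ℕ._+_
         (trans (cong ((squareCatalan ⊛ catalan) n ℕ.+_) (ℕ.+-identityʳ _))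
           (trans (cong ((squareCatalan ⊛ catalan) n ℕ.+_) (⊛-comm squareCatalan catalan n)) (sym (∑²-distrib-+ n _ _))))
         (trans (cong (2 ℕ.*_) (sym (centralBinomial-⊛ n))) (sym (∑²-*ˡ n 2 _))) ⟩
  ∑² (λ i j → squareCatalan i ℕ.* catalan j ℕ.+ catalan i ℕ.* squareCatalan j) n
    ℕ.+ ∑² (λ i j → 2 ℕ.* (centralBinomial i ℕ.* centralBinomial j)) n
    ≡⟨ ∑²-distrib-+ n _ _ ⟨
  ∑² (λ i j → squareCatalan i ℕ.* catalan j ℕ.+ catalan i ℕ.* squareCatalan j ℕ.+ 2 ℕ.* (centralBinomial i ℕ.* centralBinomial j)) n
    ≡⟨ ∑²-cong n (λ i j e → trans (square i j (catalan i) (catalan j))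
         (cong (λ k → suc (suc k) ℕ.* suc (suc k) ℕ.* (catalan i ℕ.* catalan j)) e)) ⟩
  ∑² (λ i j → suc (suc n) ℕ.* suc (suc n) ℕ.* (catalan i ℕ.* catalan j)) n
    ≡⟨ ∑²-*ˡ n (suc (suc n) ℕ.* suc (suc n)) _ ⟩
  suc (suc n) ℕ.* suc (suc n) ℕ.* (catalan ⊛ catalan) n
    ≡⟨ cong (suc (suc n) ℕ.* suc (suc n) ℕ.*_) (catalan-⊛ n) ⟨
  suc (suc n) ℕ.* suc (suc n) ℕ.* catalan (suc n) ∎
  where
  square : ∀ i j x y → suc i ℕ.* suc i ℕ.* x ℕ.* y ℕ.+ x ℕ.* (suc j ℕ.* suc j ℕ.* y) ℕ.+ 2 ℕ.* ((suc i ℕ.* x) ℕ.* (suc j ℕ.* y))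
                       ≡ suc (suc (i ℕ.+ j)) ℕ.* suc (suc (i ℕ.+ j)) ℕ.* (x ℕ.* y)
  square = solve-∀

-- The two previous evaluations of `squareCatalan ⊛ catalan` eliminate it, and `catalan-rec`,
-- multiplied by n + 2, eliminates `catalan (suc n)`.
squaresTotal-closed : ∀ n → squaresTotal n ℕ.+ 4 ^ n ≡ (n ℕ.* n ℕ.+ 3 ℕ.* n ℕ.+ 1) ℕ.* catalan n
squaresTotal-closed n = ℕ.*-cancelˡ-≡ _ _ 2 (cross _ _
  (cong₂ ℕ._+_ (cong₂ ℕ._+_ (cong (2 ℕ.*_) (squaresTotal+squareCatalan n)) (squareCatalan-⊛ n))
               (cong (suc (suc n) ℕ.*_) (catalan-rec n)))
  (balance n (squaresTotal n) (4 ^ n) (catalan n) (catalan (suc n)) ((squareCatalan ⊛ catalan) n)))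
  where
  balance : ∀ n r p c c′ y →
    2 ℕ.* (r ℕ.+ p) ℕ.+ (2 ℕ.* y ℕ.+ suc (suc n) ℕ.* suc (suc n) ℕ.* c′ ℕ.+ suc (suc n) ℕ.* (2 ℕ.* (2 ℕ.* n ℕ.+ 1) ℕ.* c))
    ≡ 2 ℕ.* ((n ℕ.* n ℕ.+ 3 ℕ.* n ℕ.+ 1) ℕ.* c)
      ℕ.+ (2 ℕ.* (r ℕ.+ suc n ℕ.* suc n ℕ.* c) ℕ.+ (2 ℕ.* y ℕ.+ 2 ℕ.* p) ℕ.+ suc (suc n) ℕ.* (suc (suc n) ℕ.* c′))
  balance = solve-∀

-- Codes: each entry by its rank among the entries processed before it

insert↓ : ℕ → Word → Word
insert↓ zero    w       = ↓ ∷ w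
insert↓ (suc r) []      = ↓ ∷ []
insert↓ (suc r) (s ∷ w) = s ∷ insert↓ r w

cost↓ : ℕ → Word → ℕ
cost↓ zero    w       = 0
cost↓ (suc r) []      = 0
cost↓ (suc r) (↑ ∷ w) = cost↓ r w
cost↓ (suc r) (↓ ∷ w) = suc (cost↓ r w)

insert↑ : ℕ → ℕ → Word → Word
insert↑ h       zero    w       = ↑ ∷ w
insert↑ h       (suc r) []      = ↑ ∷ []
insert↑ h       (suc r) (↑ ∷ w) = ↑ ∷ insert↑ (suc h) r w
insert↑ zero    (suc r) (↓ ∷ w) = ↑ ∷ insert↓ r w
insert↑ (suc h) (suc r) (↓ ∷ w) = ↓ ∷ insert↑ h r w

cost↑ : ℕ → ℕ → Word → ℕ
cost↑ h       zero    w       = 0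
cost↑ h       (suc r) []      = 0
cost↑ h       (suc r) (↑ ∷ w) = suc (cost↑ (suc h) r w)
cost↑ zero    (suc r) (↓ ∷ w) = suc (cost↓ r w)
cost↑ (suc h) (suc r) (↓ ∷ w) = cost↑ h r w

length-insert↓ : ∀ r w → length (insert↓ r w) ≡ suc (length w)
length-insert↓ zero    w       = refl
length-insert↓ (suc r) []      = refl
length-insert↓ (suc r) (s ∷ w) = cong suc (length-insert↓ r w)

length-insert↑ : ∀ h r w → length (insert↑ h r w) ≡ suc (length w)
length-insert↑ h       zero    w       = refl
length-insert↑ h       (suc r) []      = refl
length-insert↑ h       (suc r) (↑ ∷ w) = cong suc (length-insert↑ (suc h) r w)
length-insert↑ zero    (suc r) (↓ ∷ w) = cong suc (length-insert↓ r w)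
length-insert↑ (suc h) (suc r) (↓ ∷ w) = cong suc (length-insert↑ h r w)

∑-insert↓ : ∀ w K → ∑ (suc (length w)) (λ r → K (insert↓ r w) (cost↓ r w)) ≡ ∑↓ w K
∑-insert↓ []      K = refl
∑-insert↓ (↑ ∷ w) K = cong (K (↓ ∷ ↑ ∷ w) 0 ℕ.+_) (∑-insert↓ w (λ Q c → K (↑ ∷ Q) c))
∑-insert↓ (↓ ∷ w) K = cong (K (↓ ∷ ↓ ∷ w) 0 ℕ.+_) (∑-insert↓ w (λ Q c → K (↓ ∷ Q) (suc c)))

∑-insert↑ : ∀ h w K → ∑ (suc (length w)) (λ r → K (insert↑ h r w) (cost↑ h r w)) ≡ ∑↑ h w K
∑-insert↑ h       []      K = refl
∑-insert↑ h       (↑ ∷ w) K = cong (K (↑ ∷ ↑ ∷ w) 0 ℕ.+_) (∑-insert↑ (suc h) w (λ P c → K (↑ ∷ P) (suc c)))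
∑-insert↑ zero    (↓ ∷ w) K = cong (K (↑ ∷ ↓ ∷ w) 0 ℕ.+_) (∑-insert↓ w (λ P c → K (↑ ∷ P) (suc c)))
∑-insert↑ (suc h) (↓ ∷ w) K = cong (K (↑ ∷ ↓ ∷ w) 0 ℕ.+_) (∑-insert↑ h w (λ P c → K (↓ ∷ P) c))

-- The sum over all lists r₁ ∷ … ∷ rₙ ∷ [] with rᵢ ≤ n - i.
∑codes : ℕ → (List ℕ → ℕ) → ℕ
∑codes zero    g = g []
∑codes (suc n) g = ∑codes n (λ cs → ∑ (suc n) (λ r → g (r ∷ cs)))

∑codes-cong : ∀ n {f g : List ℕ → ℕ} → (∀ cs → length cs ≡ n → f cs ≡ g cs) → ∑codes n f ≡ ∑codes n g
∑codes-cong zero    f≡g = f≡g [] refl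
∑codes-cong (suc n) f≡g = ∑codes-cong n (λ cs e → ∑-cong (suc n) (λ r → f≡g (r ∷ cs) (cong suc e)))

∑codes-distrib-+ : ∀ n (f g : List ℕ → ℕ) → ∑codes n (λ cs → f cs ℕ.+ g cs) ≡ ∑codes n f ℕ.+ ∑codes n g
∑codes-distrib-+ zero    f g = refl
∑codes-distrib-+ (suc n) f g =
  trans (∑codes-cong n (λ cs _ → ∑-distrib-+ (suc n) (λ r → f (r ∷ cs)) (λ r → g (r ∷ cs))))
        (∑codes-distrib-+ n _ _)

∑codes-*ˡ : ∀ n c (f : List ℕ → ℕ) → ∑codes n (λ cs → c ℕ.* f cs) ≡ c ℕ.* ∑codes n f
∑codes-*ˡ zero    c f = refl
∑codes-*ˡ (suc n) c f =
  trans (∑codes-cong n (λ cs _ → ∑-*ˡ (suc n) (λ r → f (r ∷ cs)))) (∑codes-*ˡ n c _)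
  where
  ∑-*ˡ : ∀ n (f : ℕ → ℕ) → ∑ n (λ i → c ℕ.* f i) ≡ c ℕ.* ∑ n f
  ∑-*ˡ zero    f = sym (ℕ.*-zeroʳ c)
  ∑-*ˡ (suc n) f = trans (cong (c ℕ.* f 0 ℕ.+_) (∑-*ˡ n (f ∘ suc))) (sym (ℕ.*-distribˡ-+ c (f 0) _))

-- Lists run through the columns from left to right but are processed from the right: the tail comes
-- first, then the lower entry `x`, then the upper entry `y`.
state : List ℕ → Word
state []           = []
state (r ∷ [])     = []
state (y ∷ x ∷ cs) = insert↑ 0 y (insert↓ x (state cs))

cost : List ℕ → ℕ
cost []           = 0
cost (r ∷ [])     = 0
cost (y ∷ x ∷ cs) = cost cs ℕ.+ (cost↓ x (state cs) ℕ.+ cost↑ 0 y (insert↓ x (state cs)))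

length-state : ∀ n cs → length cs ≡ dbl n → length (state cs) ≡ dbl n
length-state zero    []           e = refl
length-state (suc n) (y ∷ x ∷ cs) e =
  trans (length-insert↑ 0 y (insert↓ x (state cs)))
        (cong suc (trans (length-insert↓ x (state cs))
                         (cong suc (length-state n cs (ℕ.suc-injective (ℕ.suc-injective e))))))

-- By `length-state` the ranges of the two ranks are exactly the gaps of the word before each
-- insertion, so summing over ranks is summing over insertions.
∑codes-step : ∀ n (G : List ℕ → Word → ℕ → ℕ) →
  ∑codes (dbl (suc n)) (λ { (y ∷ x ∷ cs) → G cs (insert↑ 0 y (insert↓ x (state cs)))
                                             (cost↓ x (state cs) ℕ.+ cost↑ 0 y (insert↓ x (state cs)))
                          ; _            → 0 }) ≡
  ∑codes (dbl n) (λ cs → ∑↓ (state cs) (λ Q i → ∑↑ 0 Q (λ P c → G cs P (i ℕ.+ c))))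
∑codes-step n G = ∑codes-cong (dbl n) λ cs e → begin
  ∑ (suc (dbl n)) (λ x → ∑ (suc (suc (dbl n))) (λ y →
    G cs (insert↑ 0 y (insert↓ x (state cs))) (cost↓ x (state cs) ℕ.+ cost↑ 0 y (insert↓ x (state cs)))))
    ≡⟨ cong (λ k → ∑ (suc k) (λ x → ∑ (suc (suc k)) (λ y →
         G cs (insert↑ 0 y (insert↓ x (state cs))) (cost↓ x (state cs) ℕ.+ cost↑ 0 y (insert↓ x (state cs))))))
         (length-state n cs e) ⟨
  ∑ (suc (length (state cs))) (λ x → ∑ (suc (suc (length (state cs)))) (λ y →
    G cs (insert↑ 0 y (insert↓ x (state cs))) (cost↓ x (state cs) ℕ.+ cost↑ 0 y (insert↓ x (state cs)))))
    ≡⟨ ∑-cong (suc (length (state cs))) (λ x → trans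
         (cong (λ k → ∑ (suc k) (λ y → G cs (insert↑ 0 y (insert↓ x (state cs))) (cost↓ x (state cs) ℕ.+ cost↑ 0 y (insert↓ x (state cs)))))
               (sym (length-insert↓ x (state cs))))
         (∑-insert↑ 0 (insert↓ x (state cs)) (λ P c → G cs P (cost↓ x (state cs) ℕ.+ c)))) ⟩
  ∑ (suc (length (state cs))) (λ x → ∑↑ 0 (insert↓ x (state cs)) (λ P c → G cs P (cost↓ x (state cs) ℕ.+ c)))
    ≡⟨ ∑-insert↓ (state cs) (λ Q i → ∑↑ 0 Q (λ P c → G cs P (i ℕ.+ c))) ⟩
  ∑↓ (state cs) (λ Q i → ∑↑ 0 Q (λ P c → G cs P (i ℕ.+ c))) ∎

-- The number of codes that lead to any one path of semilength n, the product of the fibre sizes of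
-- all steps; it equals n! (n + 1)! by `κ-factorial`.
κ : ℕ → ℕ
κ zero    = 1
κ (suc n) = κ n ℕ.* (suc n ℕ.* suc (suc n))

∑codes-state : ∀ n F → ∑codes (dbl n) (F ∘ state) ≡ κ n ℕ.* S n 0 F
∑codes-state zero    F = sym (ℕ.+-identityʳ _)
∑codes-state (suc n) F = begin
  ∑codes (dbl (suc n)) (F ∘ state)
    ≡⟨ ∑codes-step n (λ _ P _ → F P) ⟩
  ∑codes (dbl n) (λ cs → ∑↓ (state cs) (λ Q _ → ∑↑ 0 Q (λ P _ → F P)))
    ≡⟨ ∑codes-state n (λ D → ∑↓ D (λ Q _ → ∑↑ 0 Q (λ P _ → F P))) ⟩
  κ n ℕ.* S n 0 (λ D → ∑↓ D (λ Q _ → ∑↑ 0 Q (λ P _ → F P)))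
    ≡⟨ cong (κ n ℕ.*_) (S-∑↓∑↑-uniform n F) ⟩
  κ n ℕ.* (suc n ℕ.* suc (suc n) ℕ.* S (suc n) 0 F)
    ≡⟨ ℕ.*-assoc (κ n) (suc n ℕ.* suc (suc n)) (S (suc n) 0 F) ⟨
  κ (suc n) ℕ.* S (suc n) 0 F ∎

-- The recurrence for the total cost

totalCost stepTotal : ℕ → ℕ
totalCost n = ∑codes (dbl n) cost
stepTotal n = S n 0 (λ P → preimages 0 P stepCost)

-- The cost of the earlier columns recurs for each of the (2n + 1)(2n + 2) pairs of new ranks. The
-- new cost depends on the earlier codes only through `state`, so it may be summed over paths with
-- the factor `κ n`.
totalCost-suc : ∀ n → totalCost (suc n) ≡
  suc (dbl n) ℕ.* suc (suc (dbl n)) ℕ.* totalCost n ℕ.+ κ n ℕ.* stepTotal (suc n)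
totalCost-suc n = begin
  totalCost (suc n)
    ≡⟨ ∑codes-step n (λ cs _ c → cost cs ℕ.+ c) ⟩
  ∑codes (dbl n) (λ cs → ∑↓ (state cs) (λ Q i → ∑↑ 0 Q (λ P c → cost cs ℕ.+ (i ℕ.+ c))))
    ≡⟨ ∑codes-cong (dbl n) (λ cs e → split cs (length-state n cs e)) ⟩
  ∑codes (dbl n) (λ cs → suc (dbl n) ℕ.* suc (suc (dbl n)) ℕ.* cost cs ℕ.+ F (state cs))
    ≡⟨ ∑codes-distrib-+ (dbl n) (λ cs → suc (dbl n) ℕ.* suc (suc (dbl n)) ℕ.* cost cs) (F ∘ state) ⟩
  ∑codes (dbl n) (λ cs → suc (dbl n) ℕ.* suc (suc (dbl n)) ℕ.* cost cs) ℕ.+ ∑codes (dbl n) (F ∘ state)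
    ≡⟨ cong₂ ℕ._+_ (∑codes-*ˡ (dbl n) (suc (dbl n) ℕ.* suc (suc (dbl n))) cost) (trans (∑codes-state n F) (cong (κ n ℕ.*_) (S-∑↓∑↑ n (λ _ c → c)))) ⟩
  suc (dbl n) ℕ.* suc (suc (dbl n)) ℕ.* totalCost n ℕ.+ κ n ℕ.* stepTotal (suc n) ∎
  where
  F : Word → ℕ
  F D = ∑↓ D (λ Q i → ∑↑ 0 Q (λ P c → i ℕ.+ c))
  split : ∀ cs → length (state cs) ≡ dbl n →
          ∑↓ (state cs) (λ Q i → ∑↑ 0 Q (λ P c → cost cs ℕ.+ (i ℕ.+ c))) ≡
          suc (dbl n) ℕ.* suc (suc (dbl n)) ℕ.* cost cs ℕ.+ F (state cs)
  split cs e = begin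
    ∑↓ (state cs) (λ Q i → ∑↑ 0 Q (λ P c → cost cs ℕ.+ (i ℕ.+ c)))
      ≡⟨ ∑↓-cong (state cs) (λ Q i e′ → trans (∑↑-distrib-+ 0 Q (λ _ _ → cost cs) (λ _ c → i ℕ.+ c))
           (cong (ℕ._+ ∑↑ 0 Q (λ _ c → i ℕ.+ c)) (trans (∑↑-const 0 Q (cost cs)) (cong (λ k → suc k ℕ.* cost cs) (trans e′ (cong suc e)))))) ⟩
    ∑↓ (state cs) (λ Q i → suc (suc (dbl n)) ℕ.* cost cs ℕ.+ ∑↑ 0 Q (λ P c → i ℕ.+ c))
      ≡⟨ ∑↓-distrib-+ (state cs) (λ _ _ → suc (suc (dbl n)) ℕ.* cost cs) (λ Q i → ∑↑ 0 Q (λ P c → i ℕ.+ c)) ⟩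
    ∑↓ (state cs) (λ _ _ → suc (suc (dbl n)) ℕ.* cost cs) ℕ.+ F (state cs)
      ≡⟨ cong (ℕ._+ F (state cs)) (trans (∑↓-const (state cs) _) (trans (cong (λ k → suc k ℕ.* (suc (suc (dbl n)) ℕ.* cost cs)) e)
           (sym (ℕ.*-assoc (suc (dbl n)) (suc (suc (dbl n))) (cost cs))))) ⟩
    suc (dbl n) ℕ.* suc (suc (dbl n)) ℕ.* cost cs ℕ.+ F (state cs) ∎

stepTotal-closed : ∀ n → 2 ℕ.* stepTotal n ℕ.+ 2 ℕ.* squaresTotal n ≡ total n ℕ.* catalan n
stepTotal-closed n = begin
  2 ℕ.* stepTotal n ℕ.+ 2 ℕ.* squaresTotal n
    ≡⟨ cong₂ ℕ._+_ (S-*ˡ n 0 2 (λ P → preimages 0 P stepCost)) (S-*ˡ n 0 2 (squares 0)) ⟨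
  S n 0 (λ P → 2 ℕ.* preimages 0 P stepCost) ℕ.+ S n 0 (λ P → 2 ℕ.* squares 0 P)
    ≡⟨ S-distrib-+ n 0 (λ P → 2 ℕ.* preimages 0 P stepCost) (λ P → 2 ℕ.* squares 0 P) ⟨
  S n 0 (λ P → 2 ℕ.* preimages 0 P stepCost ℕ.+ 2 ℕ.* squares 0 P)
    ≡⟨ S-cong n 0 (λ P p → trans (preimages-cost p) (sym (ℕ.*-identityʳ (total n)))) ⟩
  S n 0 (λ P → total n ℕ.* 1)
    ≡⟨ S-*ˡ n 0 (total n) (λ _ → 1) ⟩
  total n ℕ.* catalan n ∎

κ-catalan : ∀ n → κ n ℕ.* catalan n ≡ dbl n !
κ-catalan zero    = refl
κ-catalan (suc n) = begin
  κ n ℕ.* (suc n ℕ.* suc (suc n)) ℕ.* catalan (suc n)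
    ≡⟨ ℕ.*-assoc (κ n) _ _ ⟩
  κ n ℕ.* (suc n ℕ.* suc (suc n) ℕ.* catalan (suc n))
    ≡⟨ cong (κ n ℕ.*_) (catalan-rec′ n) ⟩
  κ n ℕ.* (suc (dbl n) ℕ.* suc (suc (dbl n)) ℕ.* catalan n)
    ≡⟨ rotate (κ n) (suc (dbl n)) (suc (suc (dbl n))) (catalan n) ⟩
  suc (suc (dbl n)) ℕ.* (suc (dbl n) ℕ.* (κ n ℕ.* catalan n))
    ≡⟨ cong (λ x → suc (suc (dbl n)) ℕ.* (suc (dbl n) ℕ.* x)) (κ-catalan n) ⟩
  dbl (suc n) ! ∎
  where
  rotate : ∀ a b c d → a ℕ.* (b ℕ.* c ℕ.* d) ≡ c ℕ.* (b ℕ.* (a ℕ.* d))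
  rotate = solve-∀

κ-factorial : ∀ n → κ n ≡ n ! ℕ.* suc n !
κ-factorial zero    = refl
κ-factorial (suc n) = trans (cong (ℕ._* (suc n ℕ.* suc (suc n))) (κ-factorial n)) (rotate (n !) (suc n) (suc (suc n)) (suc n !))
  where
  rotate : ∀ a b c d → a ℕ.* d ℕ.* (b ℕ.* c) ≡ b ℕ.* a ℕ.* (c ℕ.* d)
  rotate = solve-∀

-- Permutations

below : ∀ {n} → ℕ → List (Fin n) → ℕ
below t vs = length (filter (λ v → toℕ v ℕ.<? t) vs)

below-< : ∀ {n t} {v : Fin n} {vs} → toℕ v ℕ.< t → below t (v ∷ vs) ≡ suc (below t vs)
below-< {t = t} v<t = cong length (List.filter-accept (λ v → toℕ v ℕ.<? t) v<t)

below-≥ : ∀ {n t} {v : Fin n} {vs} → t ℕ.≤ toℕ v → below t (v ∷ vs) ≡ below t vs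
below-≥ {t = t} t≤v = cong length (List.filter-reject (λ v → toℕ v ℕ.<? t) (ℕ.≤⇒≯ t≤v))

below-map : ∀ {m n s t} (f : Fin m → Fin n) → (∀ j → toℕ (f j) ℕ.< s ⇔ toℕ j ℕ.< t) →
            ∀ vs → below s (map f vs) ≡ below t vs
below-map             f f<s⇔<t []       = refl
below-map {s = s} {t} f f<s⇔<t (v ∷ vs) with ℕ.<-≤-connex (toℕ v) t
... | inj₁ v<t = trans (below-< (Equivalence.from (f<s⇔<t v) v<t))
                      (trans (cong suc (below-map f f<s⇔<t vs)) (sym (below-< v<t)))
... | inj₂ t≤v = trans (below-≥ (ℕ.≮⇒≥ (ℕ.≤⇒≯ t≤v ∘ Equivalence.to (f<s⇔<t v))))
                      (trans (below-map f f<s⇔<t vs) (sym (below-≥ t≤v)))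

punchIn-<-≥ : ∀ {n} v (j : Fin n) t → t ℕ.≤ toℕ v → toℕ (punchIn v j) ℕ.< t ⇔ toℕ j ℕ.< t
punchIn-<-≥ v       j       zero    t≤v       = mk⇔ (λ ()) (λ ())
punchIn-<-≥ (suc v) zero    (suc t) (s≤s t≤v) = mk⇔ (λ _ → s≤s z≤n) (λ _ → s≤s z≤n)
punchIn-<-≥ (suc v) (suc j) (suc t) (s≤s t≤v) = mk⇔ (s≤s ∘ to ∘ s<s⁻¹) (s≤s ∘ from ∘ s<s⁻¹)
  where open Equivalence (punchIn-<-≥ v j t t≤v)

punchIn-<-≤ : ∀ {n} v (j : Fin n) t → toℕ v ℕ.≤ t → toℕ (punchIn v j) ℕ.< suc t ⇔ toℕ j ℕ.< t
punchIn-<-≤ zero    j       t       v≤t       = mk⇔ s<s⁻¹ s≤s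
punchIn-<-≤ (suc v) zero    (suc t) (s≤s v≤t) = mk⇔ (λ _ → s≤s z≤n) (λ _ → s≤s z≤n)
punchIn-<-≤ (suc v) (suc j) (suc t) (s≤s v≤t) = mk⇔ (s≤s ∘ to ∘ s<s⁻¹) (s≤s ∘ from ∘ s<s⁻¹)
  where open Equivalence (punchIn-<-≤ v j t v≤t)

punchIn-<-punchIn : ∀ {n} v (i j : Fin n) → toℕ (punchIn v j) ℕ.< toℕ (punchIn v i) ⇔ toℕ j ℕ.< toℕ i
punchIn-<-punchIn v i j = mk⇔
  (λ lt → ℕ.≰⇒> (λ i≤j → ℕ.≤⇒≯ (punchIn-mono-≤ v i j i≤j) lt))
  (λ lt → ℕ.≰⇒> (λ i≤j → ℕ.≤⇒≯ (punchIn-cancel-≤ v i j i≤j) lt))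

-- The Lehmer code: entries further right are processed earlier, so the rank is taken among them.
codes : ∀ {n} → List (Fin n) → List ℕ
codes []       = []
codes (v ∷ vs) = below (toℕ v) vs ∷ codes vs

codes-punchIn : ∀ {n} (v : Fin (suc n)) (vs : List (Fin n)) → codes (map (punchIn v) vs) ≡ codes vs
codes-punchIn v []       = refl
codes-punchIn v (w ∷ vs) = cong₂ _∷_ (below-map (punchIn v) (punchIn-<-punchIn v w) vs) (codes-punchIn v vs)

-- Built to match `codes`: `punchIn v` is monotone and hence keeps the code of the tail, while the
-- rank of `v` among all other values is `v` itself.
perms : ∀ n → List (List (Fin n))
perms zero    = [] ∷ []
perms (suc n) = cartesianProductWith (λ v w → v ∷ map (punchIn v) w) (allFin (suc n)) (perms n)

below-perm : ∀ n {w} → w ∈ perms n → ∀ t → t ℕ.≤ n → below t w ≡ t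
below-perm zero    (here refl) zero z≤n = refl
below-perm (suc n) w∈         t t≤
  with v , w′ , _ , w′∈ , refl ← ∈-cartesianProductWith⁻ (λ v w → v ∷ map (punchIn v) w) (allFin (suc n)) (perms n) w∈
  with t | ℕ.<-≤-connex (toℕ v) t
... | suc t | inj₁ (s≤s v≤t) = trans (below-< (s≤s v≤t)) (cong suc
        (trans (below-map (punchIn v) (λ j → punchIn-<-≤ v j t v≤t) w′) (below-perm n w′∈ t (ℕ.s≤s⁻¹ t≤))))
... | t     | inj₂ t≤v = trans (below-≥ t≤v)
        (trans (below-map (punchIn v) (λ j → punchIn-<-≥ v j t t≤v) w′)
               (below-perm n w′∈ t (ℕ.≤-trans t≤v (ℕ.s≤s⁻¹ (toℕ<n v)))))

perms-complete : ∀ n w → Unique w → length w ≡ n → w ∈ perms n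
perms-complete zero    []      _         _  = here refl
perms-complete (suc n) (v ∷ w) (v∉w ∷ w!) eq =
  subst (λ u → v ∷ u ∈ perms (suc n)) map-w′≡w
    (∈-cartesianProductWith⁺ (λ v w → v ∷ map (punchIn v) w) (∈-allFin v)
      (perms-complete n w′ (Unique.map⁻ (subst Unique (sym map-w′≡w) w!))
        (trans (sym (List.length-map (punchIn v) w′)) (trans (cong length map-w′≡w) (ℕ.suc-injective eq)))))
  where
  preimage : ∀ {w} → All (v ≢_) w → ∃ λ w′ → map (punchIn v) w′ ≡ w
  preimage []          = [] , refl
  preimage (v≢x ∷ v∉w) = let w′ , eq = preimage v∉w in
    punchOut v≢x ∷ w′ , cong₂ _∷_ (punchIn-punchOut v≢x) eq
  w′ = proj₁ (preimage v∉w)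
  map-w′≡w = proj₂ (preimage v∉w)

perms-sound : ∀ n {w} → w ∈ perms n → Unique w × length w ≡ n × (∀ v → v ∈ w)
perms-sound zero    (here refl) = [] , refl , λ ()
perms-sound (suc n) w∈
  with v , w , _ , w∈ , refl ← ∈-cartesianProductWith⁻ (λ v w → v ∷ map (punchIn v) w) (allFin (suc n)) (perms n) w∈
  with w! , length-w , ∈w ← perms-sound n w∈ =
  All.map⁺ (All.universal (λ j eq → punchInᵢ≢i v j (sym eq)) w) ∷ Unique.map⁺ (λ {i} {j} → punchIn-injective v i j) w!
  , cong suc (trans (List.length-map (punchIn v) w) length-w)
  , member
  where
  member : ∀ x → x ∈ v ∷ map (punchIn v) w
  member x with v ≟ x
  ... | yes refl = here refl
  ... | no  v≢x  = there (subst (_∈ map (punchIn v) w) (punchIn-punchOut v≢x) (∈-map⁺ (punchIn v) (∈w (punchOut v≢x))))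

perms-unique : ∀ n → Unique (perms n)
perms-unique zero    = [] ∷ []
perms-unique (suc n) = Unique.cartesianProductWith⁺ (λ v w → v ∷ map (punchIn v) w) injective (Unique.allFin⁺ (suc n)) (perms-unique n)
  where
  injective : ∀ {v x : Fin (suc n)} {w y} → v ∷ map (punchIn v) w ≡ x ∷ map (punchIn x) y → v ≡ x × w ≡ y
  injective {v} eq with refl , eq′ ← List.∷-injective eq =
    refl , List.map-injective (λ {i} {j} → punchIn-injective v i j) eq′

sum-map-cong : ∀ {A : Set} {f g : A → ℕ} (xs : List A) → (∀ {x} → x ∈ xs → f x ≡ g x) → sum (map f xs) ≡ sum (map g xs)
sum-map-cong []       f≡g = refl
sum-map-cong (x ∷ xs) f≡g = cong₂ ℕ._+_ (f≡g (here refl)) (sum-map-cong xs (f≡g ∘ there))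

sum-cartesianProductWith : ∀ {A B C : Set} (f : C → ℕ) (h : A → B → C) xs ys →
  sum (map f (cartesianProductWith h xs ys)) ≡ sum (map (λ y → sum (map (λ x → f (h x y)) xs)) ys)
sum-cartesianProductWith f h []       ys = sym (zeros ys)
  where
  zeros : ∀ ys → sum (map (λ _ → 0) ys) ≡ 0
  zeros []       = refl
  zeros (_ ∷ ys) = zeros ys
sum-cartesianProductWith f h (x ∷ xs) ys = begin
  sum (map f (map (h x) ys ++ cartesianProductWith h xs ys))
    ≡⟨ trans (cong sum (List.map-++ f (map (h x) ys) _)) (sum-++ (map f (map (h x) ys)) _) ⟩
  sum (map f (map (h x) ys)) ℕ.+ sum (map f (cartesianProductWith h xs ys))
    ≡⟨ cong₂ ℕ._+_ (cong sum (sym (List.map-∘ ys))) (sum-cartesianProductWith f h xs ys) ⟩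
  sum (map (f ∘ h x) ys) ℕ.+ sum (map (λ y → sum (map (λ x → f (h x y)) xs)) ys)
    ≡⟨ merge ys ⟩
  sum (map (λ y → f (h x y) ℕ.+ sum (map (λ x → f (h x y)) xs)) ys) ∎
  where
  merge : ∀ ys → sum (map (f ∘ h x) ys) ℕ.+ sum (map (λ y → sum (map (λ x → f (h x y)) xs)) ys) ≡
                 sum (map (λ y → f (h x y) ℕ.+ sum (map (λ x → f (h x y)) xs)) ys)
  merge []       = refl
  merge (y ∷ ys) = trans (+-interchange (f (h x y)) _ _ _) (cong (f (h x y) ℕ.+ sum (map (λ x → f (h x y)) xs) ℕ.+_) (merge ys))

sum-allFin : ∀ n (k : ℕ → ℕ) → sum (map (k ∘ toℕ) (allFin n)) ≡ ∑ n k
sum-allFin n k = trans (cong sum (List.map-tabulate {n = n} id (k ∘ toℕ))) (go n k)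
  where
  go : ∀ n (k : ℕ → ℕ) → sum (tabulate {n = n} (k ∘ toℕ)) ≡ ∑ n k
  go zero    k = refl
  go (suc n) k = cong (k 0 ℕ.+_) (go n (k ∘ suc))

sum-perms-codes : ∀ n (g : List ℕ → ℕ) → sum (map (g ∘ codes) (perms n)) ≡ ∑codes n g
sum-perms-codes zero    g = ℕ.+-identityʳ (g [])
sum-perms-codes (suc n) g = begin
  sum (map (g ∘ codes) (perms (suc n)))
    ≡⟨ sum-cartesianProductWith (g ∘ codes) (λ v w → v ∷ map (punchIn v) w) (allFin (suc n)) (perms n) ⟩
  sum (map (λ w → sum (map (λ v → g (codes (v ∷ map (punchIn v) w))) (allFin (suc n)))) (perms n))
    ≡⟨ sum-map-cong (perms n) (λ {w} w∈ → trans
         (sum-map-cong (allFin (suc n)) (λ {v} _ → cong g (cong₂ _∷_ (rank w∈ v) (codes-punchIn v w))))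
         (sum-allFin (suc n) (λ r → g (r ∷ codes w)))) ⟩
  sum (map ((λ cs → ∑ (suc n) (λ r → g (r ∷ cs))) ∘ codes) (perms n))
    ≡⟨ sum-perms-codes n (λ cs → ∑ (suc n) (λ r → g (r ∷ cs))) ⟩
  ∑codes (suc n) g ∎
  where
  rank : ∀ {w} → w ∈ perms n → ∀ v → below (toℕ v) (map (punchIn v) w) ≡ toℕ v
  rank {w} w∈ v = trans (below-map (punchIn v) (λ j → punchIn-<-≥ v j (toℕ v) ℕ.≤-refl) w)
                        (below-perm n w∈ (toℕ v) (ℕ.s≤s⁻¹ (toℕ<n v)))

-- Enumeration of functions

Π-setoid : ∀ {n} → (Fin n → Setoid 0ℓ 0ℓ) → Setoid 0ℓ 0ℓ
Π-setoid S = record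
  { Carrier       = ∀ i → Setoid.Carrier (S i)
  ; _≈_           = λ f g → ∀ i → Setoid._≈_ (S i) (f i) (g i)
  ; isEquivalence = record
    { refl  = λ i → Setoid.refl (S i)
    ; sym   = λ f≈g i → Setoid.sym (S i) (f≈g i)
    ; trans = λ f≈g g≈h i → Setoid.trans (S i) (f≈g i) (g≈h i)
    }
  }

-- Listed functions can only be matched pointwise, not as propositionally equal functions; hence
-- membership in a setoid, here and in `choices-unique`.
choices-complete : ∀ {n} (S : Fin n → Setoid 0ℓ 0ℓ) (xs : ∀ i → List (Setoid.Carrier (S i))) f →
  (∀ i → SetoidMembership._∈_ (S i) (f i) (xs i)) → SetoidMembership._∈_ (Π-setoid S) f (choices xs)
choices-complete {zero}  S xs f f∈ = here λ ()
choices-complete {suc n} S xs f f∈ = SetoidMembership.∈-resp-≈ (Π-setoid S)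
  {x = ∀-cons (f zero) (f ∘ suc)} (∀-cons (Setoid.refl (S zero)) (λ i → Setoid.refl (S (suc i))))
  (SetoidMembership.∈-cartesianProductWith⁺ (S zero) (Π-setoid (S ∘ suc)) (Π-setoid S)
    (λ x≈y f≈g → ∀-cons x≈y f≈g) (f∈ zero) (choices-complete (S ∘ suc) (xs ∘ suc) (f ∘ suc) (f∈ ∘ suc)))

choices-unique : ∀ {n} (S : Fin n → Setoid 0ℓ 0ℓ) (xs : ∀ i → List (Setoid.Carrier (S i))) →
  (∀ i → SetoidUnique.Unique (S i) (xs i)) → SetoidUnique.Unique (Π-setoid S) (choices xs)
choices-unique {zero}  S xs xs! = [] ∷ []
choices-unique {suc n} S xs xs! = SetoidUnique.cartesianProductWith⁺ (S zero) (Π-setoid (S ∘ suc)) (Π-setoid S)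
  ∀-cons (λ f≈g → f≈g zero , f≈g ∘ suc) (xs! zero) (choices-unique (S ∘ suc) (xs ∘ suc) (xs! ∘ suc))

below-none : ∀ {n} {x : Fin n} {vs : List (Fin n)} → All (x Fin.<_) vs → below (toℕ x) vs ≡ 0
below-none []        = refl
below-none (p ∷ x<) = trans (below-≥ (ℕ.<⇒≤ p)) (below-none x<)

below-↭ : ∀ {n} t {vs ws : List (Fin n)} → vs ↭ ws → below t vs ≡ below t ws
below-↭ t vs↭ws = ↭-length (filter-↭ (λ v → toℕ v ℕ.<? t) vs↭ws)

-- The processed part of a tableau: its entries in increasing order, each with
-- its row (↑ for the upper and ↓ for the lower one).
Entries : ℕ → Set
Entries n = List (Fin n × Step)

module _ {n : ℕ} where

  values : Entries n → List (Fin n)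
  values = map proj₁

  word : Entries n → Word
  word = map proj₂

  row : Step → Entries n → List (Fin n)
  row s []            = []
  row ↑ ((v , ↑) ∷ L) = v ∷ row ↑ L
  row ↑ ((v , ↓) ∷ L) = row ↑ L
  row ↓ ((v , ↑) ∷ L) = row ↓ L
  row ↓ ((v , ↓) ∷ L) = v ∷ row ↓ L

  row-All : ∀ {P : Fin n → Set} s L → All P (values L) → All P (row s L)
  row-All s []            []       = []
  row-All ↑ ((v , ↑) ∷ L) (p ∷ ps) = p ∷ row-All ↑ L ps
  row-All ↑ ((v , ↓) ∷ L) (p ∷ ps) = row-All ↑ L ps
  row-All ↓ ((v , ↑) ∷ L) (p ∷ ps) = row-All ↓ L ps
  row-All ↓ ((v , ↓) ∷ L) (p ∷ ps) = p ∷ row-All ↓ L ps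

  -- With `place↑`, the counterpart of `insert↓` and `insert↑` on actual entries: comparison of
  -- values takes the place of counting down a rank.
  place↓ : Fin n → Entries n → Entries n
  place↓ x []            = (x , ↓) ∷ []
  place↓ x ((v , s) ∷ L) with ℕ.<-≤-connex (toℕ v) (toℕ x)
  ... | inj₁ _ = (v , s) ∷ place↓ x L
  ... | inj₂ _ = (x , ↓) ∷ (v , s) ∷ L

  place↑ : ℕ → Fin n → Entries n → Entries n
  place↑ h y []            = (y , ↑) ∷ []
  place↑ h y ((v , s) ∷ L) with ℕ.<-≤-connex (toℕ v) (toℕ y)
  ... | inj₂ _ = (y , ↑) ∷ (v , s) ∷ L
  place↑ h       y ((v , ↑) ∷ L) | inj₁ _ = (v , ↑) ∷ place↑ (suc h) y L
  place↑ zero    y ((v , ↓) ∷ L) | inj₁ _ = (v , ↑) ∷ place↓ y L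
  place↑ (suc h) y ((v , ↓) ∷ L) | inj₁ _ = (v , ↓) ∷ place↑ h y L

  place↓-↭ : ∀ x L → values (place↓ x L) ↭ x ∷ values L
  place↓-↭ x []            = ↭-refl
  place↓-↭ x ((v , s) ∷ L) with ℕ.<-≤-connex (toℕ v) (toℕ x)
  ... | inj₁ _ = ↭-trans (↭-prep v (place↓-↭ x L)) (↭-swap v x ↭-refl)
  ... | inj₂ _ = ↭-refl

  place↑-↭ : ∀ h y L → values (place↑ h y L) ↭ y ∷ values L
  place↑-↭ h y []            = ↭-refl
  place↑-↭ h y ((v , s) ∷ L) with ℕ.<-≤-connex (toℕ v) (toℕ y)
  ... | inj₂ _ = ↭-refl
  place↑-↭ h       y ((v , ↑) ∷ L) | inj₁ _ = ↭-trans (↭-prep v (place↑-↭ (suc h) y L)) (↭-swap v y ↭-refl)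
  place↑-↭ zero    y ((v , ↓) ∷ L) | inj₁ _ = ↭-trans (↭-prep v (place↓-↭ y L)) (↭-swap v y ↭-refl)
  place↑-↭ (suc h) y ((v , ↓) ∷ L) | inj₁ _ = ↭-trans (↭-prep v (place↑-↭ h y L)) (↭-swap v y ↭-refl)

  Sorted : Entries n → Set
  Sorted L = AllPairs Fin._<_ (values L)

  strict : ∀ {x v : Fin n} → toℕ x ℕ.≤ toℕ v → x ≢ v → x Fin.< v
  strict x≤v x≢v = ℕ.≤∧≢⇒< x≤v (x≢v ∘ Fin.toℕ-injective)

  below-all : ∀ {x v : Fin n} {vs} → x Fin.< v → All (v Fin.<_) vs → All (x Fin.<_) (v ∷ vs)
  below-all x<v v< = x<v ∷ All.map (ℕ.<-trans x<v) v<

  place↓-sorted : ∀ x L → Sorted L → All (x ≢_) (values L) → Sorted (place↓ x L)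
  place↓-sorted x []            []         []        = [] ∷ []
  place↓-sorted x ((v , s) ∷ L) (v<L ∷ L<) (x≢v ∷ x∉L) with ℕ.<-≤-connex (toℕ v) (toℕ x)
  ... | inj₁ v<x = All-resp-↭ (↭-sym (place↓-↭ x L)) (v<x ∷ v<L) ∷ place↓-sorted x L L< x∉L
  ... | inj₂ x≤v = below-all (strict x≤v x≢v) v<L ∷ v<L ∷ L<

  place↑-sorted : ∀ h y L → Sorted L → All (y ≢_) (values L) → Sorted (place↑ h y L)
  place↑-sorted h y []            []         []        = [] ∷ []
  place↑-sorted h y ((v , s) ∷ L) (v<L ∷ L<) (y≢v ∷ y∉L) with ℕ.<-≤-connex (toℕ v) (toℕ y)
  ... | inj₂ y≤v = below-all (strict y≤v y≢v) v<L ∷ v<L ∷ L<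
  place↑-sorted h y ((v , ↑) ∷ L) (v<L ∷ L<) (y≢v ∷ y∉L) | inj₁ v<y =
    All-resp-↭ (↭-sym (place↑-↭ (suc h) y L)) (v<y ∷ v<L) ∷ place↑-sorted (suc h) y L L< y∉L
  place↑-sorted zero y ((v , ↓) ∷ L) (v<L ∷ L<) (y≢v ∷ y∉L) | inj₁ v<y =
    All-resp-↭ (↭-sym (place↓-↭ y L)) (v<y ∷ v<L) ∷ place↓-sorted y L L< y∉L
  place↑-sorted (suc h) y ((v , ↓) ∷ L) (v<L ∷ L<) (y≢v ∷ y∉L) | inj₁ v<y =
    All-resp-↭ (↭-sym (place↑-↭ h y L)) (v<y ∷ v<L) ∷ place↑-sorted h y L L< y∉L

  -- In a sorted list the entries smaller than `x` form an initial segment, so their number is the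
  -- position where `x` is placed.
  word-place↓ : ∀ x L → Sorted L → All (x ≢_) (values L) →
                word (place↓ x L) ≡ insert↓ (below (toℕ x) (values L)) (word L)
  word-place↓ x []            []         []        = refl
  word-place↓ x ((v , s) ∷ L) (v<L ∷ L<) (x≢v ∷ x∉L) with ℕ.<-≤-connex (toℕ v) (toℕ x)
  ... | inj₁ v<x = trans (cong (s ∷_) (word-place↓ x L L< x∉L))
                         (cong (λ r → insert↓ r (s ∷ word L)) (sym (below-< v<x)))
  ... | inj₂ x≤v = cong (λ r → insert↓ r (s ∷ word L)) (sym (below-none (below-all (strict x≤v x≢v) v<L)))

  word-place↑ : ∀ h y L → Sorted L → All (y ≢_) (values L) →
                word (place↑ h y L) ≡ insert↑ h (below (toℕ y) (values L)) (word L)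
  word-place↑ h y []            []         []        = refl
  word-place↑ h y ((v , s) ∷ L) (v<L ∷ L<) (y≢v ∷ y∉L) with ℕ.<-≤-connex (toℕ v) (toℕ y)
  ... | inj₂ y≤v = cong (λ r → insert↑ h r (s ∷ word L)) (sym (below-none (below-all (strict y≤v y≢v) v<L)))
  word-place↑ h y ((v , ↑) ∷ L) (v<L ∷ L<) (y≢v ∷ y∉L) | inj₁ v<y =
    trans (cong (↑ ∷_) (word-place↑ (suc h) y L L< y∉L)) (cong (λ r → insert↑ h r (↑ ∷ word L)) (sym (below-< v<y)))
  word-place↑ zero y ((v , ↓) ∷ L) (v<L ∷ L<) (y≢v ∷ y∉L) | inj₁ v<y =
    trans (cong (↑ ∷_) (word-place↓ y L L< y∉L)) (cong (λ r → insert↑ 0 r (↓ ∷ word L)) (sym (below-< v<y)))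
  word-place↑ (suc h) y ((v , ↓) ∷ L) (v<L ∷ L<) (y≢v ∷ y∉L) | inj₁ v<y =
    trans (cong (↓ ∷_) (word-place↑ h y L L< y∉L)) (cong (λ r → insert↑ (suc h) r (↓ ∷ word L)) (sym (below-< v<y)))

  row-↑-place↓ : ∀ x L → row ↑ (place↓ x L) ≡ row ↑ L
  row-↑-place↓ x []            = refl
  row-↑-place↓ x ((v , s) ∷ L) with ℕ.<-≤-connex (toℕ v) (toℕ x)
  ... | inj₂ _ = refl
  row-↑-place↓ x ((v , ↑) ∷ L) | inj₁ _ = cong (v ∷_) (row-↑-place↓ x L)
  row-↑-place↓ x ((v , ↓) ∷ L) | inj₁ _ = row-↑-place↓ x L

  -- place↑ H leaves the first H entries of the lower row in place.
  drop-row-place↑ : ∀ y L {h H b bs} → h ℕ.< H → drop h (row ↓ L) ≡ b ∷ bs →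
                    ∃ λ bs′ → drop h (row ↓ (place↑ H y L)) ≡ b ∷ bs′
  drop-row-place↑ y []            {zero}  h<H ()
  drop-row-place↑ y []            {suc h} h<H ()
  drop-row-place↑ y ((v , s) ∷ L) h<H eq with ℕ.<-≤-connex (toℕ v) (toℕ y)
  ... | inj₂ _ = _ , eq
  drop-row-place↑ y ((v , ↑) ∷ L)         h<H       eq   | inj₁ _ = drop-row-place↑ y L (ℕ.m≤n⇒m≤1+n h<H) eq
  drop-row-place↑ y ((v , ↓) ∷ L) {zero}  (s≤s h<H) refl | inj₁ _ = _ , refl
  drop-row-place↑ y ((v , ↓) ∷ L) {suc h} (s≤s h<H) eq   | inj₁ _ = drop-row-place↑ y L h<H eq

  entries : List (Fin n) → Entries n
  entries []           = []
  entries (_ ∷ [])     = []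
  entries (y ∷ x ∷ vs) = place↑ 0 y (place↓ x (entries vs))

drop-suc : ∀ {A : Set} h {xs : List A} {y ys} → drop h xs ≡ y ∷ ys → drop (suc h) xs ≡ ys
drop-suc zero    {_ ∷ _}  refl = refl
drop-suc (suc h) {_ ∷ xs} eq   = drop-suc h eq

-- The algorithm on two rows

module _ (μ : Partition) where
  open Inverse using (to; from)

  private
    n = size μ

  round-stop : ∀ b k T → All (λ d → k Fin.< to T d) (neighbours μ (from T k)) → round μ b k T ≡ (0 , T)
  round-stop zero    k T k< = refl
  round-stop (suc b) k T k< with neighbours μ (from T k)
  ... | []     = refl
  ... | d ∷ ds with k Fin.<? min (Fin.≤-totalOrder n) (to T d) (map (to T) ds)
  ...   | yes _  = refl
  ...   | no k≮m with p ∷ ps ← k< =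
    contradiction (argmin-all (Fin.≤-totalOrder n) id {P = k Fin.<_} p (All.map⁺ {f = to T} ps)) k≮m

  min-value : ∀ (T : Tableau μ) {d ds} e → e ∈ d ∷ ds → All (λ x → to T e Fin.≤ to T x) (d ∷ ds) →
              min (Fin.≤-totalOrder n) (to T d) (map (to T) ds) ≡ to T e
  min-value T {d} {ds} e e∈ (e≤d ∷ e≤ds) = Fin.≤-antisym
    (f[argmin]≤v⁺ (Fin.≤-totalOrder n) {f = id} (to T d) (map (to T) ds) (split e∈))
    (v≤f[argmin]⁺ (Fin.≤-totalOrder n) {f = id} e≤d (All.map⁺ e≤ds))
    where
    split : e ∈ d ∷ ds → (to T d Fin.≤ to T e) ⊎ Any (Fin._≤ to T e) (map (to T) ds)
    split (here refl) = inj₁ ℕ.≤-refl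
    split (there e∈)  = inj₂ (Any.map⁺ (lose e∈ ℕ.≤-refl))

  -- The smallest neighbour is supplied as `e`, so that the simulation only compares entries and
  -- never evaluates `min`.
  round-exchange : ∀ b k T {d ds} e → neighbours μ (from T k) ≡ d ∷ ds → e ∈ d ∷ ds →
    All (λ x → to T e Fin.≤ to T x) (d ∷ ds) → to T e Fin.< k →
    round μ (suc b) k T ≡ map₁ suc (round μ b k (exchange μ (to T e) k T))
  round-exchange b k T e eq e∈ e≤ e<k with neighbours μ (from T k)
  round-exchange b k T {d} {ds} e refl e∈ e≤ e<k | d ∷ ds
    with k Fin.<? min (Fin.≤-totalOrder n) (to T d) (map (to T) ds)
  ... | yes k<m = contradiction (subst (k Fin.<_) (min-value T e e∈ e≤) k<m) (ℕ.<-asym e<k)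
  ... | no _    = cong (λ m → map₁ suc (round μ b k (exchange μ m k T))) (min-value T e e∈ e≤)

  exchange-first : ∀ m k T {x} → to T x ≡ m → to (exchange μ m k T) x ≡ k
  exchange-first m k T refl with m Fin.≟ m
  ... | yes _  = refl
  ... | no m≢m = contradiction refl m≢m

  exchange-second : ∀ m k T {x} → to T x ≡ k → to (exchange μ m k T) x ≡ m
  exchange-second m k T refl with k Fin.≟ m
  ... | yes k≡m = k≡m
  ... | no _    with k Fin.≟ k
  ...   | yes _  = refl
  ...   | no k≢k = contradiction refl k≢k

  exchange-other : ∀ m k T {x} → to T x ≢ m → to T x ≢ k → to (exchange μ m k T) x ≡ to T x
  exchange-other m k T {x} x≢m x≢k with to T x Fin.≟ m
  ... | yes x≡m = contradiction x≡m x≢m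
  ... | no _    with to T x Fin.≟ k
  ...   | yes x≡k = contradiction x≡k x≢k
  ...   | no _    = refl

-- Column readings of two-row fillings

columns : ∀ {A : Set} {k} → (Fin k → A) → (Fin k → A) → List A
columns {k = zero}  f g = []
columns {k = suc k} f g = f zero ∷ g zero ∷ columns (f ∘ suc) (g ∘ suc)

length-columns : ∀ {A : Set} {k} (f g : Fin k → A) → length (columns f g) ≡ dbl k
length-columns {k = zero}  f g = refl
length-columns {k = suc k} f g = cong (λ n → ℕ.suc (ℕ.suc n)) (length-columns (f ∘ suc) (g ∘ suc))

columns-injective : ∀ {A : Set} {k} {f g f′ g′ : Fin k → A} → columns f g ≡ columns f′ g′ →
                    (∀ j → f j ≡ f′ j) × (∀ j → g j ≡ g′ j)
columns-injective {k = zero}  eq = (λ ()) , (λ ())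
columns-injective {k = suc k} eq
  with f0 , eq₁ ← List.∷-injective eq
  with g0 , eq₂ ← List.∷-injective eq₁
  with f≡ , g≡ ← columns-injective eq₂ =
  (λ { zero → f0 ; (suc j) → f≡ j }) , (λ { zero → g0 ; (suc j) → g≡ j })

columns-surjective : ∀ {A : Set} k (w : List A) → length w ≡ dbl k → ∃₂ λ (f g : Fin k → A) → columns f g ≡ w
columns-surjective zero    []          _  = (λ ()) , (λ ()) , refl
columns-surjective (suc k) (y ∷ x ∷ w) eq
  with f , g , eq′ ← columns-surjective k w (ℕ.suc-injective (ℕ.suc-injective eq)) =
  (λ { zero → y ; (suc j) → f j }) , (λ { zero → x ; (suc j) → g j }) , cong (λ w → y ∷ x ∷ w) eq′

columns-cong : ∀ {A : Set} {k} {f g f′ g′ : Fin k → A} → (∀ j → f j ≡ f′ j) → (∀ j → g j ≡ g′ j) →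
               columns f g ≡ columns f′ g′
columns-cong {k = zero}  f≡ g≡ = refl
columns-cong {k = suc k} f≡ g≡ = cong₂ (λ a b → a ∷ b) (f≡ zero) (cong₂ _∷_ (g≡ zero) (columns-cong (f≡ ∘ suc) (g≡ ∘ suc)))

∈-columns⁻ : ∀ {A : Set} {k} (f g : Fin k → A) {v} → v ∈ columns f g → (∃ λ j → f j ≡ v) ⊎ (∃ λ j → g j ≡ v)
∈-columns⁻ {k = suc k} f g (here refl)         = inj₁ (zero , refl)
∈-columns⁻ {k = suc k} f g (there (here refl)) = inj₂ (zero , refl)
∈-columns⁻ {k = suc k} f g (there (there v∈))  with ∈-columns⁻ (f ∘ suc) (g ∘ suc) v∈
... | inj₁ (j , eq) = inj₁ (suc j , eq)
... | inj₂ (j , eq) = inj₂ (suc j , eq)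

∈-columns-↑ : ∀ {A : Set} {k} (f g : Fin k → A) j → f j ∈ columns f g
∈-columns-↑ f g zero    = here refl
∈-columns-↑ f g (suc j) = there (there (∈-columns-↑ (f ∘ suc) (g ∘ suc) j))

∈-columns-↓ : ∀ {A : Set} {k} (f g : Fin k → A) j → g j ∈ columns f g
∈-columns-↓ f g zero    = there (here refl)
∈-columns-↓ f g (suc j) = there (there (∈-columns-↓ (f ∘ suc) (g ∘ suc) j))

record Injective₂ {A : Set} {k} (f g : Fin k → A) : Set where
  field
    f-injective : ∀ {i j} → f i ≡ f j → i ≡ j
    g-injective : ∀ {i j} → g i ≡ g j → i ≡ j
    f≢g         : ∀ {i j} → f i ≢ g j
open Injective₂

unique-columns⁺ : ∀ {A : Set} {k} {f g : Fin k → A} → Injective₂ f g → Unique (columns f g)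
unique-columns⁺ {k = zero}  inj = []
unique-columns⁺ {k = suc k} {f} {g} inj =
  (f≢g inj ∷ All.tabulate (λ v∈ f0≡v → away-f (∈-columns⁻ (f ∘ suc) (g ∘ suc) v∈) f0≡v))
  ∷ All.tabulate (λ v∈ g0≡v → away-g (∈-columns⁻ (f ∘ suc) (g ∘ suc) v∈) g0≡v)
  ∷ unique-columns⁺ (record
      { f-injective = λ eq → Fin.suc-injective (f-injective inj eq)
      ; g-injective = λ eq → Fin.suc-injective (g-injective inj eq)
      ; f≢g         = f≢g inj
      })
  where
  away-f : ∀ {v} → (∃ λ j → f (suc j) ≡ v) ⊎ (∃ λ j → g (suc j) ≡ v) → f zero ≢ v
  away-f (inj₁ (j , refl)) eq with () ← f-injective inj eq
  away-f (inj₂ (j , refl)) eq = f≢g inj eq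
  away-g : ∀ {v} → (∃ λ j → f (suc j) ≡ v) ⊎ (∃ λ j → g (suc j) ≡ v) → g zero ≢ v
  away-g (inj₁ (j , refl)) eq = f≢g inj (sym eq)
  away-g (inj₂ (j , refl)) eq with () ← g-injective inj eq

unique-columns⁻ : ∀ {A : Set} {k} {f g : Fin k → A} → Unique (columns f g) → Injective₂ f g
unique-columns⁻ {k = zero} _ = record { f-injective = λ { {()} } ; g-injective = λ { {()} } ; f≢g = λ { {()} } }
unique-columns⁻ {k = suc k} {f} {g} ((f0≢g0 ∷ f0∉) ∷ g0∉ ∷ u) = record
  { f-injective = λ { {zero} {zero} _ → refl
                    ; {zero} {suc j} eq → ⊥-elim (All.lookup f0∉ (∈-columns-↑ (f ∘ suc) (g ∘ suc) j) eq)
                    ; {suc i} {zero} eq → ⊥-elim (All.lookup f0∉ (∈-columns-↑ (f ∘ suc) (g ∘ suc) i) (sym eq))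
                    ; {suc i} {suc j} eq → cong suc (f-injective rec eq) }
  ; g-injective = λ { {zero} {zero} _ → refl
                    ; {zero} {suc j} eq → ⊥-elim (All.lookup g0∉ (∈-columns-↓ (f ∘ suc) (g ∘ suc) j) eq)
                    ; {suc i} {zero} eq → ⊥-elim (All.lookup g0∉ (∈-columns-↓ (f ∘ suc) (g ∘ suc) i) (sym eq))
                    ; {suc i} {suc j} eq → cong suc (g-injective rec eq) }
  ; f≢g         = λ { {zero} {zero} eq → f0≢g0 eq
                    ; {zero} {suc j} eq → All.lookup f0∉ (∈-columns-↓ (f ∘ suc) (g ∘ suc) j) eq
                    ; {suc i} {zero} eq → All.lookup g0∉ (∈-columns-↑ (f ∘ suc) (g ∘ suc) i) (sym eq)
                    ; {suc i} {suc j} eq → f≢g rec eq }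
  }
  where rec = unique-columns⁻ u

rounds-∷ : ∀ μ k ks T → rounds μ (k ∷ ks) T ≡
           proj₁ (round μ (size μ) k T) ℕ.+ rounds μ ks (proj₂ (round μ (size μ) k T))
rounds-∷ μ k ks T with round μ (size μ) k T
... | e , T′ = refl

-- Simulation of the rounds by insertions into words

module TwoRow (m : ℕ) .{{_ : NonZero m}} where
  open Inverse using (to; from; strictlyInverseʳ)

  μ : Partition
  μ = twoRow m m ℕ.≤-refl

  cell : Step → ∀ c → .(c ℕ.< m) → Cell μ
  cell ↑ c c<m = zero , fromℕ< c<m
  cell ↓ c c<m = suc zero , fromℕ< c<m

  cellAt-↑ : ∀ c (c<m : c ℕ.< m) → cellAt μ 0 c ≡ just (cell ↑ c c<m)
  cellAt-↑ c c<m with c ℕ.<? m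
  ... | yes _   = refl
  ... | no  c≮m = contradiction c<m c≮m

  cellAt-↓ : ∀ c (c<m : c ℕ.< m) → cellAt μ 1 c ≡ just (cell ↓ c c<m)
  cellAt-↓ c c<m with c ℕ.<? m
  ... | yes _   = refl
  ... | no  c≮m = contradiction c<m c≮m

  cellAt-≮ : ∀ s c → ¬ c ℕ.< m → cellAt μ s c ≡ nothing
  cellAt-≮ zero c c≮m with c ℕ.<? m
  ... | yes c<m = contradiction c<m c≮m
  ... | no _    = refl
  cellAt-≮ (suc zero) c c≮m with c ℕ.<? m
  ... | yes c<m = contradiction c<m c≮m
  ... | no _    = refl
  cellAt-≮ (suc (suc s)) c c≮m = refl

  neighbours-↓ : ∀ c (c<m : c ℕ.< m) (sc<m : suc c ℕ.< m) → neighbours μ (cell ↓ c c<m) ≡ cell ↓ (suc c) sc<m ∷ []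
  neighbours-↓ c c<m sc<m rewrite Fin.toℕ-fromℕ< c<m | cellAt-↓ (suc c) sc<m = refl

  neighbours-↓-last : ∀ c (c<m : c ℕ.< m) → ¬ suc c ℕ.< m → neighbours μ (cell ↓ c c<m) ≡ []
  neighbours-↓-last c c<m sc≮m rewrite Fin.toℕ-fromℕ< c<m | cellAt-≮ 1 (suc c) sc≮m = refl

  neighbours-↑ : ∀ c (c<m : c ℕ.< m) (sc<m : suc c ℕ.< m) →
    neighbours μ (cell ↑ c c<m) ≡ cell ↓ c c<m ∷ cell ↑ (suc c) sc<m ∷ []
  neighbours-↑ c c<m sc<m rewrite Fin.toℕ-fromℕ< c<m | cellAt-↓ c c<m | cellAt-↑ (suc c) sc<m = refl

  neighbours-↑-last : ∀ c (c<m : c ℕ.< m) → ¬ suc c ℕ.< m → neighbours μ (cell ↑ c c<m) ≡ cell ↓ c c<m ∷ []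
  neighbours-↑-last c c<m sc≮m rewrite Fin.toℕ-fromℕ< c<m | cellAt-↓ c c<m | cellAt-≮ 0 (suc c) sc≮m = refl

  N : ℕ
  N = size μ

  from-cell : ∀ (T : Tableau μ) {x k} → to T x ≡ k → from T k ≡ x
  from-cell T refl = strictlyInverseʳ T _

  to-injective : ∀ (T : Tableau μ) {x y} → to T x ≡ to T y → x ≡ y
  to-injective T {x} {y} eq = trans (sym (strictlyInverseʳ T x)) (trans (cong (from T) eq) (strictlyInverseʳ T y))

  cell-injective : ∀ s s′ c c′ .(p : c ℕ.< m) .(p′ : c′ ℕ.< m) → cell s c p ≡ cell s′ c′ p′ → s ≡ s′ × c ≡ c′
  cell-injective ↑ ↑ c c′ p p′ eq = refl , Fin.fromℕ<-injective c c′ p p′ (zero-injective eq)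
    where
    zero-injective : ∀ {i j : Fin m} → _≡_ {A = Cell μ} (zero , i) (zero , j) → i ≡ j
    zero-injective refl = refl
  cell-injective ↓ ↓ c c′ p p′ eq = refl , Fin.fromℕ<-injective c c′ p p′ (suc-injective eq)
    where
    suc-injective : ∀ {i j : Fin m} → _≡_ {A = Cell μ} (suc zero , i) (suc zero , j) → i ≡ j
    suc-injective refl = refl
  cell-injective ↑ ↓ c c′ p p′ ()
  cell-injective ↓ ↑ c c′ p p′ ()

  cell-≢ : ∀ s s′ {c c′} .(p : c ℕ.< m) .(p′ : c′ ℕ.< m) → c ≢ c′ → cell s c p ≢ cell s′ c′ p′
  cell-≢ s s′ p p′ c≢c′ eq = c≢c′ (proj₂ (cell-injective s s′ _ _ p p′ eq))

  exchange-frame : ∀ (T : Tableau μ) e {k x y} → to T y ≡ k → x ≢ e → x ≢ y →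
                   to (exchange μ (to T e) k T) x ≡ to T x
  exchange-frame T e {k} y≡k x≢e x≢y = exchange-other μ (to T e) k T (x≢e ∘ to-injective T)
    (λ x≡k → x≢y (to-injective T (trans x≡k (sym y≡k))))

  -- Ending with `c ≡ m` makes the list reach the right border, so its being empty or not decides
  -- whether a right neighbour exists.
  data Row (T : Tableau μ) (s : Step) (c : ℕ) : List (Fin N) → Set where
    []   : c ≡ m → Row T s c []
    cons : ∀ {v vs} (c<m : c ℕ.< m) → to T (cell s c c<m) ≡ v → Row T s (suc c) vs → Row T s c (v ∷ vs)

  Row-length : ∀ {T s c vs} → Row T s c vs → c ℕ.+ length vs ≡ m
  Row-length {c = c} ([] refl)      = ℕ.+-identityʳ c
  Row-length {c = c} (cons _ _ R) = trans (ℕ.+-suc c _) (Row-length R)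

  Row-frame : ∀ {T T′ s c vs} → (∀ c′ (p : c′ ℕ.< m) → c ℕ.≤ c′ → to T′ (cell s c′ p) ≡ to T (cell s c′ p)) →
              Row T s c vs → Row T′ s c vs
  Row-frame T′≡T ([] c≡m)        = [] c≡m
  Row-frame T′≡T (cons c<m eq R) = cons c<m (trans (T′≡T _ c<m ℕ.≤-refl) eq)
    (Row-frame (λ c′ p c<c′ → T′≡T c′ p (ℕ.<⇒≤ c<c′)) R)

  stop-↓ : ∀ b c (c<m : c ℕ.< m) T k {vs} → to T (cell ↓ c c<m) ≡ k → Row T ↓ (suc c) vs → All (k Fin.<_) vs →
           round μ b k T ≡ (0 , T)
  stop-↓ b c c<m T k eq ([] sc≡m) k< = round-stop μ b k T
    (subst (All _) (sym (trans (cong (neighbours μ) (from-cell T eq)) (neighbours-↓-last c c<m (ℕ.<-irrefl sc≡m)))) [])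
  stop-↓ b c c<m T k eq (cons sc<m refl R) (k<v ∷ k<) = round-stop μ b k T
    (subst (All _) (sym (trans (cong (neighbours μ) (from-cell T eq)) (neighbours-↓ c c<m sc<m))) (k<v ∷ []))

  stop-↑ : ∀ b c (c<m : c ℕ.< m) T k {as bs} → to T (cell ↑ c c<m) ≡ k →
           Row T ↑ (suc c) as → Row T ↓ c bs → All (k Fin.<_) as → All (k Fin.<_) bs →
           round μ b k T ≡ (0 , T)
  stop-↑ b c c<m T k eq _ ([] c≡m) _ _ = contradiction c<m (ℕ.<-irrefl c≡m)
  stop-↑ b c c<m T k eq ([] sc≡m) (cons _ refl _) _ (k<b ∷ _) = round-stop μ b k T
    (subst (All _) (sym (trans (cong (neighbours μ) (from-cell T eq)) (neighbours-↑-last c c<m (ℕ.<-irrefl sc≡m)))) (k<b ∷ []))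
  stop-↑ b c c<m T k eq (cons sc<m refl _) (cons _ refl _) (k<a ∷ _) (k<b ∷ _) = round-stop μ b k T
    (subst (All _) (sym (trans (cong (neighbours μ) (from-cell T eq)) (neighbours-↑ c c<m sc<m))) (k<b ∷ k<a ∷ []))

  Outcome↓ : ℕ → Tableau μ → ℕ → List (Fin N) → ℕ × Tableau μ → Set
  Outcome↓ c T e vs (e′ , T′) =
    e′ ≡ e ×
    Row T′ ↓ c vs ×
    (∀ s c′ (p : c′ ℕ.< m) → s ≡ ↑ ⊎ c′ ℕ.< c → to T′ (cell s c′ p) ≡ to T (cell s c′ p))

  -- `L` presents the processed entries in increasing order. The next smaller `↓` is the right
  -- neighbour of `k` and is exchanged with it; an `↑` lies in the other row and changes nothing; at
  -- the first larger entry everything to the right of `k` is larger and the round stops.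
  round-↓ : ∀ L c (c<m : c ℕ.< m) b T k → Sorted L → All (k ≢_) (values L) →
    Row T ↓ (suc c) (row ↓ L) → to T (cell ↓ c c<m) ≡ k → length (row ↓ L) ℕ.≤ b →
    Outcome↓ c T (cost↓ (below (toℕ k) (values L)) (word L)) (row ↓ (place↓ k L)) (round μ b k T)
  round-↓ [] c c<m b T k _ _ R eq _ =
    subst (Outcome↓ c T _ _) (sym (stop-↓ b c c<m T k eq R []))
      (refl , cons c<m eq R , λ _ _ _ _ → refl)
  round-↓ ((v , s) ∷ L) c c<m b T k (v<L ∷ L<) (k≢v ∷ k∉L) R eq len with ℕ.<-≤-connex (toℕ v) (toℕ k)
  ... | inj₂ k≤v =
    subst (Outcome↓ c T _ _) (sym (stop-↓ b c c<m T k eq R (row-All ↓ ((v , s) ∷ L) k<)))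
      (sym (cong (λ r → cost↓ r (s ∷ word L)) (below-none k<)) , cons c<m eq R , λ _ _ _ _ → refl)
    where
    k< = below-all (strict k≤v k≢v) v<L
  round-↓ ((v , ↑) ∷ L) c c<m b T k (v<L ∷ L<) (k≢v ∷ k∉L) R eq len | inj₁ v<k
    with e≡ , R′ , frame ← round-↓ L c c<m b T k L< k∉L R eq len =
    trans e≡ (cong (λ r → cost↓ r (↑ ∷ word L)) (sym (below-< v<k))) , R′ , frame
  round-↓ ((v , ↓) ∷ L) c c<m (suc b) T k (v<L ∷ L<) (k≢v ∷ k∉L) (cons sc<m refl R) eq (s≤s len) | inj₁ v<k =
    subst (Outcome↓ c T _ _) (sym step)
      ( trans (cong suc e≡) (cong (λ r → cost↓ r (↓ ∷ word L)) (sym (below-< v<k)))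
      , cons c<m (trans (frame ↓ c c<m (inj₂ ℕ.≤-refl)) (exchange-second μ v k T eq)) R′
      , λ s c′ p outside → trans (frame s c′ p (weaken outside)) (frame₁ s c′ p outside)
      )
    where
    E = cell ↓ (suc c) sc<m
    T₁ = exchange μ (to T E) k T
    step : round μ (suc b) k T ≡ map₁ suc (round μ b k T₁)
    step = round-exchange μ b k T E (trans (cong (neighbours μ) (from-cell T eq)) (neighbours-↓ c c<m sc<m))
      (here refl) (ℕ.≤-refl ∷ []) v<k
    R₁ : Row T₁ ↓ (suc (suc c)) (row ↓ L)
    R₁ = Row-frame (λ c′ p c<c′ → exchange-frame T E eq
      (cell-≢ ↓ ↓ p sc<m (ℕ.>⇒≢ c<c′)) (cell-≢ ↓ ↓ p c<m (ℕ.>⇒≢ (ℕ.<⇒≤ c<c′)))) R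
    rec = round-↓ L (suc c) sc<m b T₁ k L< k∉L R₁ (exchange-first μ (to T E) k T refl) len
    e≡ = proj₁ rec
    R′ = proj₁ (proj₂ rec)
    frame = proj₂ (proj₂ rec)
    weaken : ∀ {s c′} → s ≡ ↑ ⊎ c′ ℕ.< c → s ≡ ↑ ⊎ c′ ℕ.< suc c
    weaken (inj₁ s≡↑)  = inj₁ s≡↑
    weaken (inj₂ c′<c) = inj₂ (ℕ.m≤n⇒m≤1+n c′<c)
    frame₁ : ∀ s c′ (p : c′ ℕ.< m) → s ≡ ↑ ⊎ c′ ℕ.< c → to T₁ (cell s c′ p) ≡ to T (cell s c′ p)
    frame₁ .↑ c′ p (inj₁ refl) = exchange-frame T E eq (λ ()) (λ ())
    frame₁ s  c′ p (inj₂ c′<c) = exchange-frame T E eq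
      (cell-≢ s ↓ p sc<m (ℕ.<⇒≢ (ℕ.m≤n⇒m≤1+n c′<c))) (cell-≢ s ↓ p c<m (ℕ.<⇒≢ c′<c))

  Outcome↑ : ℕ → Tableau μ → ℕ → List (Fin N) → List (Fin N) → ℕ × Tableau μ → Set
  Outcome↑ c T e as bs (e′ , T′) =
    e′ ≡ e ×
    Row T′ ↑ c as ×
    Row T′ ↓ c bs ×
    (∀ s c′ (p : c′ ℕ.< m) → c′ ℕ.< c → to T′ (cell s c′ p) ≡ to T (cell s c′ p))

  -- h is the height of the path after the entries smaller than k met so far; L
  -- holds the remaining ones.  The first h entries of the lower row in L lie to
  -- the left of column c, hence the drop h.
  round-↑ : ∀ L h c (c<m : c ℕ.< m) b T k → Sorted L → All (k ≢_) (values L) →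
    Row T ↑ (suc c) (row ↑ L) → Row T ↓ c (drop h (row ↓ L)) → to T (cell ↑ c c<m) ≡ k →
    length (drop h (row ↓ L)) ℕ.≤ b →
    Outcome↑ c T (cost↑ h (below (toℕ k) (values L)) (word L))
      (row ↑ (place↑ h k L)) (drop h (row ↓ (place↑ h k L))) (round μ b k T)
  round-↑ [] zero    c c<m b T k _ _ _ ([] c≡m) _ _ = contradiction c<m (ℕ.<-irrefl c≡m)
  round-↑ [] (suc h) c c<m b T k _ _ _ ([] c≡m) _ _ = contradiction c<m (ℕ.<-irrefl c≡m)
  round-↑ ((v , s) ∷ L) h c c<m b T k (v<L ∷ L<) (k≢v ∷ k∉L) A B eq len with ℕ.<-≤-connex (toℕ v) (toℕ k)
  ... | inj₂ k≤v =
    subst (Outcome↑ c T _ _ _)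
      (sym (stop-↑ b c c<m T k eq A B (row-All ↑ ((v , s) ∷ L) k<) (All.drop⁺ h (row-All ↓ ((v , s) ∷ L) k<))))
      ( sym (cong (λ r → cost↑ h r (s ∷ word L)) (below-none k<))
      , cons c<m eq A , B , λ _ _ _ _ → refl)
    where
    k< = below-all (strict k≤v k≢v) v<L
  -- At positive height this lower entry lies to the left of column `c` and cannot meet `k`.
  round-↑ ((v , ↓) ∷ L) (suc h) c c<m b T k (v<L ∷ L<) (k≢v ∷ k∉L) A B eq len | inj₁ v<k
    with e≡ , A′ , B′ , frame ← round-↑ L h c c<m b T k L< k∉L A B eq len =
    trans e≡ (cong (λ r → cost↑ (suc h) r (↓ ∷ word L)) (sym (below-< v<k))) , A′ , B′ , frame
  -- At height 0 the next lower entry stands directly below `k`. The upper entries still in `L` are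
  -- larger, so `v` is the smallest neighbour: it moves up, becoming `↑`, and `k` continues in the
  -- lower row.
  round-↑ ((v , ↓) ∷ L) zero c c<m (suc b) T k (v<L ∷ L<) (k≢v ∷ k∉L) A (cons _ refl B) eq (s≤s len) | inj₁ v<k =
    subst (Outcome↑ c T _ _ _) (sym step)
      ( trans (cong suc e≡) (cong (λ r → cost↑ 0 r (↓ ∷ word L)) (sym (below-< v<k)))
      , cons c<m (trans (frame ↑ c c<m (inj₁ refl)) (exchange-second μ v k T eq))
          (subst (Row _ ↑ (suc c)) (sym (row-↑-place↓ k L))
            (Row-frame (λ c′ p c<c′ → trans (frame ↑ c′ p (inj₁ refl)) (exchange-frame T E eq (λ ()) (cell-≢ ↑ ↑ p c<m (ℕ.>⇒≢ c<c′)))) A))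
      , B′
      , λ s c′ p c′<c → trans (frame s c′ p (inj₂ c′<c))
          (exchange-frame T E eq (cell-≢ s ↓ p c<m (ℕ.<⇒≢ c′<c)) (cell-≢ s ↑ p c<m (ℕ.<⇒≢ c′<c)))
      )
    where
    E = cell ↓ c c<m
    T₁ = exchange μ (to T E) k T
    step : round μ (suc b) k T ≡ map₁ suc (round μ b k T₁)
    step = at A (row-All ↑ L v<L)
      where
      at : ∀ {as} → Row T ↑ (suc c) as → All (v Fin.<_) as → round μ (suc b) k T ≡ map₁ suc (round μ b k T₁)
      at ([] sc≡m) [] = round-exchange μ b k T E
        (trans (cong (neighbours μ) (from-cell T eq)) (neighbours-↑-last c c<m (ℕ.<-irrefl sc≡m)))
        (here refl) (ℕ.≤-refl ∷ []) v<k
      at (cons sc<m refl _) (v<a ∷ _) = round-exchange μ b k T E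
        (trans (cong (neighbours μ) (from-cell T eq)) (neighbours-↑ c c<m sc<m))
        (here refl) (ℕ.≤-refl ∷ ℕ.<⇒≤ v<a ∷ []) v<k
    rec = round-↓ L c c<m b T₁ k L< k∉L
      (Row-frame (λ c′ p c<c′ → exchange-frame T E eq (cell-≢ ↓ ↓ p c<m (ℕ.>⇒≢ c<c′)) (λ ())) B)
      (exchange-first μ (to T E) k T refl) len
    e≡ = proj₁ rec
    B′ = proj₁ (proj₂ rec)
    frame = proj₂ (proj₂ rec)
  -- Now `v` is the right neighbour, and the entry `b₀` below `k` comes later in `L`, hence is
  -- larger. After the exchange `k` is one column further right, so `b₀` joins the lower entries
  -- left behind and the height grows by one.
  round-↑ ((v , ↑) ∷ L) h c c<m b T k (v<L ∷ L<) (k≢v ∷ k∉L) (cons sc<m refl A) B eq len | inj₁ v<k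
    with drop h (row ↓ L) in drop≡
  ... | [] with [] c≡m ← B = contradiction c<m (ℕ.<-irrefl c≡m)
  round-↑ ((v , ↑) ∷ L) h c c<m (suc b) T k (v<L ∷ L<) (k≢v ∷ k∉L) (cons sc<m refl A) (cons _ refl B) eq (s≤s len) | inj₁ v<k
      | b₀ ∷ bs =
    subst (Outcome↑ c T _ _ _) (sym step)
      ( trans (cong suc e≡) (cong (λ r → cost↑ h r (↑ ∷ word L)) (sym (below-< v<k)))
      , cons c<m (trans (frame ↑ c c<m ℕ.≤-refl) (exchange-second μ v k T eq)) A′
      , subst (Row _ ↓ c) (sym (trans (proj₂ kept) (cong (b₀ ∷_) (sym (drop-suc h (proj₂ kept))))))
          (cons c<m (trans (frame ↓ c c<m ℕ.≤-refl) (exchange-frame T E eq (λ ()) (λ ()))) B′)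
      , λ s c′ p c′<c → trans (frame s c′ p (ℕ.m≤n⇒m≤1+n c′<c))
          (exchange-frame T E eq (cell-≢ s ↑ p sc<m (ℕ.<⇒≢ (ℕ.m≤n⇒m≤1+n c′<c))) (cell-≢ s ↑ p c<m (ℕ.<⇒≢ c′<c)))
      )
    where
    E = cell ↑ (suc c) sc<m
    T₁ = exchange μ (to T E) k T
    kept = drop-row-place↑ k L {h} {suc h} ℕ.≤-refl drop≡
    v<b : v Fin.< b₀
    v<b with v<b ∷ _ ← subst (All (v Fin.<_)) drop≡ (All.drop⁺ h (row-All ↓ L v<L)) = v<b
    step : round μ (suc b) k T ≡ map₁ suc (round μ b k T₁)
    step = round-exchange μ b k T E (trans (cong (neighbours μ) (from-cell T eq)) (neighbours-↑ c c<m sc<m))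
      (there (here refl)) (ℕ.<⇒≤ v<b ∷ ℕ.≤-refl ∷ []) v<k
    rec = round-↑ L (suc h) (suc c) sc<m b T₁ k L< k∉L
      (Row-frame (λ c′ p c<c′ → exchange-frame T E eq (cell-≢ ↑ ↑ p sc<m (ℕ.>⇒≢ c<c′)) (cell-≢ ↑ ↑ p c<m (ℕ.>⇒≢ (ℕ.<⇒≤ c<c′)))) A)
      (Row-frame (λ c′ p c<c′ → exchange-frame T E eq (λ ()) (λ ())) (subst (Row T ↓ (suc c)) (sym (drop-suc h drop≡)) B))
      (exchange-first μ (to T E) k T refl)
      (subst (λ bs → length bs ℕ.≤ b) (sym (drop-suc h drop≡)) len)
    e≡ = proj₁ rec
    A′ = proj₁ (proj₂ rec)
    B′ = proj₁ (proj₂ (proj₂ rec))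
    frame = proj₂ (proj₂ (proj₂ rec))

  -- The entries of the initial tableau from column `c` on. The processed columns hold the same
  -- entries rearranged, which is why ranks may be computed from this list.
  data ReadFrom (T : Tableau μ) (c : ℕ) : List (Fin N) → Set where
    []   : c ≡ m → ReadFrom T c []
    cons : ∀ {l} (c<m : c ℕ.< m) → ReadFrom T (suc c) l →
           ReadFrom T c (to T (cell ↑ c c<m) ∷ to T (cell ↓ c c<m) ∷ l)

  ReadFrom-∉ : ∀ {T c l} s c′ (c′<m : c′ ℕ.< m) → c′ ℕ.< c → ReadFrom T c l → All (to T (cell s c′ c′<m) ≢_) l
  ReadFrom-∉ s c′ c′<m c′<c ([] _) = []
  ReadFrom-∉ {T} s c′ c′<m c′<c (cons c<m R) =
    (cell-≢ s ↑ c′<m c<m (ℕ.<⇒≢ c′<c) ∘ to-injective T) ∷ (cell-≢ s ↓ c′<m c<m (ℕ.<⇒≢ c′<c) ∘ to-injective T)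
    ∷ ReadFrom-∉ s c′ c′<m (ℕ.m≤n⇒m≤1+n c′<c) R

  -- `permuted` connects the two orders in play: `codes` ranks an entry in the initial arrangement,
  -- the rounds compare it with the sorted one, and `below` is invariant under permutation.
  record Processed (l : List (Fin N)) : Set where
    field
      sorted    : Sorted (entries l)
      permuted  : values (entries l) ↭ l
      word≡     : word (entries l) ≡ state (codes l)
  open Processed

  processed-[] : Processed []
  processed-[] = record { sorted = [] ; permuted = ↭-refl ; word≡ = refl }

  module _ {l} (P : Processed l) {x y} (x∉l : All (x ≢_) l) (y∉l : All (y ≢_) l) (y≢x : y ≢ x) where

    x∉ : All (x ≢_) (values (entries l))
    x∉ = All-resp-↭ (↭-sym (permuted P)) x∉l

    permuted₁ : values (place↓ x (entries l)) ↭ x ∷ l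
    permuted₁ = ↭-trans (place↓-↭ x (entries l)) (↭-prep x (permuted P))

    y∉ : All (y ≢_) (values (place↓ x (entries l)))
    y∉ = All-resp-↭ (↭-sym permuted₁) (y≢x ∷ y∉l)

    sorted₁ : Sorted (place↓ x (entries l))
    sorted₁ = place↓-sorted x (entries l) (sorted P) x∉

    word₁ : word (place↓ x (entries l)) ≡ insert↓ (below (toℕ x) l) (state (codes l))
    word₁ = trans (word-place↓ x (entries l) (sorted P) x∉)
                  (cong₂ insert↓ (below-↭ (toℕ x) (permuted P)) (word≡ P))

    processed-∷∷ : Processed (y ∷ x ∷ l)
    processed-∷∷ = record
      { sorted   = place↑-sorted 0 y _ sorted₁ y∉
      ; permuted = ↭-trans (place↑-↭ 0 y (place↓ x (entries l))) (↭-prep y permuted₁)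
      ; word≡    = trans (word-place↑ 0 y _ sorted₁ y∉)
                         (cong₂ (insert↑ 0) (below-↭ (toℕ y) permuted₁) word₁)
      }

    cost-∷∷ : ∀ {e₁ e₂} →
      e₁ ≡ cost↓ (below (toℕ x) (values (entries l))) (word (entries l)) →
      e₂ ≡ cost↑ 0 (below (toℕ y) (values (place↓ x (entries l)))) (word (place↓ x (entries l))) →
      cost (codes (y ∷ x ∷ l)) ≡ cost (codes l) ℕ.+ (e₁ ℕ.+ e₂)
    cost-∷∷ refl refl = sym (cong₂ (λ a b → cost (codes l) ℕ.+ (a ℕ.+ b))
      (cong₂ cost↓ (below-↭ (toℕ x) (permuted P)) (word≡ P))
      (cong₂ (cost↑ 0) (below-↭ (toℕ y) permuted₁) word₁))

  -- `decreasingCells μ` cut down to the first `j` columns, with `downFrom 2` evaluated; for `j` =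
  -- `m` only `max≡m` is left to apply.
  cells : ℕ → List (Cell μ)
  cells j = concatMap (λ c → mapMaybe (λ s → cellAt μ s c) (1 ∷ 0 ∷ [])) (downFrom j)

  cells-suc : ∀ j (j<m : j ℕ.< m) → cells (suc j) ≡ cell ↓ j j<m ∷ cell ↑ j j<m ∷ cells j
  cells-suc j j<m rewrite cellAt-↓ j j<m | cellAt-↑ j j<m = refl

  -- The loop invariant: from column `j` on the tableau is as described by `entries l`, to the left
  -- it is still initial, and `cost (codes l)` accounts for the exchanges made so far. Each step
  -- prepends one column to `l`, until `l′` reads the whole initial tableau.
  rounds-cells : ∀ T₀ j → j ℕ.≤ m → ∀ T l → ReadFrom T₀ j l → Processed l →
    Row T ↑ j (row ↑ (entries l)) → Row T ↓ j (row ↓ (entries l)) →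
    (∀ s c (p : c ℕ.< m) → c ℕ.< j → to T (cell s c p) ≡ to T₀ (cell s c p)) →
    ∃ λ l′ → ReadFrom T₀ 0 l′ × cost (codes l′) ≡ rounds μ (map (to T₀) (cells j)) T ℕ.+ cost (codes l)
  rounds-cells T₀ zero    _   T l R P A B T≡T₀ = l , R , refl
  rounds-cells T₀ (suc j) j<m T l R P A B T≡T₀ =
    let l′ , R′ , eq = rounds-cells T₀ j (ℕ.<⇒≤ j<m) T₂ (y ∷ x ∷ l) (cons j<m R)
          (processed-∷∷ P x∉l y∉l y≢x) A₂ B₂
          (λ s c p c<j → trans (frame₂ s c p c<j)
             (trans (frame₁ s c p (inj₂ c<j)) (T≡T₀ s c p (ℕ.m≤n⇒m≤1+n c<j))))
    in l′ , R′ , (begin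
      cost (codes l′)
        ≡⟨ eq ⟩
      rounds μ ks T₂ ℕ.+ cost (codes (y ∷ x ∷ l))
        ≡⟨ cong (rounds μ ks T₂ ℕ.+_) (cost-∷∷ P x∉l y∉l y≢x e₁≡ e₂≡) ⟩
      rounds μ ks T₂ ℕ.+ (cost (codes l) ℕ.+ (e₁ ℕ.+ e₂))
        ≡⟨ regroup (rounds μ ks T₂) (cost (codes l)) e₁ e₂ ⟩
      e₁ ℕ.+ (e₂ ℕ.+ rounds μ ks T₂) ℕ.+ cost (codes l)
        ≡⟨ cong (λ r → e₁ ℕ.+ r ℕ.+ cost (codes l)) (rounds-∷ μ y ks T₁) ⟨
      e₁ ℕ.+ rounds μ (y ∷ ks) T₁ ℕ.+ cost (codes l)
        ≡⟨ cong (ℕ._+ cost (codes l)) (rounds-∷ μ x (y ∷ ks) T) ⟨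
      rounds μ (x ∷ y ∷ ks) T ℕ.+ cost (codes l)
        ≡⟨ cong (λ cs → rounds μ (map (to T₀) cs) T ℕ.+ cost (codes l)) (cells-suc j j<m) ⟨
      rounds μ (map (to T₀) (cells (suc j))) T ℕ.+ cost (codes l) ∎)
    where
    regroup : ∀ a b c d → a ℕ.+ (b ℕ.+ (c ℕ.+ d)) ≡ c ℕ.+ (d ℕ.+ a) ℕ.+ b
    regroup = solve-∀
    x = to T₀ (cell ↓ j j<m)
    y = to T₀ (cell ↑ j j<m)
    ks = map (to T₀) (cells j)
    x∉l = ReadFrom-∉ ↓ j j<m ℕ.≤-refl R
    y∉l = ReadFrom-∉ ↑ j j<m ℕ.≤-refl R
    y≢x : y ≢ x
    y≢x eq with () ← to-injective T₀ {cell ↑ j j<m} {cell ↓ j j<m} eq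
    -- A round makes at most one exchange per column that remains to the right, plus one downwards,
    -- so a row length bounds it, and `N` is two row lengths.
    enough : ∀ {T s c vs} → Row T s c vs → length vs ℕ.≤ N
    enough R = ℕ.≤-trans (ℕ.m+n≤o⇒n≤o _ (ℕ.≤-reflexive (Row-length R))) (ℕ.m≤m+n m (m ℕ.+ 0))
    e₁ = proj₁ (round μ N x T)
    T₁ = proj₂ (round μ N x T)
    first = round-↓ (entries l) j j<m N T x (sorted P) (x∉ P x∉l y∉l y≢x) B (T≡T₀ ↓ j j<m ℕ.≤-refl) (enough B)
    e₁≡ = proj₁ first
    B₁ = proj₁ (proj₂ first)
    frame₁ = proj₂ (proj₂ first)
    A₁ : Row T₁ ↑ (suc j) (row ↑ (place↓ x (entries l)))
    A₁ = subst (Row T₁ ↑ (suc j)) (sym (row-↑-place↓ x (entries l))) (Row-frame (λ c′ p _ → frame₁ ↑ c′ p (inj₁ refl)) A)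
    e₂ = proj₁ (round μ N y T₁)
    T₂ = proj₂ (round μ N y T₁)
    second = round-↑ (place↓ x (entries l)) 0 j j<m N T₁ y (sorted₁ P x∉l y∉l y≢x) (y∉ P x∉l y∉l y≢x) A₁ B₁
      (trans (frame₁ ↑ j j<m (inj₁ refl)) (T≡T₀ ↑ j j<m ℕ.≤-refl)) (enough B₁)
    e₂≡ = proj₁ second
    A₂ = proj₁ (proj₂ second)
    B₂ = proj₁ (proj₂ (proj₂ second))
    frame₂ = proj₂ (proj₂ (proj₂ second))

  reading : (Cell μ → Fin N) → List (Fin N)
  reading f = columns (λ j → f (zero , j)) (λ j → f (suc zero , j))

  -- The index map `ix` absorbs the shift by `c`, since `columns` recurses by composing with `suc`.
  ReadFrom-columns : ∀ T k c (ix : Fin k → Fin m) → c ℕ.+ k ≡ m → (∀ i → toℕ (ix i) ≡ c ℕ.+ toℕ i) → ∀ {l} →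
    ReadFrom T c l → l ≡ columns (λ j → to T (zero , ix j)) (λ j → to T (suc zero , ix j))
  ReadFrom-columns T zero    c ix eq ix≡ ([] _)       = refl
  ReadFrom-columns T zero    c ix eq ix≡ (cons c<m R) = contradiction c<m (ℕ.<-irrefl (trans (sym (ℕ.+-identityʳ c)) eq))
  ReadFrom-columns T (suc k) c ix eq ix≡ ([] refl)    = contradiction eq (ℕ.m+1+n≢m c)
  ReadFrom-columns T (suc k) c ix eq ix≡ (cons c<m R) = cong₂ (λ a b → a ∷ b)
    (cong (λ i → to T (zero , i)) first) (cong₂ _∷_ (cong (λ i → to T (suc zero , i)) first)
    (ReadFrom-columns T k (suc c) (ix ∘ suc) (trans (sym (ℕ.+-suc c k)) eq) (λ i → trans (ix≡ (suc i)) (ℕ.+-suc c (toℕ i))) R))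
    where
    first : fromℕ< c<m ≡ ix zero
    first = Fin.toℕ-injective (trans (Fin.toℕ-fromℕ< c<m) (sym (trans (ix≡ zero) (ℕ.+-identityʳ c))))

  max≡m : max 0 (m ∷ m ∷ []) ≡ m
  max≡m = ℕ.≤-antisym (f[argmax]≤v⁺ ℕ.≤-totalOrder {f = id} {v = m} {xs = m ∷ m ∷ []} z≤n (ℕ.≤-refl ∷ ℕ.≤-refl ∷ []))
                      (v≤f[argmax]⁺ ℕ.≤-totalOrder {f = id} {v = m} 0 (m ∷ m ∷ []) (inj₂ (here ℕ.≤-refl)))

  exchanges≡cost : ∀ T → exchanges μ T ≡ cost (codes (reading (to T)))
  exchanges≡cost T = begin
    rounds μ (map (to T) (decreasingCells μ)) T
      ≡⟨ cong (λ j → rounds μ (map (to T) (cells j)) T) max≡m ⟩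
    rounds μ (map (to T) (cells m)) T
      ≡⟨ ℕ.+-identityʳ _ ⟨
    rounds μ (map (to T) (cells m)) T ℕ.+ 0
      ≡⟨ proj₂ (proj₂ result) ⟨
    cost (codes (proj₁ result))
      ≡⟨ cong (cost ∘ codes) (ReadFrom-columns T m 0 id refl (λ _ → refl) (proj₁ (proj₂ result))) ⟩
    cost (codes (reading (to T))) ∎
    where
    result = rounds-cells T m ℕ.≤-refl T [] ([] refl) processed-[] ([] refl) ([] refl) (λ _ _ _ _ → refl)

  -- Tableaux correspond to permutations

  rowSetoid = λ (i : Fin 2) → Π-setoid {lookup (parts μ) i} (λ _ → setoid (Fin N))

  rows : List (∀ (i : Fin 2) → Fin (lookup (parts μ) i) → Fin N)
  rows = choices (λ i → choices (λ j → allFin N))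

  rows-unique : SetoidUnique.Unique (Π-setoid rowSetoid) rows
  rows-unique = choices-unique rowSetoid _ (λ i → choices-unique (λ _ → setoid (Fin N)) _ (λ j → Unique.allFin⁺ N))

  rows-complete : ∀ F → Any (λ G → ∀ i j → F i j ≡ G i j) rows
  rows-complete F = choices-complete rowSetoid _ F (λ i → choices-complete (λ _ → setoid (Fin N)) _ (F i) (λ j → ∈-allFin (F i j)))

  readings-unique : AllPairs (λ f g → reading f ≢ reading g) (fillings μ)
  readings-unique = AllPairs.map⁺ (AllPairs.map (λ F≉G eq → F≉G (λ
    { zero       → proj₁ (columns-injective eq)
    ; (suc zero) → proj₂ (columns-injective eq) })) rows-unique)

  toTableau : (Cell μ → Fin N) → Maybe (Tableau μ)
  toTableau f = Maybe.map (⤖⇒↔ ∘ mk⤖) (dec⇒maybe (bijective? μ f))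

  -- Comparing the words read off avoids comparing bijections with their inverses and proofs. As
  -- `toTableau` is the function mapped in `tableaux`, `readings (fillings μ)` is by computation the
  -- list of readings of all tableaux.
  readings : List (Cell μ → Fin N) → List (List (Fin N))
  readings fs = map (reading ∘ to) (mapMaybe toTableau fs)

  readings-sound : ∀ fs → All (λ w → Any (λ f → Bijective _≡_ _≡_ f × reading f ≡ w) fs) (readings fs)
  readings-sound []       = []
  readings-sound (f ∷ fs) with bijective? μ f
  ... | yes bij = here (bij , refl) ∷ All.map there (readings-sound fs)
  ... | no  _   = All.map there (readings-sound fs)

  readings-complete : ∀ fs {w} → Any (λ f → Bijective _≡_ _≡_ f × reading f ≡ w) fs → w ∈ readings fs
  readings-complete (f ∷ fs) f∈ with bijective? μ f
  readings-complete (f ∷ fs) (here (_ , eq))  | yes _    = here (sym eq)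
  readings-complete (f ∷ fs) (there f∈)       | yes _    = there (readings-complete fs f∈)
  readings-complete (f ∷ fs) (here (bij , _)) | no ¬bij  = contradiction bij ¬bij
  readings-complete (f ∷ fs) (there f∈)       | no _     = readings-complete fs f∈

  readings-! : ∀ fs → AllPairs (λ f g → reading f ≢ reading g) fs → Unique (readings fs)
  readings-! []       []         = []
  readings-! (f ∷ fs) (f# ∷ fs#) with bijective? μ f
  ... | no  _ = readings-! fs fs#
  ... | yes _ = All.map (λ g∈ eq → distinct f# g∈ eq) (readings-sound fs) ∷ readings-! fs fs#
    where
    distinct : ∀ {w gs} → All (λ g → reading f ≢ reading g) gs →
               Any (λ g → Bijective _≡_ _≡_ g × reading g ≡ w) gs → reading f ≢ w
    distinct (f≢g ∷ _) (here (_ , refl)) eq = f≢g eq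
    distinct (_ ∷ f#)  (there g∈)        eq = distinct f# g∈ eq

  length-reading : ∀ f → length (reading f) ≡ N
  length-reading f = trans (length-columns _ _) (dbl≡2* m)

  reading-unique⁺ : ∀ f → Injective _≡_ _≡_ f → Unique (reading f)
  reading-unique⁺ f inj = unique-columns⁺ (record
    { f-injective = λ eq → ↑-injective (inj eq)
    ; g-injective = λ eq → ↓-injective (inj eq)
    ; f≢g         = λ eq → ↑≢↓ (inj eq)
    })
    where
    ↑-injective : ∀ {i j : Fin m} → _≡_ {A = Cell μ} (zero , i) (zero , j) → i ≡ j
    ↑-injective refl = refl
    ↓-injective : ∀ {i j : Fin m} → _≡_ {A = Cell μ} (suc zero , i) (suc zero , j) → i ≡ j
    ↓-injective refl = refl
    ↑≢↓ : ∀ {i j : Fin m} → _≢_ {A = Cell μ} (zero , i) (suc zero , j)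
    ↑≢↓ ()

  reading-injective⁻ : ∀ f → Unique (reading f) → Injective _≡_ _≡_ f
  reading-injective⁻ f u {zero , _}     {zero , _}     eq = cong (zero ,_) (f-injective (unique-columns⁻ u) eq)
  reading-injective⁻ f u {suc zero , _} {suc zero , _} eq = cong (suc zero ,_) (g-injective (unique-columns⁻ u) eq)
  reading-injective⁻ f u {zero , _}     {suc zero , _} eq = contradiction eq (f≢g (unique-columns⁻ u))
  reading-injective⁻ f u {suc zero , _} {zero , _}     eq = contradiction (sym eq) (f≢g (unique-columns⁻ u))

  reading-surjective⁻ : ∀ f → (∀ v → v ∈ reading f) → Surjective _≡_ _≡_ f
  reading-surjective⁻ f ∈f v with ∈-columns⁻ _ _ (∈f v)
  ... | inj₁ (j , refl) = (zero , j) , λ { refl → refl }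
  ... | inj₂ (j , refl) = (suc zero , j) , λ { refl → refl }

  -- Two lists without repetition and with the same members are permutations of each other.
  -- Surjectivity of a filling read from a permutation needs no counting, because `perms-sound`
  -- already says that every value occurs.
  readings-↭-perms : readings (fillings μ) ↭ perms N
  readings-↭-perms = ∼bag⇒↭ (unique∧set⇒bag (readings-! (fillings μ) readings-unique) (perms-unique N)
    (mk⇔ (λ w∈ → sound (All.lookup (readings-sound (fillings μ)) w∈)) complete))
    where
    sound : ∀ {w fs} → Any (λ f → Bijective _≡_ _≡_ f × reading f ≡ w) fs → w ∈ perms N
    sound (here {f} ((inj , _) , refl)) = perms-complete N (reading f) (reading-unique⁺ f inj) (length-reading f)
    sound (there f∈)                    = sound f∈
    complete : ∀ {w} → w ∈ perms N → w ∈ readings (fillings μ)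
    complete {w} w∈ = readings-complete (fillings μ) (Any.map⁺ (Any.map found (rows-complete F)))
      where
      w! = proj₁ (perms-sound N w∈)
      ∈w = proj₂ (proj₂ (perms-sound N w∈))
      preimage = columns-surjective m w (trans (proj₁ (proj₂ (perms-sound N w∈))) (sym (dbl≡2* m)))
      F : ∀ (i : Fin 2) → Fin (lookup (parts μ) i) → Fin N
      F zero       = proj₁ preimage
      F (suc zero) = proj₁ (proj₂ preimage)
      found : ∀ {G} → (∀ i j → F i j ≡ G i j) → Bijective _≡_ _≡_ (uncurry G) × reading (uncurry G) ≡ w
      found {G} F≡G = (reading-injective⁻ (uncurry G) (subst Unique (sym eq) w!)
                      , reading-surjective⁻ (uncurry G) (λ v → subst (v ∈_) (sym eq) (∈w v))) , eq
        where
        eq : reading (uncurry G) ≡ w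
        eq = trans (columns-cong (λ j → sym (F≡G zero j)) (λ j → sym (F≡G (suc zero) j))) (proj₂ (proj₂ preimage))

  totalExchanges : sum (map (exchanges μ) (tableaux μ)) ≡ totalCost m
  totalExchanges = begin
    sum (map (exchanges μ) (tableaux μ))
      ≡⟨ cong sum (List.map-cong exchanges≡cost (tableaux μ)) ⟩
    sum (map (cost ∘ codes ∘ reading ∘ to) (tableaux μ))
      ≡⟨ cong sum (List.map-∘ (tableaux μ)) ⟩
    sum (map (cost ∘ codes) (readings (fillings μ)))
      ≡⟨ sum-↭ (map⁺ (cost ∘ codes) readings-↭-perms) ⟩
    sum (map (cost ∘ codes) (perms N))
      ≡⟨ sum-perms-codes N cost ⟩
    ∑codes N cost
      ≡⟨ cong (λ k → ∑codes k cost) (dbl≡2* m) ⟨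
    totalCost m ∎

-- Rational arithmetic

ι : ℤ → ℚ
ι z = z / 1

toℚᵘ-/ : ∀ z n .{{_ : NonZero n}} → toℚᵘ (z / n) ≃ (z ℚᵘ./ n)
toℚᵘ-/ z (suc n) = ℚ.toℚᵘ-fromℚᵘ (mkℚᵘ z n)

ι-+ : ∀ a b → ι (a ℤ.+ b) ≡ ι a + ι b
ι-+ a b = ℚ.toℚᵘ-injective (ℚᵘ.≃-trans (toℚᵘ-/ (a ℤ.+ b) 1) (ℚᵘ.≃-trans (*≡* (eq a b))
  (ℚᵘ.≃-sym (ℚᵘ.≃-trans (ℚ.toℚᵘ-homo-+ (ι a) (ι b)) (ℚᵘ.+-cong (toℚᵘ-/ a 1) (toℚᵘ-/ b 1))))))
  where
  eq : ∀ a b → (a ℤ.+ b) ℤ.* + 1 ≡ (a ℤ.* + 1 ℤ.+ b ℤ.* + 1) ℤ.* + 1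
  eq = ℤ-Solver.solve-∀

ι-* : ∀ a b → ι (a ℤ.* b) ≡ ι a * ι b
ι-* a b = ℚ.toℚᵘ-injective (ℚᵘ.≃-trans (toℚᵘ-/ (a ℤ.* b) 1) (ℚᵘ.≃-trans (*≡* refl)
  (ℚᵘ.≃-sym (ℚᵘ.≃-trans (ℚ.toℚᵘ-homo-* (ι a) (ι b)) (ℚᵘ.*-cong (toℚᵘ-/ a 1) (toℚᵘ-/ b 1))))))

/-* : ∀ z n .{{_ : NonZero n}} → (z / n) * ι (+ n) ≡ ι z
/-* z n@(suc _) = ℚ.toℚᵘ-injective (ℚᵘ.≃-trans
  (ℚᵘ.≃-trans (ℚ.toℚᵘ-homo-* (z / n) (ι (+ n))) (ℚᵘ.*-cong (toℚᵘ-/ z n) (toℚᵘ-/ (+ n) 1)))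
  (ℚᵘ.≃-trans (*≡* (eq z (+ n))) (ℚᵘ.≃-sym (toℚᵘ-/ z 1))))
  where
  eq : ∀ z n → z ℤ.* n ℤ.* + 1 ≡ z ℤ.* (n ℤ.* + 1)
  eq = ℤ-Solver.solve-∀

ιℕ : ℕ → ℚ
ιℕ n = ι (+ n)

ιℕ-+ : ∀ m n → ιℕ (m ℕ.+ n) ≡ ιℕ m + ιℕ n
ιℕ-+ m n = trans (cong ι (ℤ.pos-+ m n)) (ι-+ (+ m) (+ n))

ιℕ-* : ∀ m n → ιℕ (m ℕ.* n) ≡ ιℕ m * ιℕ n
ιℕ-* m n = trans (cong ι (ℤ.pos-* m n)) (ι-* (+ m) (+ n))

cancelʳ : ∀ n .{{_ : NonZero n}} {p q} → p * ιℕ n ≡ q * ιℕ n → p ≡ q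
cancelʳ n {p} {q} eq = begin
  p                          ≡⟨ undo p ⟩
  p * ιℕ n * (+ 1 / n)       ≡⟨ cong (_* (+ 1 / n)) eq ⟩
  q * ιℕ n * (+ 1 / n)       ≡⟨ undo q ⟨
  q                          ∎
  where
  undo : ∀ p → p ≡ p * ιℕ n * (+ 1 / n)
  undo p = begin
    p                        ≡⟨ ℚ.*-identityʳ p ⟨
    p * 1ℚ                   ≡⟨ cong (p *_) (/-* (+ 1) n) ⟨
    p * ((+ 1 / n) * ιℕ n)   ≡⟨ cong (p *_) (ℚ.*-comm (+ 1 / n) (ιℕ n)) ⟩
    p * (ιℕ n * (+ 1 / n))   ≡⟨ ℚ.*-assoc p (ιℕ n) (+ 1 / n) ⟨
    p * ιℕ n * (+ 1 / n)     ∎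

/≡ : ∀ z n .{{_ : NonZero n}} q → ι z ≡ q * ιℕ n → z / n ≡ q
/≡ z n q eq = cancelʳ n (trans (/-* z n) eq)

-- Counting all codes gives (2n)! = `κ n` Catₙ = n! (n + 1)! Catₙ; dividing by n! n! leaves (n + 1)
-- Catₙ.
centralBinomial≡C : ∀ n → (2 ℕ.* n) C n ≡ centralBinomial n
centralBinomial≡C n = begin
  (2 ℕ.* n) C n
    ≡⟨ nCk≡n!/k![n-k]! (ℕ.m≤m+n n (n ℕ.+ 0)) ⟩
  ((2 ℕ.* n) !) ℕ./ (n ! ℕ.* (2 ℕ.* n ℕ.∸ n) !)
    ≡⟨ ℕ./-congʳ (cong (λ k → n ! ℕ.* k !) (trans (ℕ.m+n∸m≡n n (n ℕ.+ 0)) (ℕ.+-identityʳ n))) ⟩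
  ((2 ℕ.* n) !) ℕ./ (n ! ℕ.* n !)
    ≡⟨ ℕ./-congˡ (begin
         (2 ℕ.* n) !                       ≡⟨ cong _! (dbl≡2* n) ⟨
         dbl n !                           ≡⟨ κ-catalan n ⟨
         κ n ℕ.* catalan n                 ≡⟨ cong (ℕ._* catalan n) (κ-factorial n) ⟩
         n ! ℕ.* (suc n ℕ.* n !) ℕ.* catalan n ≡⟨ regroup (n !) (suc n) (catalan n) ⟩
         centralBinomial n ℕ.* (n ! ℕ.* n !) ∎) ⟩
  centralBinomial n ℕ.* (n ! ℕ.* n !) ℕ./ (n ! ℕ.* n !)
    ≡⟨ m*n/n≡m (centralBinomial n) (n ! ℕ.* n !) ⟩
  centralBinomial n ∎
  where
  instance
    _ = n !* (2 ℕ.* n ℕ.∸ n) !≢0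
    _ = n !* n !≢0
  regroup : ∀ f s c → f ℕ.* (s ℕ.* f) ℕ.* c ≡ s ℕ.* c ℕ.* (f ℕ.* f)
  regroup = solve-∀

catalan≢0 : ∀ n → NonZero (catalan n)
catalan≢0 n = ℕ.m*n≢0⇒n≢0 (suc n) {catalan n} {{subst NonZero (centralBinomial≡C n) (centralBinomial≢0 n)}}

-- Averages and the closed form

averageCost : ℕ → ℚ
averageCost n = + totalCost n / (dbl n !)
  where instance _ = dbl n !≢0

ratio : ℕ → ℚ
ratio n = + (4 ^ n) / centralBinomial n
  where instance _ = ℕ.m*n≢0 (suc n) (catalan n) {{_}} {{catalan≢0 n}}

-- The denominator (n + 1)(n + 2) Catₙ₊₁ is the number of pairs of a path of semilength n and two
-- ranks, so this is the mean cost of adding one column.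
averageStep : ℕ → ℚ
averageStep n = + stepTotal (suc n) / (suc n ℕ.* centralBinomial (suc n))
  where instance
    _ = catalan≢0 (suc n)
    _ = ℕ.m*n≢0 (suc (suc n)) (catalan (suc n))
    _ = ℕ.m*n≢0 (suc n) (centralBinomial (suc n))

averageStep-* : ∀ n → averageStep n * ιℕ (suc n ℕ.* centralBinomial (suc n)) ≡ ιℕ (stepTotal (suc n))
averageStep-* n = /-* (+ stepTotal (suc n)) (suc n ℕ.* centralBinomial (suc n))
  where instance
    _ = catalan≢0 (suc n)
    _ = ℕ.m*n≢0 (suc (suc n)) (catalan (suc n))
    _ = ℕ.m*n≢0 (suc n) (centralBinomial (suc n))

ratio-* : ∀ n → ratio n * ιℕ (centralBinomial n) ≡ ιℕ (4 ^ n)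
ratio-* n = /-* (+ (4 ^ n)) (centralBinomial n)
  where instance _ = ℕ.m*n≢0 (suc n) (catalan n) {{_}} {{catalan≢0 n}}

averageCost-suc : ∀ n → averageCost (suc n) ≡ averageCost n + averageStep n
averageCost-suc n = /≡ (+ totalCost (suc n)) (dbl (suc n) !) (averageCost n + averageStep n) (begin
  ιℕ (totalCost (suc n))
    ≡⟨ cong ιℕ (totalCost-suc n) ⟩
  ιℕ (m ℕ.* totalCost n ℕ.+ κ n ℕ.* stepTotal (suc n))
    ≡⟨ trans (ιℕ-+ (m ℕ.* totalCost n) (κ n ℕ.* stepTotal (suc n)))
             (cong₂ _+_ (ιℕ-* m (totalCost n)) (ιℕ-* (κ n) (stepTotal (suc n)))) ⟩
  ιℕ m * ιℕ (totalCost n) + ιℕ (κ n) * ιℕ (stepTotal (suc n))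
    ≡⟨ cong₂ (λ a b → ιℕ m * a + ιℕ (κ n) * b) (/-* (+ totalCost n) (dbl n !)) (averageStep-* n) ⟨
  ιℕ m * (averageCost n * ιℕ (dbl n !)) + ιℕ (κ n) * (averageStep n * ιℕ g)
    ≡⟨ regroup (ιℕ m) (averageCost n) (ιℕ (dbl n !)) (ιℕ (κ n)) (averageStep n) (ιℕ g) ⟩
  averageCost n * (ιℕ m * ιℕ (dbl n !)) + averageStep n * (ιℕ (κ n) * ιℕ g)
    ≡⟨ cong₂ (λ a b → averageCost n * a + averageStep n * b)
         (trans (sym (ιℕ-* m (dbl n !))) (cong ιℕ (swap (suc (dbl n)) (suc (suc (dbl n))) (dbl n !))))
         (trans (sym (ιℕ-* (κ n) g)) (cong ιℕ (trans (assoc (κ n) (suc n) (suc (suc n)) (catalan (suc n))) (κ-catalan (suc n))))) ⟩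
  averageCost n * ιℕ (dbl (suc n) !) + averageStep n * ιℕ (dbl (suc n) !)
    ≡⟨ ℚ.*-distribʳ-+ (ιℕ (dbl (suc n) !)) (averageCost n) (averageStep n) ⟨
  (averageCost n + averageStep n) * ιℕ (dbl (suc n) !) ∎)
  where
  instance
    _ = dbl n !≢0
    _ = dbl (suc n) !≢0
  m = suc (dbl n) ℕ.* suc (suc (dbl n))
  g = suc n ℕ.* centralBinomial (suc n)
  swap : ∀ a b c → a ℕ.* b ℕ.* c ≡ b ℕ.* (a ℕ.* c)
  swap = solve-∀
  assoc : ∀ a b c d → a ℕ.* (b ℕ.* (c ℕ.* d)) ≡ a ℕ.* (b ℕ.* c) ℕ.* d
  assoc = solve-∀
  regroup : ∀ m x f k y g → m * (x * f) + k * (y * g) ≡ x * (m * f) + y * (k * g)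
  regroup = solve 6 (λ m x f k y g → m :* (x :* f) :+ k :* (y :* g) := x :* (m :* f) :+ y :* (k :* g)) refl

stepTotal-4ⁿ : ∀ n → 2 ℕ.* stepTotal n ℕ.+ 2 ℕ.* ((n ℕ.* n ℕ.+ 3 ℕ.* n ℕ.+ 1) ℕ.* catalan n) ≡
                     total n ℕ.* catalan n ℕ.+ 2 ℕ.* 4 ^ n
stepTotal-4ⁿ n = cross _ _
  (cong₂ ℕ._+_ (stepTotal-closed n) (cong (2 ℕ.*_) (sym (squaresTotal-closed n))))
  (balance (stepTotal n) (squaresTotal n) (4 ^ n) ((n ℕ.* n ℕ.+ 3 ℕ.* n ℕ.+ 1) ℕ.* catalan n) (total n ℕ.* catalan n))
  where
  balance : ∀ s r p m t → 2 ℕ.* s ℕ.+ 2 ℕ.* m ℕ.+ (t ℕ.+ 2 ℕ.* (r ℕ.+ p)) ≡ t ℕ.+ 2 ℕ.* p ℕ.+ ((2 ℕ.* s ℕ.+ 2 ℕ.* r) ℕ.+ 2 ℕ.* m)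
  balance = solve-∀

2ℚ 3ℚ 4ℚ : ℚ
2ℚ = ιℕ 2
3ℚ = ιℕ 3
4ℚ = ιℕ 4

ιℕ-suc : ∀ n → ιℕ (suc n) ≡ ιℕ n + 1ℚ
ιℕ-suc n = trans (ιℕ-+ 1 n) (ℚ.+-comm 1ℚ (ιℕ n))

-- Solved for the mean step cost, with p = `ratio (suc n)`, this reads k - 3/2 - 1/k + p/k. These
-- are the increments of the three parts of the closed form: k - 3/2 of the quadratic term, -1/k of
-- the harmonic one, and p/k of twice the ratio.
averageStep-ratio : ∀ n → let k = ιℕ (suc n) in
  2ℚ * averageStep n * k * (k + 1ℚ) + 2ℚ * (k * k + 3ℚ * k + 1ℚ) ≡
  2ℚ * (k * k * k) + k * k + k + 2ℚ * ratio (suc n) * (k + 1ℚ)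
averageStep-ratio n = cancelʳ c {{catalan≢0 m}} (begin
  (2ℚ * y * K * (K + 1ℚ) + 2ℚ * (K * K + 3ℚ * K + 1ℚ)) * C
    ≡⟨ solve 3 (λ y K C → (con 2ℚ :* y :* K :* (K :+ con 1ℚ) :+ con 2ℚ :* (K :* K :+ con 3ℚ :* K :+ con 1ℚ)) :* C :=
         con 2ℚ :* (y :* (K :* ((K :+ con 1ℚ) :* C))) :+ con 2ℚ :* ((K :* K :+ con 3ℚ :* K :+ con 1ℚ) :* C)) refl y K C ⟩
  2ℚ * (y * (K * ((K + 1ℚ) * C))) + 2ℚ * ((K * K + 3ℚ * K + 1ℚ) * C)
    ≡⟨ cong₂ (λ a b → 2ℚ * a + 2ℚ * (b * C))
         (trans (cong (y *_) (sym (trans (ιℕ-* m (centralBinomial m)) (cong (K *_) ιb)))) (averageStep-* n))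
         (sym (trans (ιℕ-+ (m ℕ.* m ℕ.+ 3 ℕ.* m) 1) (cong (_+ 1ℚ) (trans (ιℕ-+ (m ℕ.* m) (3 ℕ.* m)) (cong₂ _+_ (ιℕ-* m m) (ιℕ-* 3 m)))))) ⟩
  2ℚ * ιℕ (stepTotal m) + 2ℚ * (ιℕ (m ℕ.* m ℕ.+ 3 ℕ.* m ℕ.+ 1) * C)
    ≡⟨ trans (ιℕ-+ (2 ℕ.* stepTotal m) (2 ℕ.* (M ℕ.* c))) (cong₂ _+_ (ιℕ-* 2 (stepTotal m)) (trans (ιℕ-* 2 (M ℕ.* c)) (cong (2ℚ *_) (ιℕ-* M c)))) ⟨
  ιℕ (2 ℕ.* stepTotal m ℕ.+ 2 ℕ.* ((m ℕ.* m ℕ.+ 3 ℕ.* m ℕ.+ 1) ℕ.* c))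
    ≡⟨ cong ιℕ (stepTotal-4ⁿ m) ⟩
  ιℕ (total m ℕ.* c ℕ.+ 2 ℕ.* 4 ^ m)
    ≡⟨ trans (ιℕ-+ (total m ℕ.* c) (2 ℕ.* 4 ^ m)) (cong₂ _+_ (ιℕ-* (total m) c) (ιℕ-* 2 (4 ^ m))) ⟩
  ιℕ (total m) * C + 2ℚ * ιℕ (4 ^ m)
    ≡⟨ cong₂ (λ a b → a * C + 2ℚ * b) ιtotal (trans (sym (ratio-* m)) (cong (p *_) ιb)) ⟩
  (2ℚ * (K * K * K) + K * K + K) * C + 2ℚ * (p * ((K + 1ℚ) * C))
    ≡⟨ solve 3 (λ p K C → (con 2ℚ :* (K :* K :* K) :+ K :* K :+ K) :* C :+ con 2ℚ :* (p :* ((K :+ con 1ℚ) :* C)) :=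
         (con 2ℚ :* (K :* K :* K) :+ K :* K :+ K :+ con 2ℚ :* p :* (K :+ con 1ℚ)) :* C) refl p K C ⟩
  (2ℚ * (K * K * K) + K * K + K + 2ℚ * p * (K + 1ℚ)) * C ∎)
  where
  m = suc n
  M = m ℕ.* m ℕ.+ 3 ℕ.* m ℕ.+ 1
  c = catalan m
  K = ιℕ m
  C = ιℕ c
  y = averageStep n
  p = ratio m
  ιb : ιℕ (centralBinomial m) ≡ (K + 1ℚ) * C
  ιb = trans (ιℕ-* (suc m) c) (cong (_* C) (ιℕ-suc m))
  ιtotal : ιℕ (total m) ≡ 2ℚ * (K * K * K) + K * K + K
  ιtotal = trans (ιℕ-+ (2 ℕ.* (m ℕ.* m ℕ.* m) ℕ.+ m ℕ.* m) m) (cong (_+ K)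
    (trans (ιℕ-+ (2 ℕ.* (m ℕ.* m ℕ.* m)) (m ℕ.* m)) (cong₂ _+_
      (trans (ιℕ-* 2 (m ℕ.* m ℕ.* m)) (cong (2ℚ *_) (trans (ιℕ-* (m ℕ.* m) m) (cong (_* K) (ιℕ-* m m)))))
      (ιℕ-* m m))))

ratio-suc : ∀ n → ratio (suc n) * (2ℚ * ιℕ n + 1ℚ) ≡ 2ℚ * (ιℕ n + 1ℚ) * ratio n
ratio-suc n = cancelʳ (2 ℕ.* b) {{ℕ.m*n≢0 2 b {{_}} {{ℕ.m*n≢0 (suc n) (catalan n) {{_}} {{catalan≢0 n}}}}}} (begin
  p′ * (2ℚ * N + 1ℚ) * ιℕ (2 ℕ.* b)
    ≡⟨ cong (p′ * (2ℚ * N + 1ℚ) *_) (ιℕ-* 2 b) ⟩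
  p′ * (2ℚ * N + 1ℚ) * (2ℚ * B)
    ≡⟨ solve 3 (λ p′ N B → p′ :* (con 2ℚ :* N :+ con 1ℚ) :* (con 2ℚ :* B) :=
         p′ :* (con 4ℚ :* (N :* B) :+ con 2ℚ :* B)) refl p′ N B ⟩
  p′ * (4ℚ * (N * B) + 2ℚ * B)
    ≡⟨ cong (p′ *_) (trans (ιℕ-+ (4 ℕ.* (n ℕ.* b)) (2 ℕ.* b)) (cong₂ _+_ (trans (ιℕ-* 4 (n ℕ.* b)) (cong (4ℚ *_) (ιℕ-* n b))) (ιℕ-* 2 b))) ⟨
  p′ * ιℕ (4 ℕ.* (n ℕ.* b) ℕ.+ 2 ℕ.* b)
    ≡⟨ cong (λ x → p′ * ιℕ x) (centralBinomial-rec n) ⟨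
  p′ * ιℕ (suc n ℕ.* b′)
    ≡⟨ cong (p′ *_) (trans (ιℕ-* (suc n) b′) (cong (_* ιℕ b′) (ιℕ-suc n))) ⟩
  p′ * ((N + 1ℚ) * ιℕ b′)
    ≡⟨ solve 3 (λ p′ N B′ → p′ :* ((N :+ con 1ℚ) :* B′) := (N :+ con 1ℚ) :* (p′ :* B′)) refl p′ N (ιℕ b′) ⟩
  (N + 1ℚ) * (p′ * ιℕ b′)
    ≡⟨ cong ((N + 1ℚ) *_) (trans (ratio-* (suc n)) (trans (ιℕ-* 4 (4 ^ n)) (cong (4ℚ *_) (sym (ratio-* n))))) ⟩
  (N + 1ℚ) * (4ℚ * (p * B))
    ≡⟨ solve 3 (λ p N B → (N :+ con 1ℚ) :* (con 4ℚ :* (p :* B)) :=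
         con 2ℚ :* (N :+ con 1ℚ) :* p :* (con 2ℚ :* B)) refl p N B ⟩
  2ℚ * (N + 1ℚ) * p * (2ℚ * B)
    ≡⟨ cong (2ℚ * (N + 1ℚ) * p *_) (ιℕ-* 2 b) ⟨
  2ℚ * (N + 1ℚ) * p * ιℕ (2 ℕ.* b) ∎)
  where
  b = centralBinomial n
  b′ = centralBinomial (suc n)
  N = ιℕ n
  B = ιℕ b
  p = ratio n
  p′ = ratio (suc n)

closedForm : ℚ → ℚ → ℚ → ℚ
closedForm N p h = N * (N - 2ℚ) * ½ - 2ℚ * (- p + h * ½ + 1ℚ)

-- With k = n + 1, averageStep-ratio and ratio-suc determine 2k(k + 1) times the increment.
averageCost-closed : ∀ n → averageCost n ≡ closedForm (ιℕ n) (ratio n) (H n)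
averageCost-closed zero    = refl
averageCost-closed (suc n) = cancelʳ (2 ℕ.* (suc n ℕ.* suc (suc n))) (begin
  averageCost (suc n) * ιℕ (2 ℕ.* (suc n ℕ.* suc (suc n)))
    ≡⟨ cong₂ _*_ (trans (averageCost-suc n) (cong (_+ y) (averageCost-closed n))) ιD ⟩
  (closedForm N p h + y) * D
    ≡⟨ solve 4 (λ N p h y →
         (cf N p h :+ y) :* (con 2ℚ :* ((N :+ con 1ℚ) :* (N :+ con 1ℚ :+ con 1ℚ))) :=
         cf N p h :* (con 2ℚ :* ((N :+ con 1ℚ) :* (N :+ con 1ℚ :+ con 1ℚ)))
         :+ (con 2ℚ :* y :* (N :+ con 1ℚ) :* (N :+ con 1ℚ :+ con 1ℚ) :+ con 2ℚ :* ((N :+ con 1ℚ) :* (N :+ con 1ℚ) :+ con 3ℚ :* (N :+ con 1ℚ) :+ con 1ℚ))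
         :- con 2ℚ :* ((N :+ con 1ℚ) :* (N :+ con 1ℚ) :+ con 3ℚ :* (N :+ con 1ℚ) :+ con 1ℚ)) refl N p h y ⟩
  closedForm N p h * D + (2ℚ * y * (N + 1ℚ) * (N + 1ℚ + 1ℚ) + 2ℚ * ((N + 1ℚ) * (N + 1ℚ) + 3ℚ * (N + 1ℚ) + 1ℚ))
    - 2ℚ * ((N + 1ℚ) * (N + 1ℚ) + 3ℚ * (N + 1ℚ) + 1ℚ)
    ≡⟨ cong (λ e → closedForm N p h * D + e - 2ℚ * ((N + 1ℚ) * (N + 1ℚ) + 3ℚ * (N + 1ℚ) + 1ℚ))
         (subst (λ k → 2ℚ * y * k * (k + 1ℚ) + 2ℚ * (k * k + 3ℚ * k + 1ℚ) ≡ 2ℚ * (k * k * k) + k * k + k + 2ℚ * p′ * (k + 1ℚ))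
                (ιℕ-suc n) (averageStep-ratio n)) ⟩
  closedForm N p h * D + (2ℚ * ((N + 1ℚ) * (N + 1ℚ) * (N + 1ℚ)) + (N + 1ℚ) * (N + 1ℚ) + (N + 1ℚ) + 2ℚ * p′ * (N + 1ℚ + 1ℚ))
    - 2ℚ * ((N + 1ℚ) * (N + 1ℚ) + 3ℚ * (N + 1ℚ) + 1ℚ)
    ≡⟨ solve 4 (λ N p h p′ →
         cf N p h :* (con 2ℚ :* ((N :+ con 1ℚ) :* (N :+ con 1ℚ :+ con 1ℚ)))
         :+ (con 2ℚ :* ((N :+ con 1ℚ) :* (N :+ con 1ℚ) :* (N :+ con 1ℚ)) :+ (N :+ con 1ℚ) :* (N :+ con 1ℚ) :+ (N :+ con 1ℚ) :+ con 2ℚ :* p′ :* (N :+ con 1ℚ :+ con 1ℚ))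
         :- con 2ℚ :* ((N :+ con 1ℚ) :* (N :+ con 1ℚ) :+ con 3ℚ :* (N :+ con 1ℚ) :+ con 1ℚ) :=
         cf (N :+ con 1ℚ) p′ h :* (con 2ℚ :* ((N :+ con 1ℚ) :* (N :+ con 1ℚ :+ con 1ℚ)))
         :- con 2ℚ :* (N :+ con 1ℚ :+ con 1ℚ) :* con 1ℚ
         :+ con 2ℚ :* (N :+ con 1ℚ :+ con 1ℚ) :* (con 2ℚ :* (N :+ con 1ℚ) :* p :- p′ :* (con 2ℚ :* N :+ con 1ℚ))) refl N p h p′ ⟩
  closedForm (N + 1ℚ) p′ h * D - 2ℚ * (N + 1ℚ + 1ℚ) * 1ℚ + 2ℚ * (N + 1ℚ + 1ℚ) * (2ℚ * (N + 1ℚ) * p - p′ * (2ℚ * N + 1ℚ))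
    -- The factor `1ℚ` becomes `r * (N + 1ℚ)`, to be absorbed into the harmonic number, and
    -- `ratio-suc` turns the last bracket into a difference of equal terms.
    ≡⟨ cong₂ (λ o z → closedForm (N + 1ℚ) p′ h * D - 2ℚ * (N + 1ℚ + 1ℚ) * o + 2ℚ * (N + 1ℚ + 1ℚ) * (z - p′ * (2ℚ * N + 1ℚ)))
         (trans (sym (/-* (+ 1) (suc n))) (cong (r *_) (ιℕ-suc n))) (sym (ratio-suc n)) ⟩
  closedForm (N + 1ℚ) p′ h * D - 2ℚ * (N + 1ℚ + 1ℚ) * (r * (N + 1ℚ))
    + 2ℚ * (N + 1ℚ + 1ℚ) * (p′ * (2ℚ * N + 1ℚ) - p′ * (2ℚ * N + 1ℚ))
    ≡⟨ solve 4 (λ N p′ h r →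
         cf (N :+ con 1ℚ) p′ h :* (con 2ℚ :* ((N :+ con 1ℚ) :* (N :+ con 1ℚ :+ con 1ℚ)))
         :- con 2ℚ :* (N :+ con 1ℚ :+ con 1ℚ) :* (r :* (N :+ con 1ℚ))
         :+ con 2ℚ :* (N :+ con 1ℚ :+ con 1ℚ) :* (p′ :* (con 2ℚ :* N :+ con 1ℚ) :- p′ :* (con 2ℚ :* N :+ con 1ℚ)) :=
         cf (N :+ con 1ℚ) p′ (h :+ r) :* (con 2ℚ :* ((N :+ con 1ℚ) :* (N :+ con 1ℚ :+ con 1ℚ)))) refl N p′ h r ⟩
  closedForm (N + 1ℚ) p′ (h + r) * D
    ≡⟨ cong₂ (λ k d → closedForm k p′ (h + r) * d) (ιℕ-suc n) ιD ⟨
  closedForm (ιℕ (suc n)) p′ (H (suc n)) * ιℕ (2 ℕ.* (suc n ℕ.* suc (suc n))) ∎)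
  where
  N = ιℕ n
  p = ratio n
  p′ = ratio (suc n)
  h = H n
  r = + 1 / suc n
  y = averageStep n
  D = 2ℚ * ((N + 1ℚ) * (N + 1ℚ + 1ℚ))
  ιD : ιℕ (2 ℕ.* (suc n ℕ.* suc (suc n))) ≡ D
  ιD = trans (ιℕ-* 2 (suc n ℕ.* suc (suc n))) (cong (2ℚ *_) (trans (ιℕ-* (suc n) (suc (suc n)))
    (cong₂ _*_ (ιℕ-suc n) (trans (ιℕ-suc (suc n)) (cong (_+ 1ℚ) (ιℕ-suc n))))))
  cf : ∀ {m} → (N p h : +-*-Solver.Polynomial m) → +-*-Solver.Polynomial m
  cf N p h = N :* (N :- con 2ℚ) :* con ½ :- con 2ℚ :* (:- p :+ h :* con ½ :+ con 1ℚ)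

ι-closedForm : ∀ n → (+ n ℤ.* (+ n ℤ.- + 2)) / 2 ≡ ιℕ n * (ιℕ n - 2ℚ) * ½
ι-closedForm n = /≡ (+ n ℤ.* (+ n ℤ.- + 2)) 2 (ιℕ n * (ιℕ n - 2ℚ) * ½) (begin
  ι (+ n ℤ.* (+ n ℤ.- + 2))          ≡⟨ ι-* (+ n) (+ n ℤ.- + 2) ⟩
  ιℕ n * ι (+ n ℤ.- + 2)             ≡⟨ cong (ιℕ n *_) (ι-+ (+ n) (ℤ.- + 2)) ⟩
  ιℕ n * (ιℕ n - 2ℚ)                 ≡⟨ solve 1 (λ N → N :* (N :- con 2ℚ) := N :* (N :- con 2ℚ) :* con ½ :* con 2ℚ) refl (ιℕ n) ⟩
  ιℕ n * (ιℕ n - 2ℚ) * ½ * 2ℚ        ∎)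

mainTheorem6 : ∀ (λ₂ : ℕ) .{{_ : NonZero λ₂}} →
    let instance _ = centralBinomial≢0 λ₂ in
    complexity (twoRow λ₂ λ₂ ≤-refl)
    ≡ (+ λ₂ ℤ.* (+ λ₂ ℤ.- + 2)) / 2
    - (+ 2 / 1) * (- (+ (2 ^ (2 ℕ.* λ₂)) / ((2 ℕ.* λ₂) C λ₂)) + H λ₂ * (+ 1 / 2) + 1ℚ)
mainTheorem6 λ₂ = begin
  complexity (twoRow λ₂ λ₂ ≤-refl)
    ≡⟨ ℚ./-cong (cong +_ (TwoRow.totalExchanges λ₂)) (cong _! (sym (dbl≡2* λ₂))) ⟩
  averageCost λ₂
    ≡⟨ averageCost-closed λ₂ ⟩
  closedForm (ιℕ λ₂) (ratio λ₂) (H λ₂)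
    ≡⟨ cong₂ (λ a p → a - 2ℚ * (- p + H λ₂ * ½ + 1ℚ)) (ι-closedForm λ₂)
         (ℚ./-cong (cong +_ (sym (ℕ.^-*-assoc 2 2 λ₂))) (centralBinomial≡C λ₂)) ⟨
  (+ λ₂ ℤ.* (+ λ₂ ℤ.- + 2)) / 2
    - (+ 2 / 1) * (- (+ (2 ^ (2 ℕ.* λ₂)) / ((2 ℕ.* λ₂) C λ₂)) + H λ₂ * (+ 1 / 2) + 1ℚ) ∎
  where instance
    _ = centralBinomial≢0 λ₂
    _ = catalan≢0 λ₂
    _ = ℕ.m*n≢0 (suc λ₂) (catalan λ₂)
    _ = dbl λ₂ !≢0
    _ = size (twoRow λ₂ λ₂ ≤-refl) !≢0
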